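{- Let $\mathbb S$ be a connected oriented surface with boundary, without punctures, with finitely many marked points on its boundary (at least one on each boundary component). Let $\mathcal T$ be an ideal triangulation of $\mathbb S$, and let $\gamma$ be a non-$\mathcal T$-diagonal. Consider the cluster structures of $\mathscr A_{\mathrm{SL}_{n+1},\mathbb S}$, $n\ge1$, with initial seed given by the $n$-triangulated quiver of $\mathcal T$. If the number of monomials (counted with multiplicity) in the Laurent expansion of the cluster variable of $\gamma$ for $n=1$ is $K$, then for general $n$ the numbers of monomials (counted with multiplicity) in the Laurent expansions of the $n$ cluster variables on $\gamma$, listed in order along $\gamma$, are $$(K^n,K^{2n-2},\dots,K^{t(n+1-t)},\dots,K^{2n-2},K^n).$$
   Context: **Mutation.** Mutation of a seed at a mutable vertex $k$ replaces $x_k$ by $x_k'=\frac1{x_k}\left(\prod_{k\to i}x_i+\prod_{j\to k}x_j\right)$ and changes the quiver by the usual quiver mutation. Arrows between frozen vertices are ignored. **$n$-triangulated quiver.** For a triangle with corners $P,Q,R$ in clockwise order, the quiver vertices are the points $(a,b,c):=\frac{aP+bQ+cR}{n+1}$ with $a,b,c\in\mathbb Z_{\ge0}$, $a+b+c=n+1$, except the three corners. For every $(u_1,u_2,u_3)\in\mathbb Z_{\ge1}^3$ with sum $n+2$ there is a 3-cycle of arrows $(u_1-1,u_2,u_3)\to(u_1,u_2,u_3-1)\to(u_1,u_2-1,u_3)\to(u_1-1,u_2,u_3)$. For a triangulated surface glue the quivers of the triangles along common edges. Vertices on $\partial\mathbb S$ are frozen, all others mutable. This seed defines the cluster structure of $\mathscr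 A_{\mathrm{SL}_{n+1},\mathbb S}$ used here. For $n=1$ it is the usual cluster algebra of the surface, with one variable per arc. **Flip.** Flipping an arc replaces it by the other diagonal of the quadrilateral formed by its two adjacent triangles. On seeds: identify the quadrilateral with the square $[0,n+1]^2$ so that the arc to be flipped joins $(0,0)$ to $(n+1,n+1)$ and the quiver vertices are the non-corner integer points. For $k=1,\dots,n$ successively, mutate at all integer points $(i,j)$ with $i-j\equiv k-1\pmod2$, $|i-j|\le k-1$, $|i+j-(n+1)|\le n-k$. The result is the $n$-triangulated quiver of the new triangulation, whose new arc joins $(n+1,0)$ to $(0,n+1)$. **Variables on $\gamma$.** A non-$\mathcal T$-diagonal is an arc $\gamma$ that intersects each arc of $\mathcal T$ exactly once. The cluster variables on $\gamma$ are the $n$ variables at the quiver vertices on $\gamma$ in the seed of a triangulation containing $\gamma$ obtained from $\mathcal T$ by flips. They are Laurent polynomials with positive integer coefficients in the initial variables. The number of monomials counted with multiplicity is the sum of the coefficients. -}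

module Defs where

open import Data.Bool.Base using (Bool; true; false; not; if_then_else_)
open import Data.Fin.Base using (Fin; zero; suc)
import Data.Fin.Properties as Fin
open import Data.Integer.Base as ℤ using (ℤ; +_; -[1+_])
import Data.Integer.Properties as ℤ
open import Data.List.Base
  using (List; []; _∷_; _++_; map; concatMap; cartesianProduct; cartesianProductWith;
         filter; foldr; foldl; length; upTo; allFin)
open import Data.List.NonEmpty.Base as List⁺ using (List⁺; _⁺++⁺_)
open import Data.List.Relation.Unary.All using (all?)
open import Data.Nat.Base
open import Data.Nat.DivMod using (_%_)
import Data.Nat.Properties as ℕ
open import Data.Product.Base using (_×_; _,_; ∃; proj₁; proj₂)
import Data.Product.Properties as Product
open import Data.Sum.Base using (_⊎_; inj₁; inj₂)
import Data.Sum.Properties as Sum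
open import Function.Base using (_∘_)
open import Function.Definitions using (Injective)
open import Relation.Binary.Construct.Closure.Equivalence using (EqClosure)
open import Relation.Binary.Construct.Closure.ReflexiveTransitive using (Star)
open import Relation.Binary.Definitions using (DecidableEquality)
open import Relation.Binary.PropositionalEquality using (_≡_)
open import Relation.Nullary.Decidable using (does; yes; no; _×-dec_)
open import Relation.Nullary.Negation using (¬_)

------------------------------------------------------------------------
-- Rational functions and Laurent polynomials in a finite list of variables

-- Exponent vectors are functions on V; only their values on vars matter.
module RationalFunctions {V : Set} (_≟_ : DecidableEquality V) (vars : List V) where

  Laurent : Set
  Laurent = List (ℤ × (V → ℤ))

  coefficient : (V → ℤ) → Laurent → ℤ
  coefficient e []            = + 0
  coefficient e ((c , d) ∷ L) =
    (if does (all? (λ v → e v ℤ.≟ d v) vars) then c else + 0) ℤ.+ coefficient e L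

  infix 4 _≈_
  _≈_ : Laurent → Laurent → Set
  L ≈ M = ∀ e → coefficient e L ≡ coefficient e M

  infixl 7 _⊗_
  _⊗_ : Laurent → Laurent → Laurent
  _⊗_ = cartesianProductWith λ (c , e) (d , f) → c ℤ.* d , λ v → e v ℤ.+ f v

  coefficientSum : Laurent → ℤ
  coefficientSum = foldr (λ (c , _) s → c ℤ.+ s) (+ 0)

  -- A nonempty sum of monomials, i.e. a nonzero polynomial with coefficients in ℕ.
  Polynomial : Set
  Polynomial = List⁺ (V → ℕ)

  infixl 6 _⊞_
  _⊞_ : Polynomial → Polynomial → Polynomial
  _⊞_ = _⁺++⁺_

  infixl 7 _⊠_
  _⊠_ : Polynomial → Polynomial → Polynomial
  p ⊠ q = List⁺.concatMap (λ e → List⁺.map (λ f v → e v + f v) q) p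

  𝟙 : Polynomial
  𝟙 = List⁺.[ (λ _ → 0) ]

  ⟦_⟧ : Polynomial → Laurent
  ⟦ p ⟧ = map (λ e → + 1 , λ v → + e v) (List⁺.toList p)

  -- Mutation never subtracts, so all cluster variables are quotients of nonzero
  -- polynomials with coefficients in ℕ, and no division by zero can occur.
  infix 5 _÷_
  record Rational : Set where
    constructor _÷_
    field
      numerator denominator : Polynomial
  open Rational

  generator : V → Rational
  generator v = List⁺.[ (λ w → if does (v ≟ w) then 1 else 0) ] ÷ 𝟙

  one : Rational
  one = 𝟙 ÷ 𝟙

  add mul div : Rational → Rational → Rational
  add (p ÷ q) (r ÷ s) = (p ⊠ s ⊞ r ⊠ q) ÷ (q ⊠ s)
  mul (p ÷ q) (r ÷ s) = (p ⊠ r) ÷ (q ⊠ s)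
  div (p ÷ q) (r ÷ s) = (p ⊠ s) ÷ (q ⊠ r)

  power : Rational → ℕ → Rational
  power x zero    = one
  power x (suc m) = mul x (power x m)

  IsLaurentExpansion : Laurent → Rational → Set
  IsLaurentExpansion L x = ⟦ numerator x ⟧ ≈ L ⊗ ⟦ denominator x ⟧

------------------------------------------------------------------------
-- Seeds and mutation

positivePart : ℤ → ℕ
positivePart (+ m)    = m
positivePart -[1+ _ ] = 0

module Seeds {V : Set} (_≟_ : DecidableEquality V) (vars : List V) where
  open RationalFunctions _≟_ vars

  -- arrows v w is the number of arrows v → w minus the number of arrows w → v.
  record Seed : Set where
    field
      arrows  : V → V → ℤ
      cluster : V → Rational
  open Seed public

  -- The quiver with the given list of arrows, all 2-cycles cancelled.
  quiver : List (V × V) → V → V → ℤ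
  quiver as v w = + count (v , w) ℤ.- + count (w , v)
    where
    count : V × V → ℕ
    count a = length (filter (Product.≡-dec _≟_ _≟_ a) as)

  mutate : V → Seed → Seed
  mutate k s = record { arrows = b′ ; cluster = x′ }
    where
    b = arrows s
    x = cluster s

    b′ : V → V → ℤ
    b′ v w with v ≟ k | w ≟ k
    ... | no _ | no _ = b v w ℤ.+ + (positivePart (b v k) * positivePart (b k w))
                              ℤ.- + (positivePart (b w k) * positivePart (b k v))
    ... | _    | _    = ℤ.- b v w

    product : (V → ℕ) → Rational
    product e = foldr (λ v r → mul (power (x v) (e v)) r) one vars

    x′ : V → Rational
    x′ v with v ≟ k
    ... | yes _ = div (add (product λ i → positivePart (b k i))
                           (product λ j → positivePart (b j k)))
                      (x k)
    ... | no _  = x v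

  mutateAll : List V → Seed → Seed
  mutateAll ks s = foldl (λ s k → mutate k s) s ks

------------------------------------------------------------------------
-- Ideal triangulations

-- The corners of each triangle are numbered clockwise; (τ , i) stands for the side of τ
-- going clockwise from corner i to the next corner.
Side : ℕ → Set
Side t = Fin t × Fin 3

rotate : Fin 3 → Fin 3
rotate zero             = suc zero
rotate (suc zero)       = suc (suc zero)
rotate (suc (suc zero)) = zero

next prev : ∀ {t} → Side t → Side t
next (τ , i) = τ , rotate i
prev = next ∘ next

_≟ˢ_ : ∀ {t} → DecidableEquality (Side t)
_≟ˢ_ = Product.≡-dec Fin._≟_ Fin._≟_

-- An edge (arc or boundary segment) with one of its two orientations.
OrientedEdge : ℕ → Set
OrientedEdge m = Fin m × Bool

opposite : ∀ {m} → OrientedEdge m → OrientedEdge m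
opposite (e , b) = e , not b

module Gluing {t m : ℕ} (edge : Side t → OrientedEdge m) where

  Glued : Side t → Side t → Set
  Glued h k = edge k ≡ opposite (edge h)

  Adjacent : Fin t → Fin t → Set
  Adjacent τ σ = ∃ λ i → ∃ λ j → Glued (τ , i) (σ , j)

  -- Turning around the initial corner of a side, from triangle to triangle, one
  -- arrives at the boundary; around a puncture one would turn forever.
  data ReachesBoundary (h : Side t) : Set where
    here : (∀ k → ¬ Glued h k) → ReachesBoundary h
    turn : ∀ {k} → Glued h k → ReachesBoundary (next k) → ReachesBoundary h

-- The surface is the union of t triangles glued along their sides. Every edge occurs
-- at most once in each orientation, i.e. it is a side of one triangle (a boundary
-- segment) or is glued, compatibly with the orientation, from two sides (an arc).
record Triangulation (t m : ℕ) : Set where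
  field
    edge           : Side t → OrientedEdge m
    edge-injective : Injective _≡_ _≡_ edge
    edge-covers    : ∀ e → ∃ λ h → proj₁ (edge h) ≡ e
  open Gluing edge public
  field
    connected  : ∀ τ σ → Star Adjacent τ σ
    unpunctured : ∀ h → ReachesBoundary h

  IsArc : Fin m → Set
  IsArc e = ∃ λ h → ∃ λ k → proj₁ (edge h) ≡ e × Glued h k

open Triangulation public using (edge)

-- Data on the sides after the triangles of two sides h and k have been replaced: x₁ , x₂ ,
-- x₃ on h , next h , prev h and y₁ , y₂ , y₃ on k , next k , prev k; f on all other sides.
replace : ∀ {t} {X : Set} (h k : Side t) (x₁ x₂ x₃ y₁ y₂ y₃ : X) (f : Side t → X) → Side t → X
replace h k x₁ x₂ x₃ y₁ y₂ y₃ f s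
  with s ≟ˢ h | s ≟ˢ next h | s ≟ˢ prev h | s ≟ˢ k | s ≟ˢ next k | s ≟ˢ prev k
... | yes _ | _     | _     | _     | _     | _     = x₁
... | no _  | yes _ | _     | _     | _     | _     = x₂
... | no _  | no _  | yes _ | _     | _     | _     = x₃
... | no _  | no _  | no _  | yes _ | _     | _     = y₁
... | no _  | no _  | no _  | no _  | yes _ | _     = y₂
... | no _  | no _  | no _  | no _  | no _  | yes _ = y₃
... | no _  | no _  | no _  | no _  | no _  | no _  = f s

-- Clockwise around the quadrilateral of the arc glued from h and k lie the sides prev h ,
-- next k , prev k , next h. The new triangle at h consists of the new arc (which inherits
-- the name of the old one), prev h and next k; the one at k of the new arc, prev k, next h.
flippedEdge : ∀ {t m} → Side t → Side t → (Side t → OrientedEdge m) → Side t → OrientedEdge m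
flippedEdge h k f =
  replace h k (f h) (f (prev h)) (f (next k)) (f k) (f (prev k)) (f (next h)) f

record Flip {t m} (T T′ : Triangulation t m) : Set where
  field
    h k    : Side t
    glued  : Triangulation.Glued T h k
    result : ∀ s → edge T′ s ≡ flippedEdge h k (edge T) s

infixl 5 _▷_
data Flips {t m} (T : Triangulation t m) : Triangulation t m → Set where
  start : Flips T T
  _▷_   : ∀ {T₁ T₂} → Flips T T₁ → Flip T₁ T₂ → Flips T T₂

------------------------------------------------------------------------
-- Homotopy classes of curves between marked points

module Homotopy {t m} (T : Triangulation t m) where
  open Triangulation T

  -- An edge path; up to homotopy every curve between marked points is one.
  Path : Set
  Path = List (OrientedEdge m)

  data Step : Path → Path → Set where
    backtrack : ∀ p q o → Step (p ++ o ∷ opposite o ∷ q) (p ++ q)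
    triangle  : ∀ p q h →
      Step (p ++ edge T h ∷ edge T (next h) ∷ edge T (prev h) ∷ q) (p ++ q)

  infix 4 _≃_
  _≃_ : Path → Path → Set
  _≃_ = EqClosure Step

  -- A curve in minimal position with respect to the arcs of T, from the moment it enters
  -- a triangle through h: it ends at the opposite corner or leaves through another side.
  data Entered (h : Side t) : Set where
    stop    : Entered h
    viaNext : ∀ {k} → Glued (next h) k → Entered k → Entered h
    viaPrev : ∀ {k} → Glued (prev h) k → Entered k → Entered h

  -- The curve starts at the corner opposite to exit and leaves that triangle through exit.
  record Curve : Set where
    field
      {exit entry} : Side t
      glued        : Glued exit entry
      rest         : Entered entry

  crossedAfter : ∀ {h} → Entered h → List (Fin m)
  crossedAfter stop                = []
  crossedAfter {h} (viaNext _ c)   = proj₁ (edge T (next h)) ∷ crossedAfter c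
  crossedAfter {h} (viaPrev _ c)   = proj₁ (edge T (prev h)) ∷ crossedAfter c

  crossed : Curve → List (Fin m)
  crossed c = proj₁ (edge T (Curve.exit c)) ∷ crossedAfter (Curve.rest c)

  -- A homotopic edge path running along one side of the curve. The remaining path after
  -- a crossing starts at the final corner of the side h of entry.
  pathAfter : ∀ {h} → Entered h → Path
  pathAfter {h} stop          = edge T (next h) ∷ []
  pathAfter {h} (viaNext _ c) = pathAfter c
  pathAfter {h} (viaPrev _ c) = edge T (next h) ∷ pathAfter c

  path : Curve → Path
  path c = edge T (prev (Curve.exit c)) ∷ pathAfter (Curve.rest c)

  -- That the curve can be drawn without self-intersections is not recorded here: it holds
  -- as soon as the curve is homotopic to an arc of some triangulation.
  record NonTDiagonal : Set where
    field
      curve       : Curve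
      crossesOnce : ∀ e → IsArc e → length (filter (e Fin.≟_) (crossed curve)) ≡ 1

  -- The homotopy classes in the surface of the sides of a triangulation obtained by flips.
  sidePath : ∀ {T′} → Flips T T′ → Side t → Path
  sidePath start    h = edge T h ∷ []
  sidePath (φ ▷ fl) =
    replace h k (f (prev k) ++ f (next h)) (f (prev h)) (f (next k))
                (f (prev h) ++ f (next k)) (f (prev k)) (f (next h)) f
    where
    open Flip fl
    f = sidePath φ

  -- The side h of the last triangulation, oriented clockwise, is γ.
  IsSide : ∀ {T′} → Flips T T′ → Side t → NonTDiagonal → Set
  IsSide φ h γ = sidePath φ h ≃ path (NonTDiagonal.curve γ)

------------------------------------------------------------------------
-- The n-triangulated quiver and its flips

-- All (a , b , c) with a , b , c ≥ 1 and a + b + c ≡ s.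
positiveTriples : ℕ → List (ℕ × ℕ × ℕ)
positiveTriples s =
  filter (λ (a , b , c) → 1 ℕ.≤? a ×-dec 1 ℕ.≤? b ×-dec 1 ℕ.≤? c ×-dec a + b + c ℕ.≟ s)
         (cartesianProduct (upTo s) (cartesianProduct (upTo s) (upTo s)))

-- Names for the vertices of the initial n-triangulated quiver; those that are actually
-- vertices are listed by vertices n. onEdge e s is the point at distance s from the
-- initial end of (e , true), where the edge has length n + 1.
Vertex : ℕ → ℕ → Set
Vertex t m = (Fin m × ℕ) ⊎ (Fin t × ℕ × ℕ × ℕ)

pattern onEdge e s         = inj₁ (e , s)
pattern inTriangle τ a b c = inj₂ (τ , a , b , c)

_≟ᵛ_ : ∀ {t m} → DecidableEquality (Vertex t m)
_≟ᵛ_ = Sum.≡-dec (Product.≡-dec Fin._≟_ ℕ._≟_)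
                 (Product.≡-dec Fin._≟_ (Product.≡-dec ℕ._≟_ (Product.≡-dec ℕ._≟_ ℕ._≟_)))

vertices : ∀ {t m} → ℕ → List (Vertex t m)
vertices {t} {m} n =
  cartesianProductWith (λ e s → onEdge e (suc s)) (allFin m) (upTo n) ++
  cartesianProductWith (λ τ (a , b , c) → inTriangle τ a b c) (allFin t) (positiveTriples (suc n))

-- chart h a b c is the vertex at the point (aP + bQ + cR)/(n + 1) of the triangle having
-- h as a side, where h goes from P to Q and R is the opposite corner. Charts are used
-- only for a + b + c ≡ n + 1 and away from the corners.
Chart : ℕ → ℕ → Set
Chart t m = Side t → ℕ → ℕ → ℕ → Vertex t m

module _ {t m : ℕ} where

  -- Extend charts given at the sides (τ , 0) to all sides.
  fromZero : (Fin t → ℕ → ℕ → ℕ → Vertex t m) → Chart t m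
  fromZero f (τ , zero)           a b c = f τ a b c
  fromZero f (τ , suc zero)       a b c = f τ c a b
  fromZero f (τ , suc (suc zero)) a b c = f τ b c a

  initialChart : Triangulation t m → Chart t m
  initialChart T = fromZero place
    where
    onSide : OrientedEdge m → ℕ → ℕ → Vertex t m
    onSide (e , true)  a b = onEdge e b
    onSide (e , false) a b = onEdge e a

    place : Fin t → ℕ → ℕ → ℕ → Vertex t m
    place τ a zero c    = onSide (edge T (τ , suc (suc zero))) c a
    place τ zero b c    = onSide (edge T (τ , suc zero)) b c
    place τ a b zero    = onSide (edge T (τ , zero)) a b
    place τ a b c       = inTriangle τ a b c

module Cluster {t m : ℕ} (n : ℕ) where
  open RationalFunctions _≟ᵛ_ (vertices {t} {m} n) public
  open Seeds _≟ᵛ_ (vertices {t} {m} n) public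

  quiverArrows : Chart t m → List (Vertex t m × Vertex t m)
  quiverArrows χ =
    concatMap (λ τ → concatMap (cycle (χ (τ , zero))) (positiveTriples (2 + n))) (allFin t)
    where
    cycle : (ℕ → ℕ → ℕ → Vertex t m) → ℕ × ℕ × ℕ → List (Vertex t m × Vertex t m)
    cycle p (u₁ , u₂ , u₃) =
      (p (pred u₁) u₂ u₃ , p u₁ u₂ (pred u₃)) ∷
      (p u₁ u₂ (pred u₃) , p u₁ (pred u₂) u₃) ∷
      (p u₁ (pred u₂) u₃ , p (pred u₁) u₂ u₃) ∷ []

  -- Only vertices inside a quadrilateral are ever mutated, so the frozen vertices and
  -- the (irrelevant) arrows between them need not be singled out.
  initialSeed : Triangulation t m → Seed
  initialSeed T = record
    { arrows  = quiver (quiverArrows (initialChart T))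
    ; cluster = generator
    }

  -- The square [0 , n + 1]² made of the two triangles at the glued sides h and k. Its
  -- corners (0 , 0) and (n + 1 , n + 1) are the ends of h in this order, (n + 1 , 0) is
  -- the corner opposite to h and (0 , n + 1) is the corner opposite to k.
  square : (h k : Side t) → Chart t m → ℕ → ℕ → Vertex t m
  square h k χ i j with j ℕ.≤? i
  ... | yes _ = χ h (suc n ∸ i) j (i ∸ j)
  ... | no _  = χ k i (suc n ∸ j) (j ∸ i)

  -- The points mutated in round 1 + r. No arrows join the points of one round at that
  -- stage, so their order is irrelevant.
  round : ℕ → List (ℕ × ℕ)
  round r = filter
    (λ (i , j) → ∣ i - j ∣ % 2 ℕ.≟ r % 2 ×-dec ∣ i - j ∣ ℕ.≤? r ×-dec
                 ∣ i + j - suc n ∣ ℕ.≤? n ∸ suc r)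
    (cartesianProduct (upTo (2 + n)) (upTo (2 + n)))

  -- Mutation keeps the vertices; only the way they are placed in the triangles changes.
  chartAfter : ∀ {T T′} → Flips T T′ → Chart t m
  chartAfter {T} start = initialChart T
  chartAfter (φ ▷ fl)  =
    replace h k (λ a b c → □ b a)             (λ a b c → □ a c)             (λ a b c → □ c b)
                (λ a b c → □ (a + c) (b + c)) (λ a b c → □ (b + c) (a + b)) (λ a b c → □ (a + b) (a + c))
                χ
    where
    open Flip fl
    χ = chartAfter φ
    □ = square h k χ

  seedAfter : ∀ {T T′} → Flips T T′ → Seed
  seedAfter {T} start = initialSeed T
  seedAfter (φ ▷ fl)  =
    mutateAll
      (concatMap (λ r → map (λ (i , j) → square h k (chartAfter φ) i j) (round r)) (upTo n))
      (seedAfter φ)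
    where open Flip fl

  -- The variable at the point at distance s from the initial end of the side h.
  variableOn : ∀ {T T′} → Flips T T′ → Side t → ℕ → Rational
  variableOn φ h s = cluster (seedAfter φ) (chartAfter φ h (suc n ∸ s) s 0)

{-# OPTIONS --safe #-}
module Submission where

-- Set all initial variables to 1: the sum of the coefficients of a Laurent expansion becomes
-- the value of the cluster variable, and mutation becomes a recursion for positive rational
-- numbers. Write x_e for the values in the case n = 1; under flips they obey Ptolemy's
-- relation. For every n and every triangulation reached by flips, the variable at the point
-- (a , b , c) of a triangle PQR then has the value
--     x_PQ^(ab) x_QR^(bc) x_RP^(ca),
-- which on an edge is x_e^(s(n+1-s)). Initially this holds since all values are 1. For the
-- flip in a quadrilateral give the point of weights (w_P , w_Q , w_R , w_S), where
-- w_P + w_Q + w_R + w_S = n + 1, the value ∏ x_XY^(w_X w_Y) over the six pairs of corners.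
-- By Ptolemy's relation these values satisfy the octahedron recurrence, and each mutation of
-- the flip is an instance of it: it raises by 2 the height of one point of a surface in the
-- tetrahedron of all weights, which moves from the two old triangles to the two new ones.
-- That the quiver has the four arrows needed at each mutated point follows from a formula
-- for the quiver of a surface that is linear in the heights.

-- The tetrahedron lies over the square of a flip: weights w₀₀, w₁₀, w₁₁, w₀₁ of the corners give
-- the point (w₁₀ + w₁₁ , w₀₁ + w₁₁) at height w₁₀ + w₀₁. The lower faces w₁₀ = 0 and w₀₁ = 0 are
-- the old triangles, the upper faces w₀₀ = 0 and w₁₁ = 0 the new ones. Raising a height by 2 takes
-- one unit of weight from each of 00 and 11 and gives one to each of 10 and 01. The obstacle is
-- that opposite sides of the quadrilateral may be glued to each other, so that different boundary
-- points of the square are one vertex and double arrows occur. Entries of the exchange matrix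
-- therefore cannot be indexed by points. Instead every arrow between two points contributes to
-- every entry, and heights are the coefficients of these contributions. A mutation then requires
-- only that the mutated point differs from all other points and that its out-neighbours differ from
-- its in-neighbours; the latter is where the absence of punctures enters. The quiver is doubled
-- because heights change by 1 along the sides of a unit square but by 0 or 2 between opposite
-- corners.

open import Algebra.Bundles using (CommutativeRing)
import Algebra.Properties.CommutativeSemiring.Exp
open import Data.Bool.Base using (Bool; true; false; _∧_; if_then_else_)
import Data.Bool.Properties as Bool
open import Data.Empty using (⊥; ⊥-elim)
open import Data.Fin.Base using (Fin; zero; suc)
import Data.Fin.Properties as Fin
open import Data.Integer.Base as ℤ using (ℤ; +_; -[1+_])
import Data.Integer.Properties as ℤ
import Data.Integer.Tactic.RingSolver as ℤ-solver
open import Data.List.Base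
  using (List; []; _∷_; _++_; map; concat; concatMap; filter; foldr; length; upTo; applyUpTo;
         allFin; cartesianProduct)
open import Data.List.Membership.Propositional using (_∈_; _∉_)
open import Data.List.Membership.Propositional.Properties
  using (∈-++⁺ˡ; ∈-++⁺ʳ; ∈-allFin; ∈-upTo⁺; ∈-upTo⁻; ∈-filter⁺; ∈-filter⁻;
         ∈-cartesianProduct⁺; ∈-cartesianProduct⁻; ∈-cartesianProductWith⁺; ∈-cartesianProductWith⁻)
open import Data.List.NonEmpty.Base as List⁺ using (_∷_; toList)
import Data.List.NonEmpty.Properties as List⁺
import Data.List.Properties as List
open import Data.List.Relation.Unary.All as All using (All; all?)
open import Data.List.Relation.Unary.AllPairs.Core using (_∷_)
open import Data.List.Relation.Unary.Any using (here; there)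
open import Data.List.Relation.Unary.Unique.Propositional using (Unique)
import Data.List.Relation.Unary.Unique.Propositional.Properties as Unique
open import Data.Nat.Base as ℕ
  using (ℕ; zero; suc; pred; z≤n; s≤s; _+_; _*_; _^_; _∸_; _⊔_; _⊓_; _≤_; _<_; _<ᵇ_; _≡ᵇ_; ∣_-_∣)
open import Data.Nat.DivMod using (_%_)
import Data.Nat.Properties as ℕ
import Data.Nat.Tactic.RingSolver as ℕ-solver
open import Data.Product.Base using (_×_; _,_; ∃; proj₁; proj₂)
import Data.Product.Properties as Product
open import Data.Rational.Base as ℚ using (ℚ; 1ℚ; fromℚᵘ; toℚᵘ)
import Data.Rational.Properties as ℚ
import Data.Rational.Solver as ℚ-solver
open import Data.Rational.Unnormalised.Base as ℚᵘ using (mkℚᵘ; *≡*)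
import Data.Rational.Unnormalised.Properties as ℚᵘ
open import Data.Sum.Base using (_⊎_; inj₁; inj₂)
open import Function.Base using (_∘_; id)
open import Relation.Binary.Definitions using (DecidableEquality; tri<; tri≈; tri>)
open import Relation.Binary.PropositionalEquality
open import Relation.Nullary.Decidable using (Dec; does; yes; no; _×-dec_; ¬?; dec-true; dec-false)
open import Relation.Nullary.Negation using (¬_; contradiction)
open import Relation.Unary using (Decidable)
open import Defs

open Algebra.Properties.CommutativeSemiring.Exp
  (CommutativeRing.commutativeSemiring ℚ.+-*-commutativeRing)
  using () renaming (_^_ to _^ℚ_; ^-homo-* to ^ℚ-homo-*)

-- Values at the point where all variables are 1

ι : ℕ → ℚ
ι n = fromℚᵘ (mkℚᵘ (+ n) 0)

ι-homo-+ : ∀ m n → ι (m + n) ≡ ι m ℚ.+ ι n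
ι-homo-+ m n = ℚ.toℚᵘ-injective (let open ℚᵘ.≃-Reasoning in begin
  toℚᵘ (ι (m + n))                    ≈⟨ ℚ.toℚᵘ-fromℚᵘ _ ⟩
  mkℚᵘ (+ (m + n)) 0                  ≈⟨ *≡* (cong (ℤ._* + 1) (sym (cong₂ ℤ._+_ (ℤ.*-identityʳ (+ m))
      (ℤ.*-identityʳ (+ n))))) ⟩
  mkℚᵘ (+ m) 0 ℚᵘ.+ mkℚᵘ (+ n) 0        ≈⟨ ℚᵘ.+-cong (ℚ.toℚᵘ-fromℚᵘ (mkℚᵘ (+ m) 0))
      (ℚ.toℚᵘ-fromℚᵘ (mkℚᵘ (+ n) 0)) ⟨
  toℚᵘ (ι m) ℚᵘ.+ toℚᵘ (ι n)            ≈⟨ ℚ.toℚᵘ-homo-+ (ι m) (ι n) ⟨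
  toℚᵘ (ι m ℚ.+ ι n)                    ∎)

ι-homo-* : ∀ m n → ι (m * n) ≡ ι m ℚ.* ι n
ι-homo-* m n = ℚ.toℚᵘ-injective (let open ℚᵘ.≃-Reasoning in begin
  toℚᵘ (ι (m * n))                    ≈⟨ ℚ.toℚᵘ-fromℚᵘ _ ⟩
  mkℚᵘ (+ (m * n)) 0                  ≈⟨ *≡* (cong (ℤ._* + 1) (ℤ.pos-* m n)) ⟩
  mkℚᵘ (+ m) 0 ℚᵘ.* mkℚᵘ (+ n) 0        ≈⟨ ℚᵘ.*-cong (ℚ.toℚᵘ-fromℚᵘ (mkℚᵘ (+ m) 0))
      (ℚ.toℚᵘ-fromℚᵘ (mkℚᵘ (+ n) 0)) ⟨
  toℚᵘ (ι m) ℚᵘ.* toℚᵘ (ι n)            ≈⟨ ℚ.toℚᵘ-homo-* (ι m) (ι n) ⟨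
  toℚᵘ (ι m ℚ.* ι n)                    ∎)

open ≡-Reasoning

ι-injective : ∀ {m n} → ι m ≡ ι n → m ≡ n
ι-injective {m} {n} eq with ℚ.fromℚᵘ-injective {mkℚᵘ (+ m) 0} {mkℚᵘ (+ n) 0} eq
... | *≡* e = ℤ.+-injective (trans (sym (ℤ.*-identityʳ (+ m))) (trans e (ℤ.*-identityʳ (+ n))))

*ι-cancelʳ : ∀ {r s} n → r ℚ.* ι (suc n) ≡ s ℚ.* ι (suc n) → r ≡ s
*ι-cancelʳ {r} {s} n eq = begin
  r                             ≡⟨ lemma r ⟨
  r ℚ.* ι (suc n) ℚ.* ℚ.1/ d    ≡⟨ cong (ℚ._* ℚ.1/ d) eq ⟩
  s ℚ.* ι (suc n) ℚ.* ℚ.1/ d    ≡⟨ lemma s ⟩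
  s                             ∎
  where
  d = ι (suc n)
  instance
    d≢0 : ℚ.NonZero d
    d≢0 = ℚ.≢-nonZero λ e → contradiction (ι-injective {suc n} {0} e) λ ()
  lemma : ∀ x → x ℚ.* d ℚ.* ℚ.1/ d ≡ x
  lemma x = trans (ℚ.*-assoc x d _) (trans (cong (x ℚ.*_) (ℚ.*-inverseʳ d)) (ℚ.*-identityʳ x))

module Evaluation {V : Set} (_≟_ : DecidableEquality V) (vars : List V) where
  open RationalFunctions _≟_ vars

  Exponent : Set
  Exponent = V → ℤ

  same? : (e d : Exponent) → Dec (All (λ v → e v ≡ d v) vars)
  same? e d = all? (λ v → e v ℤ.≟ d v) vars

  -- Exponents matter only through their values on `vars`, and a `Laurent` may list the same
  -- monomial several times. Removing a whole class of `same?` takes exactly one coefficient out of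
  -- the list and leaves the others as they were.
  removeClass : Exponent → Laurent → Laurent
  removeClass d = filter (λ x → ¬? (same? d (proj₂ x)))

  sum-removeClass : ∀ d L → coefficientSum L ≡ coefficient d L ℤ.+ coefficientSum (removeClass d L)
  sum-removeClass d [] = refl
  sum-removeClass d ((c , e) ∷ L) with same? d e
  ... | yes _ = trans (cong (ℤ._+_ c) (sum-removeClass d L)) (sym (ℤ.+-assoc c _ _))
  ... | no _  = trans (cong (ℤ._+_ c) (sum-removeClass d L)) (lemma c (coefficient d L) _)
    where
    lemma : ∀ x y z → x ℤ.+ (y ℤ.+ z) ≡ (+ 0 ℤ.+ y) ℤ.+ (x ℤ.+ z)
    lemma = ℤ-solver.solve-∀

  coefficient-removeClass : ∀ d L →
    (∀ e → coefficient e L ≡ + 0) → ∀ e → coefficient e (removeClass d L) ≡ + 0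
  coefficient-removeClass d L L≈0 e with same? d e
  ... | yes d~e = go L
    where
    go : ∀ M → coefficient e (removeClass d M) ≡ + 0
    go []            = refl
    go ((c , f) ∷ M) with same? d f
    ... | yes _   = go M
    ... | no ¬d~f
        rewrite dec-false (same? e f) (λ e~f → ¬d~f (All.zipWith (λ (p , q) → trans p q) (d~e , e~f))) =
      trans (ℤ.+-identityˡ _) (go M)
  ... | no ¬d~e = trans (go L) (L≈0 e)
    where
    go : ∀ M → coefficient e (removeClass d M) ≡ coefficient e M
    go []            = refl
    go ((c , f) ∷ M) with same? d f
    ... | no _    = cong (ℤ._+_ (if does (same? e f) then c else + 0)) (go M)
    ... | yes d~f
        rewrite dec-false (same? e f) (λ e~f → ¬d~e (All.zipWith (λ (p , q) → trans p (sym q)) (d~f , e~f))) =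
      trans (go M) (sym (ℤ.+-identityˡ _))

  -- Induction on a bound for the length: the class of the first term contributes one coefficient,
  -- which is zero, and what remains after removing the class is strictly shorter and again has only
  -- zero coefficients.
  sum-zero : ∀ n L → length L ≤ n → (∀ e → coefficient e L ≡ + 0) → coefficientSum L ≡ + 0
  sum-zero n       []              _         _   = refl
  sum-zero (suc n) L@((c , d) ∷ M) (s≤s len) L≈0 = begin
    coefficientSum L                                        ≡⟨ sum-removeClass d L ⟩
    coefficient d L ℤ.+ coefficientSum (removeClass d L)    ≡⟨ cong₂ ℤ._+_ (L≈0 d)
      (sum-zero n (removeClass d L) shorter (coefficient-removeClass d L L≈0)) ⟩
    + 0                                                     ∎
    where
    shorter : length (removeClass d L) ≤ n
    shorter rewrite dec-true (same? d d) (All.universal (λ _ → refl) vars) =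
      ℕ.≤-trans (List.length-filter _ M) len

  negate : Laurent → Laurent
  negate = map λ (c , e) → ℤ.- c , e

  coefficient-minus : ∀ e L M → coefficient e (L ++ negate M) ≡ coefficient e L ℤ.- coefficient e M
  coefficient-minus e ((c , d) ∷ L) M =
    let a = if does (same? e d) then c else + 0 in
    trans (cong (ℤ._+_ a) (coefficient-minus e L M)) (sym (ℤ.+-assoc a (coefficient e L) _))
  coefficient-minus e [] [] = refl
  coefficient-minus e [] ((c , d) ∷ M) with does (same? e d)
  ... | true  = trans (cong (ℤ._+_ (ℤ.- c)) (coefficient-minus e [] M)) (lemma c _)
    where
    lemma : ∀ x y → ℤ.- x ℤ.+ (+ 0 ℤ.- y) ≡ + 0 ℤ.- (x ℤ.+ y)
    lemma = ℤ-solver.solve-∀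
  ... | false = trans (ℤ.+-identityˡ _) (trans (coefficient-minus e [] M)
                  (cong (λ z → + 0 ℤ.- z) (sym (ℤ.+-identityˡ (coefficient e M)))))

  sum-minus : ∀ L M → coefficientSum (L ++ negate M) ≡ coefficientSum L ℤ.- coefficientSum M
  sum-minus ((c , _) ∷ L) M = trans (cong (ℤ._+_ c) (sum-minus L M)) (sym (ℤ.+-assoc c (coefficientSum L) _))
  sum-minus [] []            = refl
  sum-minus [] ((c , d) ∷ M) = trans (cong (ℤ._+_ (ℤ.- c)) (sum-minus [] M)) (lemma c _)
    where
    lemma : ∀ x y → ℤ.- x ℤ.+ (+ 0 ℤ.- y) ≡ + 0 ℤ.- (x ℤ.+ y)
    lemma = ℤ-solver.solve-∀

  -- Lists with equal coefficients can have different terms, so there is no comparison term by term;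
  -- instead `sum-zero` applies to their formal difference.
  coefficientSum-cong : ∀ {L M} → L ≈ M → coefficientSum L ≡ coefficientSum M
  coefficientSum-cong {L} {M} L≈M = ℤ.i-j≡0⇒i≡j _ _ (trans (sym (sum-minus L M))
    (sum-zero _ (L ++ negate M) ℕ.≤-refl λ e →
      trans (coefficient-minus e L M) (ℤ.i≡j⇒i-j≡0 (L≈M e))))

  coefficientSum-⊗ : ∀ L M → coefficientSum (L ⊗ M) ≡ coefficientSum L ℤ.* coefficientSum M
  coefficientSum-⊗ []            M = refl
  coefficientSum-⊗ ((c , e) ∷ L) M = trans (go M) (trans
    (cong (ℤ._+_ (c ℤ.* coefficientSum M)) (coefficientSum-⊗ L M))
    (sym (ℤ.*-distribʳ-+ (coefficientSum M) c (coefficientSum L))))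
    where
    lemma : ∀ x y z w → x ℤ.* y ℤ.+ (x ℤ.* z ℤ.+ w) ≡ x ℤ.* (y ℤ.+ z) ℤ.+ w
    lemma = ℤ-solver.solve-∀
    go : ∀ M′ → coefficientSum (map (λ (d , f) → c ℤ.* d , λ v → e v ℤ.+ f v) M′ ++ L ⊗ M)
              ≡ c ℤ.* coefficientSum M′ ℤ.+ coefficientSum (L ⊗ M)
    go []             = sym (trans (cong (ℤ._+ _) (ℤ.*-zeroʳ c)) (ℤ.+-identityˡ _))
    go ((d , f) ∷ M′) = trans (cong (ℤ._+_ (c ℤ.* d)) (go M′)) (lemma c d _ _)

  size : Polynomial → ℕ
  size = List⁺.length

  coefficientSum-⟦⟧ : ∀ p → coefficientSum ⟦ p ⟧ ≡ + size p
  coefficientSum-⟦⟧ (e ∷ es) = cong (ℤ._+_ (+ 1)) (go es)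
    where
    go : ∀ es → coefficientSum (map (λ e → + 1 , λ v → + e v) es) ≡ + length es
    go []       = refl
    go (_ ∷ es) = cong (ℤ._+_ (+ 1)) (go es)

  size-⊠ : ∀ p q → size (p ⊠ q) ≡ size p * size q
  size-⊠ (e ∷ es) q@(f ∷ fs) = begin
    length (g e (toList q) ++ rest es)           ≡⟨ List.length-++ (g e (toList q)) ⟩
    length (g e (toList q)) + length (rest es) ≡⟨ cong₂ _+_ (List.length-map _ (toList q)) (go es) ⟩
    size q + length es * size q              ∎
    where
    g : (V → ℕ) → List (V → ℕ) → List (V → ℕ)
    g e = map (λ f v → e v + f v)
    rest : List (V → ℕ) → List (V → ℕ)
    rest es = concat (map toList (map (λ e → List⁺.map (λ f v → e v + f v) q) es))
    go : ∀ es → length (rest es) ≡ length es * size q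
    go []       = refl
    go (e ∷ es) = trans (List.length-++ (g e (toList q)))
      (cong₂ _+_ (List.length-map _ (toList q)) (go es))

  -- The value of a quotient of polynomials when all variables are set to 1.
  infix 4 _hasValue_
  record _hasValue_ (x : Rational) (r : ℚ) : Set where
    constructor value≡
    open Rational x
    field
      equation : ι (size numerator) ≡ r ℚ.* ι (size denominator)

  -- With all variables set to 1 the equation of an expansion says that `size p` is the coefficient
  -- sum times `size q`, and `size q` is positive. Both directions are used: for n = 1 a number of
  -- monomials is turned into a value, for general n a value into a number of monomials.
  coefficientSum-value : ∀ {L x r} → IsLaurentExpansion L x → x hasValue r → ∀ k →
    (coefficientSum L ≡ + k → r ≡ ι k) × (r ≡ ι k → coefficientSum L ≡ + k)
  coefficientSum-value {L} {p ÷ q} {r} expansion (value≡ value) k = to , from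
    where
    d = length (List⁺.tail q)
    eq : + size p ≡ coefficientSum L ℤ.* + suc d
    eq = trans (sym (coefficientSum-⟦⟧ p)) (trans (coefficientSum-cong {⟦ p ⟧} {L ⊗ ⟦ q ⟧} expansion)
           (trans (coefficientSum-⊗ L ⟦ q ⟧) (cong (coefficientSum L ℤ.*_) (coefficientSum-⟦⟧ q))))
    to : coefficientSum L ≡ + k → r ≡ ι k
    to e = *ι-cancelʳ d (trans (sym value) (trans
      (cong ι (ℤ.+-injective (trans eq (trans (cong (ℤ._* + suc d) e) (sym (ℤ.pos-* k (suc d)))))))
      (ι-homo-* k (suc d))))
    from : r ≡ ι k → coefficientSum L ≡ + k
    from e = ℤ.*-cancelʳ-≡ _ _ (+ suc d) (trans (sym eq) (trans
      (cong +_ (ι-injective (trans value (trans (cong (ℚ._* ι (suc d)) e) (sym (ι-homo-* k (suc d)))))))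
      (ℤ.pos-* k (suc d))))

  hasValue-unique : ∀ {x r r′} → x hasValue r → x hasValue r′ → r ≡ r′
  hasValue-unique {p ÷ q} (value≡ e) (value≡ e′) = *ι-cancelʳ (length (List⁺.tail q)) (trans (sym e) e′)

  one-hasValue : one hasValue 1ℚ
  one-hasValue = value≡ (sym (ℚ.*-identityˡ (ι 1)))

  generator-hasValue : ∀ v → generator v hasValue 1ℚ
  generator-hasValue v = value≡ (sym (ℚ.*-identityˡ (ι 1)))

  open ℚ-solver.+-*-Solver

  mul-hasValue : ∀ {x y a b} → x hasValue a → y hasValue b → mul x y hasValue (a ℚ.* b)
  mul-hasValue {p ÷ q} {r ÷ s} {a} {b} (value≡ x≐a) (value≡ y≐b) = value≡ (begin
    ι (size (p ⊠ r))                                 ≡⟨ trans (cong ι (size-⊠ p r)) (ι-homo-* (size p)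
        (size r)) ⟩
    ι (size p) ℚ.* ι (size r)                        ≡⟨ cong₂ ℚ._*_ x≐a y≐b ⟩
    a ℚ.* ι (size q) ℚ.* (b ℚ.* ι (size s))          ≡⟨ solve 4 (λ a q b s → a :* q :*
        (b :* s) := a :* b :* (q :* s)) refl a _ b _ ⟩
    a ℚ.* b ℚ.* (ι (size q) ℚ.* ι (size s))          ≡⟨ cong (a ℚ.* b ℚ.*_) (trans (cong ι (size-⊠ q s))
        (ι-homo-* (size q) (size s))) ⟨
    a ℚ.* b ℚ.* ι (size (q ⊠ s))                     ∎)

  add-hasValue : ∀ {x y a b} → x hasValue a → y hasValue b → add x y hasValue (a ℚ.+ b)
  add-hasValue {p ÷ q} {r ÷ s} {a} {b} (value≡ x≐a) (value≡ y≐b) = value≡ (begin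
    ι (size (p ⊠ s ⊞ r ⊠ q))                         ≡⟨ cong ι (trans (List⁺.length-⁺++⁺ (p ⊠ s)
        (r ⊠ q)) (cong₂ _+_ (size-⊠ p s) (size-⊠ r q))) ⟩
    ι (size p * size s + size r * size q)      ≡⟨ ι-homo-+ (size p * size s) (size r * size q) ⟩
    ι (size p * size s) ℚ.+ ι (size r * size q)  ≡⟨ cong₂ ℚ._+_ (ι-homo-* (size p) (size s))
        (ι-homo-* (size r) (size q)) ⟩
    ι (size p) ℚ.* ι (size s) ℚ.+ ι (size r) ℚ.* ι (size q)
      ≡⟨ cong₂ (λ u v → u ℚ.* ι (size s) ℚ.+ v ℚ.* ι (size q)) x≐a y≐b ⟩
    a ℚ.* ι (size q) ℚ.* ι (size s) ℚ.+ b ℚ.* ι (size s) ℚ.* ι (size q)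
      ≡⟨ solve 4 (λ a q b s → a :* q :* s :+ b :* s :* q := (a :+ b) :* (q :* s)) refl a _ b _ ⟩
    (a ℚ.+ b) ℚ.* (ι (size q) ℚ.* ι (size s))        ≡⟨ cong ((a ℚ.+ b) ℚ.*_)
        (trans (cong ι (size-⊠ q s)) (ι-homo-* (size q) (size s))) ⟨
    (a ℚ.+ b) ℚ.* ι (size (q ⊠ s))                   ∎)

  -- The quotient enters as a solution `c` of `c * b = a`, the form in which an exchange relation
  -- supplies it.
  div-hasValue : ∀ {x y a b} c → x hasValue a → y hasValue b → c ℚ.* b ≡ a → div x y hasValue c
  div-hasValue {p ÷ q} {r ÷ s} {a} {b} c (value≡ x≐a) (value≡ y≐b) eq = value≡ (begin
    ι (size (p ⊠ s))                                 ≡⟨ trans (cong ι (size-⊠ p s)) (ι-homo-* (size p)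
        (size s)) ⟩
    ι (size p) ℚ.* ι (size s)                        ≡⟨ cong (ℚ._* _) (trans x≐a (cong (ℚ._* _) (sym eq))) ⟩
    c ℚ.* b ℚ.* ι (size q) ℚ.* ι (size s)            ≡⟨ solve 4 (λ c b q s → c :* b :* q :* s := c :*
        (q :* (b :* s))) refl c b _ _ ⟩
    c ℚ.* (ι (size q) ℚ.* (b ℚ.* ι (size s)))        ≡⟨ cong (λ z → c ℚ.* (ι (size q) ℚ.* z)) y≐b ⟨
    c ℚ.* (ι (size q) ℚ.* ι (size r))                ≡⟨ cong (c ℚ.*_) (trans (cong ι (size-⊠ q r))
        (ι-homo-* (size q) (size r))) ⟨
    c ℚ.* ι (size (q ⊠ r))                           ∎)

-- Finite sums of integers

infixr 8 _·_
_·_ : Bool → ℤ → ℤ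
true  · z = z
false · z = + 0

·-0 : ∀ b → b · + 0 ≡ + 0
·-0 true  = refl
·-0 false = refl

does-cong : ∀ {P Q : Set} (p : Dec P) (q : Dec Q) → (P → Q) → (Q → P) → does p ≡ does q
does-cong p (yes x) _ g = dec-true p (g x)
does-cong p (no ¬x) f _ = dec-false p (¬x ∘ f)

<ᵇ-true : ∀ {m n} → m < n → (m <ᵇ n) ≡ true
<ᵇ-true {m} {n} = dec-true (m ℕ.<? n)

<ᵇ-false : ∀ {m n} → n ≤ m → (m <ᵇ n) ≡ false
<ᵇ-false {m} {n} n≤m = dec-false (m ℕ.<? n) (ℕ.≤⇒≯ n≤m)

≡ᵇ-refl : ∀ n → (n ≡ᵇ n) ≡ true
≡ᵇ-refl n = dec-true (n ℕ.≟ n) refl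

≡ᵇ-false : ∀ {m n} → m ≢ n → (m ≡ᵇ n) ≡ false
≡ᵇ-false {m} {n} = dec-false (m ℕ.≟ n)

Σ< : ℕ → (ℕ → ℤ) → ℤ
Σ< zero    f = + 0
Σ< (suc n) f = f 0 ℤ.+ Σ< n (f ∘ suc)

Σ<-cong : ∀ n {f g} → (∀ i → i < n → f i ≡ g i) → Σ< n f ≡ Σ< n g
Σ<-cong zero    eq = refl
Σ<-cong (suc n) eq = cong₂ ℤ._+_ (eq 0 (s≤s z≤n)) (Σ<-cong n λ i i<n → eq (suc i) (s≤s i<n))

Σ<-zero : ∀ n {f} → (∀ i → i < n → f i ≡ + 0) → Σ< n f ≡ + 0
Σ<-zero zero    eq = refl
Σ<-zero (suc n) eq = cong₂ ℤ._+_ (eq 0 (s≤s z≤n)) (Σ<-zero n λ i i<n → eq (suc i) (s≤s i<n))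

Σ<-skip : ∀ n f → f 0 ≡ + 0 → Σ< (suc n) f ≡ Σ< n (f ∘ suc)
Σ<-skip n f eq = trans (cong (ℤ._+ Σ< n (f ∘ suc)) eq) (ℤ.+-identityˡ _)

interchange : ∀ a b c d → a ℤ.+ b ℤ.+ (c ℤ.+ d) ≡ a ℤ.+ c ℤ.+ (b ℤ.+ d)
interchange = ℤ-solver.solve-∀

Σ<-+ : ∀ n f g → Σ< n (λ i → f i ℤ.+ g i) ≡ Σ< n f ℤ.+ Σ< n g
Σ<-+ zero    f g = refl
Σ<-+ (suc n) f g = trans (cong (ℤ._+_ (f 0 ℤ.+ g 0)) (Σ<-+ n _ _)) (interchange (f 0) (g 0) _ _)

Σ<-* : ∀ n c f → Σ< n (λ i → c ℤ.* f i) ≡ c ℤ.* Σ< n f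
Σ<-* zero    c f = sym (ℤ.*-zeroʳ c)
Σ<-* (suc n) c f = trans (cong (ℤ._+_ (c ℤ.* f 0)) (Σ<-* n c _)) (sym (ℤ.*-distribˡ-+ c (f 0) _))

Σ<-last : ∀ n f → Σ< (suc n) f ≡ Σ< n f ℤ.+ f n
Σ<-last zero    f = ℤ.+-comm (f 0) (+ 0)
Σ<-last (suc n) f = trans (cong (ℤ._+_ (f 0)) (Σ<-last n (f ∘ suc))) (sym (ℤ.+-assoc (f 0) _ _))

Σ<-reverse : ∀ n f → Σ< (suc n) f ≡ Σ< (suc n) (λ i → f (n ∸ i))
Σ<-reverse zero    f = refl
Σ<-reverse (suc n) f = begin
  Σ< (suc (suc n)) f                               ≡⟨ Σ<-last (suc n) f ⟩
  Σ< (suc n) f ℤ.+ f (suc n)                       ≡⟨ ℤ.+-comm _ (f (suc n)) ⟩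
  f (suc n) ℤ.+ Σ< (suc n) f                       ≡⟨ cong (ℤ._+_ (f (suc n))) (Σ<-reverse n f) ⟩
  f (suc n) ℤ.+ Σ< (suc n) (λ i → f (n ∸ i))       ∎

Σ<-swap : ∀ m n (f : ℕ → ℕ → ℤ) → Σ< m (λ i → Σ< n (λ j → f i j)) ≡ Σ< n (λ j → Σ< m (λ i → f i j))
Σ<-swap zero    n f = sym (Σ<-zero n λ _ _ → refl)
Σ<-swap (suc m) n f = trans (cong (ℤ._+_ (Σ< n (f 0))) (Σ<-swap m n (f ∘ suc)))
  (sym (Σ<-+ n (f 0) _))

Σ<-δ : ∀ n a (f : ℕ → ℤ) → a < n → Σ< n (λ i → (i ≡ᵇ a) · f i) ≡ f a
Σ<-δ (suc n) zero    f _         = trans (cong (ℤ._+_ (f 0)) (Σ<-zero n λ _ _ → refl)) (ℤ.+-identityʳ _)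
Σ<-δ (suc n) (suc a) f (s≤s a<n) = trans (ℤ.+-identityˡ _) (Σ<-δ n a (f ∘ suc) a<n)

Σ² : ℕ → ℕ → (ℕ → ℕ → ℤ) → ℤ
Σ² m n f = Σ< m λ i → Σ< n λ j → f i j

Σ²-cong : ∀ m n {f g} → (∀ i j → i < m → j < n → f i j ≡ g i j) → Σ² m n f ≡ Σ² m n g
Σ²-cong m n eq = Σ<-cong m λ i i<m → Σ<-cong n λ j j<n → eq i j i<m j<n

Σ²-+ : ∀ m n f g → Σ² m n (λ i j → f i j ℤ.+ g i j) ≡ Σ² m n f ℤ.+ Σ² m n g
Σ²-+ m n f g = trans (Σ<-cong m λ i _ → Σ<-+ n (f i) (g i)) (Σ<-+ m _ _)

Σ²-* : ∀ m n c f → Σ² m n (λ i j → c ℤ.* f i j) ≡ c ℤ.* Σ² m n f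
Σ²-* m n c f = trans (Σ<-cong m λ i _ → Σ<-* n c (f i)) (Σ<-* m c _)

Σ²-last : ∀ m n f → (∀ i → i < m → f i n ≡ + 0) → Σ² m (suc n) f ≡ Σ² m n f
Σ²-last m n f eq = Σ<-cong m λ i i<m →
  trans (Σ<-last n (f i)) (trans (cong (ℤ._+_ (Σ< n (f i))) (eq i i<m)) (ℤ.+-identityʳ _))

Σ²-first : ∀ m n f → (∀ i → i < m → f i 0 ≡ + 0) → Σ² m (suc n) f ≡ Σ² m n (λ i j → f i (suc j))
Σ²-first m n f eq = Σ<-cong m λ i i<m →
  Σ<-skip n (f i) (eq i i<m)

Σ²-last₁ : ∀ m n f → (∀ j → j < n → f m j ≡ + 0) → Σ² (suc m) n f ≡ Σ² m n f
Σ²-last₁ m n f eq = trans (Σ<-last m _) (trans (cong (ℤ._+_ (Σ² m n f)) (Σ<-zero n eq)) (ℤ.+-identityʳ _))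

Σ²-first₁ : ∀ m n f → (∀ j → j < n → f 0 j ≡ + 0) → Σ² (suc m) n f ≡ Σ² m n (f ∘ suc)
Σ²-first₁ m n f eq = Σ<-skip m (λ i → Σ< n (f i)) (Σ<-zero n eq)

δ : ℕ → ℕ → ℕ → ℕ → ℤ
δ a b i j = (i ≡ᵇ a) · (j ≡ᵇ b) · + 1

·-* : ∀ b z w → (b · z) ℤ.* w ≡ b · (z ℤ.* w)
·-* true  z w = refl
·-* false z w = refl

Σ²-δ : ∀ m n a b (f : ℕ → ℕ → ℤ) → a < m → b < n → Σ² m n (λ i j → δ a b i j ℤ.* f i j) ≡ f a b
Σ²-δ m n a b f a<m b<n = begin
  Σ² m n (λ i j → δ a b i j ℤ.* f i j)                 ≡⟨ Σ<-cong m (λ i _ → lemma i (i ≡ᵇ a)) ⟩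
  Σ< m (λ i → (i ≡ᵇ a) · f i b)                        ≡⟨ Σ<-δ m a (λ i → f i b) a<m ⟩
  f a b                                                ∎
  where
  lemma : ∀ i c → Σ< n (λ j → (c · (j ≡ᵇ b) · + 1) ℤ.* f i j) ≡ c · f i b
  lemma i true  = trans (Σ<-cong n λ j _ → trans (·-* (j ≡ᵇ b) (+ 1) (f i j)) (cong ((j ≡ᵇ b) ·_)
      (ℤ.*-identityˡ _)))
                        (Σ<-δ n b (f i) b<n)
  lemma i false = Σ<-zero n λ _ _ → refl

∑ : ∀ {A : Set} → List A → (A → ℤ) → ℤ
∑ []       f = + 0
∑ (x ∷ xs) f = f x ℤ.+ ∑ xs f

∑-cong : ∀ {A : Set} (xs : List A) {f g} → (∀ x → f x ≡ g x) → ∑ xs f ≡ ∑ xs g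
∑-cong []       eq = refl
∑-cong (x ∷ xs) eq = cong₂ ℤ._+_ (eq x) (∑-cong xs eq)

∑-++ : ∀ {A : Set} (xs ys : List A) f → ∑ (xs ++ ys) f ≡ ∑ xs f ℤ.+ ∑ ys f
∑-++ []       ys f = sym (ℤ.+-identityˡ _)
∑-++ (x ∷ xs) ys f = trans (cong (ℤ._+_ (f x)) (∑-++ xs ys f)) (sym (ℤ.+-assoc (f x) _ _))

∑-+ : ∀ {A : Set} (xs : List A) f g → ∑ xs (λ x → f x ℤ.+ g x) ≡ ∑ xs f ℤ.+ ∑ xs g
∑-+ []       f g = refl
∑-+ (x ∷ xs) f g = trans (cong (ℤ._+_ (f x ℤ.+ g x)) (∑-+ xs f g)) (interchange (f x) (g x) _ _)

∑-map : ∀ {A B : Set} (g : A → B) xs f → ∑ (map g xs) f ≡ ∑ xs (f ∘ g)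
∑-map g []       f = refl
∑-map g (x ∷ xs) f = cong (ℤ._+_ (f (g x))) (∑-map g xs f)

∑-concatMap : ∀ {A B : Set} (g : A → List B) xs f → ∑ (concatMap g xs) f ≡ ∑ xs (λ x → ∑ (g x) f)
∑-concatMap g []       f = refl
∑-concatMap g (x ∷ xs) f = trans (∑-++ (g x) _ f) (cong (ℤ._+_ (∑ (g x) f)) (∑-concatMap g xs f))

∑-product : ∀ {A B : Set} (xs : List A) (ys : List B) f →
  ∑ (cartesianProduct xs ys) f ≡ ∑ xs (λ x → ∑ ys (λ y → f (x , y)))
∑-product []       ys f = refl
∑-product (x ∷ xs) ys f = trans (∑-++ (map (x ,_) ys) _ f)
  (cong₂ ℤ._+_ (∑-map (x ,_) ys f) (∑-product xs ys f))

∑-filter : ∀ {A : Set} {P : A → Set} (P? : Decidable P) xs f →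
  ∑ (filter P? xs) f ≡ ∑ xs (λ x → does (P? x) · f x)
∑-filter P? []       f = refl
∑-filter P? (x ∷ xs) f with does (P? x)
... | true  = cong (ℤ._+_ (f x)) (∑-filter P? xs f)
... | false = trans (∑-filter P? xs f) (sym (ℤ.+-identityˡ _))

∑-upTo : ∀ n f → ∑ (upTo n) f ≡ Σ< n f
∑-upTo n f = go n id
  where
  go : ∀ n (g : ℕ → ℕ) → ∑ (applyUpTo g n) f ≡ Σ< n (f ∘ g)
  go zero    g = refl
  go (suc n) g = cong (ℤ._+_ (f (g 0))) (go n (g ∘ suc))

-- Sums over the triples that index the 3-cycles

Σ³ : ℕ → (ℕ → ℕ → ℕ → ℤ) → ℤ
Σ³ s f = Σ< s λ a → Σ< s λ b → Σ< s λ c → f a b c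

isPositive : ℕ → ℕ → ℕ → ℕ → Bool
isPositive s a b c = (0 <ᵇ a) ∧ (0 <ᵇ b) ∧ (0 <ᵇ c) ∧ (a + b + c ≡ᵇ s)

∑-positiveTriples : ∀ s f →
  ∑ (positiveTriples s) f ≡ Σ³ s (λ a b c → isPositive s a b c · f (a , b , c))
∑-positiveTriples s f = begin
  ∑ (positiveTriples s) f                             ≡⟨ ∑-filter _ (cartesianProduct (upTo s)
      (cartesianProduct (upTo s) (upTo s))) f ⟩
  ∑ (cartesianProduct (upTo s) (cartesianProduct (upTo s) (upTo s))) g
    ≡⟨ ∑-product (upTo s) _ g ⟩
  ∑ (upTo s) (λ a → ∑ (cartesianProduct (upTo s) (upTo s)) (λ y → g (a , y)))
    ≡⟨ ∑-upTo s _ ⟩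
  Σ< s (λ a → ∑ (cartesianProduct (upTo s) (upTo s)) (λ y → g (a , y)))
    ≡⟨ Σ<-cong s (λ a _ → trans (∑-product (upTo s) (upTo s) (λ y → g (a , y)))
         (trans (∑-upTo s _) (Σ<-cong s λ b _ → ∑-upTo s (λ c → g (a , b , c))))) ⟩
  Σ³ s (λ a b c → isPositive s a b c · f (a , b , c))   ∎
  where
  g : ℕ × ℕ × ℕ → ℤ
  g (a , b , c) = isPositive s a b c · f (a , b , c)

-- This makes the arrows of a triangle independent of the side from which its coordinates are read,
-- see `triangleCount-next`.
∑-rotateTriples : ∀ s f →
  ∑ (positiveTriples s) (λ (a , b , c) → f (c , a , b)) ≡ ∑ (positiveTriples s) f
∑-rotateTriples s f = begin
  ∑ (positiveTriples s) (λ (a , b , c) → f (c , a , b))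
    ≡⟨ ∑-positiveTriples s _ ⟩
  Σ³ s (λ a b c → isPositive s a b c · f (c , a , b))
    ≡⟨ Σ<-cong s (λ a _ → Σ<-swap s s (λ b c → isPositive s a b c · f (c , a , b))) ⟩
  Σ³ s (λ a c b → isPositive s a b c · f (c , a , b))
    ≡⟨ Σ<-swap s s (λ a c → Σ< s λ b → isPositive s a b c · f (c , a , b)) ⟩
  Σ³ s (λ c a b → isPositive s a b c · f (c , a , b))
    ≡⟨ Σ<-cong s (λ c _ → Σ<-cong s λ a _ → Σ<-cong s λ b _ → cong (_· f (c , a , b)) (rotated a b c)) ⟩
  Σ³ s (λ c a b → isPositive s c a b · f (c , a , b))
    ≡⟨ ∑-positiveTriples s f ⟨
  ∑ (positiveTriples s) f ∎
  where
  rotated : ∀ a b c → isPositive s a b c ≡ isPositive s c a b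
  rotated zero    b       zero    = refl
  rotated zero    b       (suc c) = refl
  rotated (suc a) zero    zero    = refl
  rotated (suc a) zero    (suc c) = refl
  rotated (suc a) (suc b) zero    = refl
  rotated (suc a) (suc b) (suc c) =
    cong (_≡ᵇ s) (trans (ℕ.+-comm _ (suc c)) (sym (ℕ.+-assoc (suc c) (suc a) (suc b))))

-- A positive third coordinate exists only for `x + y < n`, and then it is unique. In `∑-triples`
-- the first two entries of a triple of sum `2 + n` are `suc x` and `suc y`, which leaves
-- `n ∸ (x + y)`.
Σ-thirdCoordinate : ∀ n x y (g : ℕ → ℤ) →
  Σ< (suc n) (λ c → (x + y + suc c ≡ᵇ n) · g (suc c)) ≡ (x + y <ᵇ n) · g (n ∸ (x + y))
Σ-thirdCoordinate n x y g with x + y ℕ.<? n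
... | yes x+y<n rewrite <ᵇ-true x+y<n = begin
  Σ< (suc n) (λ c → (x + y + suc c ≡ᵇ n) · g (suc c))
    ≡⟨ Σ<-cong (suc n) (λ c _ → cong (_· g (suc c)) (does-cong (x + y + suc c ℕ.≟ n) (c ℕ.≟ d)
         (λ e → ℕ.suc-injective (ℕ.+-cancelˡ-≡ (x + y) _ _ (trans e (sym n≡))))
         (λ { refl → n≡ }))) ⟩
  Σ< (suc n) (λ c → (c ≡ᵇ d) · g (suc c))
    ≡⟨ Σ<-δ (suc n) d (g ∘ suc) (s≤s (ℕ.≤-trans (ℕ.n≤1+n d) (ℕ.≤-trans (ℕ.m≤n+m (suc d) (x + y))
        (ℕ.≤-reflexive n≡)))) ⟩
  g (suc d)
    ≡⟨ cong g (ℕ.m+n∸m≡n (x + y) (suc d)) ⟨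
  g ((x + y + suc d) ∸ (x + y))
    ≡⟨ cong (λ m → g (m ∸ (x + y))) n≡ ⟩
  g (n ∸ (x + y)) ∎
  where
  d = n ∸ suc (x + y)
  n≡ : x + y + suc d ≡ n
  n≡ = trans (ℕ.+-suc (x + y) d) (ℕ.m+[n∸m]≡n x+y<n)
... | no x+y≮n rewrite <ᵇ-false (ℕ.≮⇒≥ x+y≮n) = Σ<-zero (suc n) λ c _ →
  cong (_· g (suc c)) (≡ᵇ-false λ e → x+y≮n (subst (x + y <_) e (ℕ.m<m+n (x + y) {suc c} (s≤s z≤n))))

∑-triples : ∀ n f → ∑ (positiveTriples (2 + n)) f ≡
  Σ² (suc n) (suc n) (λ x y → (x + y <ᵇ n) · f (suc x , suc y , n ∸ (x + y)))
∑-triples n f = begin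
  ∑ (positiveTriples (2 + n)) f
    ≡⟨ ∑-positiveTriples (2 + n) f ⟩
  Σ³ (2 + n) g
    ≡⟨ Σ<-skip (suc n) (λ x → Σ² s s (g x)) (Σ<-zero s λ b _ → Σ<-zero s λ c _ → refl) ⟩
  Σ< (suc n) (λ x → Σ² s s (g (suc x)))
    ≡⟨ Σ<-cong (suc n) (λ x _ → Σ<-skip (suc n) (λ y → Σ< s (g (suc x) y)) (Σ<-zero s λ c _ → refl)) ⟩
  Σ² (suc n) (suc n) (λ x y → Σ< s (g (suc x) (suc y)))
    ≡⟨ Σ²-cong (suc n) (suc n) (λ x y _ _ → trans (ℤ.+-identityˡ _) (trans
         (Σ<-cong (suc n) λ c _ → cong (λ k → (k ≡ᵇ s) · f (suc x , suc y , suc c)) (shift x y c))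
         (Σ-thirdCoordinate n x y (λ c → f (suc x , suc y , c))))) ⟩
  Σ² (suc n) (suc n) (λ x y → (x + y <ᵇ n) · f (suc x , suc y , n ∸ (x + y))) ∎
  where
  s = 2 + n
  g : ℕ → ℕ → ℕ → ℤ
  g a b c = isPositive s a b c · f (a , b , c)
  shift : ∀ x y c → suc x + suc y + suc c ≡ 2 + (x + y + suc c)
  shift x y c = cong (λ k → suc (k + suc c)) (ℕ.+-suc x y)

-- The quiver of a height function

Height : Set
Height = ℕ → ℕ → ℤ

-- A i j k l is the number of arrows from (i , j) to (k , l).
Arrows : Set
Arrows = ℕ → ℕ → ℕ → ℕ → ℤ

Skew : Arrows → Set
Skew A = ∀ i j k l → A i j k l ≡ ℤ.- A k l i j

-- The ranges of summation in `form` omit the edges on the boundary of the square, since no 3-cycle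
-- has an arrow along a side of its triangle. A diagonal has as coefficient the difference of the
-- heights at the ends of the other diagonal, which is 0, 2 or -2 on a surface with steps of size 1.
horizontal vertical diagonal : Height → Arrows → ℕ → ℕ → ℤ
horizontal t A i j = + 2 ℤ.* (t i (suc j) ℤ.- t (suc i) (suc j)) ℤ.* A i (suc j) (suc i) (suc j)
vertical   t A i j = + 2 ℤ.* (t (suc i) (suc j) ℤ.- t (suc i) j) ℤ.* A (suc i) j (suc i) (suc j)
diagonal   t A i j = (t (suc i) j ℤ.- t i (suc j)) ℤ.* A i j (suc i) (suc j)
                 ℤ.+ (t (suc i) (suc j) ℤ.- t i j) ℤ.* A i (suc j) (suc i) j

-- Twice the quiver on [0 , n + 1]² attached to a height function: horizontal arrows point
-- downhill, vertical ones uphill, and squares that are not saddles get a diagonal arrow.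
-- The formula is linear in the heights, and a mutation changes one height by 2.
form : ℕ → Height → Arrows → ℤ
form n t A = Σ² (suc n) n (horizontal t A) ℤ.+ Σ² n (suc n) (vertical t A)
         ℤ.+ Σ² (suc n) (suc n) (diagonal t A)

form-cong : ∀ n {t u A B} →
  (∀ i j → i ≤ suc n → j ≤ suc n → t i j ≡ u i j) →
  (∀ i j k l → i ≤ suc n → j ≤ suc n → k ≤ suc n → l ≤ suc n → A i j k l ≡ B i j k l) →
  form n t A ≡ form n u B
form-cong n {t} {u} {A} {B} t≡ A≡ = cong₂ ℤ._+_ (cong₂ ℤ._+_
  (Σ²-cong (suc n) n λ i j i≤ j< → let j≤ = ℕ.m≤n⇒m≤1+n j< in
    cong₂ ℤ._*_ (cong (+ 2 ℤ.*_) (cong₂ ℤ._-_ (t≡ _ _ (ℕ.<⇒≤ i≤) j≤) (t≡ _ _ i≤ j≤)))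
      (A≡ _ _ _ _ (ℕ.<⇒≤ i≤) j≤ i≤ j≤))
  (Σ²-cong n (suc n) λ i j i< j≤ → let i≤ = ℕ.m≤n⇒m≤1+n i< in
    cong₂ ℤ._*_ (cong (+ 2 ℤ.*_) (cong₂ ℤ._-_ (t≡ _ _ i≤ j≤) (t≡ _ _ i≤ (ℕ.<⇒≤ j≤))))
      (A≡ _ _ _ _ i≤ (ℕ.<⇒≤ j≤) i≤ j≤)))
  (Σ²-cong (suc n) (suc n) λ i j i< j< → let i≤ = ℕ.<⇒≤ i<; j≤ = ℕ.<⇒≤ j< in
    cong₂ ℤ._+_
      (cong₂ ℤ._*_ (cong₂ ℤ._-_ (t≡ _ _ i< j≤) (t≡ _ _ i≤ j<)) (A≡ _ _ _ _ i≤ j≤ i< j<))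
      (cong₂ ℤ._*_ (cong₂ ℤ._-_ (t≡ _ _ i< j<) (t≡ _ _ i≤ j≤)) (A≡ _ _ _ _ i≤ j< i< j≤)))

form-+2* : ∀ n t u A → form n (λ i j → t i j ℤ.+ + 2 ℤ.* u i j) A ≡ form n t A ℤ.+ + 2 ℤ.* form n u A
form-+2* n t u A = begin
  form n (λ i j → t i j ℤ.+ + 2 ℤ.* u i j) A
    ≡⟨ cong₂ ℤ._+_ (cong₂ ℤ._+_
         (split (suc n) n (horizontal t A) (horizontal u A) λ i j → line (t i (suc j)) (u i (suc j))
             (t (suc i) (suc j)) _ _)
         (split n (suc n) (vertical t A) (vertical u A) λ i j → line (t (suc i) (suc j))
             (u (suc i) (suc j)) (t (suc i) j) _ _))
         (split (suc n) (suc n) (diagonal t A) (diagonal u A) λ i j →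
            cross (t (suc i) j) (u (suc i) j) (t i (suc j)) _ _ (t (suc i) (suc j)) (u (suc i) (suc j))
                (t i j) _ _) ⟩
  _ ≡⟨ collect (Σ² (suc n) n (horizontal t A)) (Σ² (suc n) n (horizontal u A))
         (Σ² n (suc n) (vertical t A)) (Σ² n (suc n) (vertical u A)) _ _ ⟩
  form n t A ℤ.+ + 2 ℤ.* form n u A ∎
  where
  split : ∀ m k {f} g h → (∀ i j → f i j ≡ g i j ℤ.+ + 2 ℤ.* h i j) →
    Σ² m k f ≡ Σ² m k g ℤ.+ + 2 ℤ.* Σ² m k h
  split m k g h eq = trans (Σ²-cong m k λ i j _ _ → eq i j)
    (trans (Σ²-+ m k g (λ i j → + 2 ℤ.* h i j)) (cong (ℤ._+_ (Σ² m k g)) (Σ²-* m k (+ 2) h)))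
  line : ∀ a b c d x → + 2 ℤ.* (a ℤ.+ + 2 ℤ.* b ℤ.- (c ℤ.+ + 2 ℤ.* d)) ℤ.* x
       ≡ + 2 ℤ.* (a ℤ.- c) ℤ.* x ℤ.+ + 2 ℤ.* (+ 2 ℤ.* (b ℤ.- d) ℤ.* x)
  line = ℤ-solver.solve-∀
  cross : ∀ a b c d x e f g h y →
    (a ℤ.+ + 2 ℤ.* b ℤ.- (c ℤ.+ + 2 ℤ.* d)) ℤ.* x ℤ.+ (e ℤ.+ + 2 ℤ.* f ℤ.- (g ℤ.+ + 2 ℤ.* h)) ℤ.* y
    ≡ (a ℤ.- c) ℤ.* x ℤ.+ (e ℤ.- g) ℤ.* y ℤ.+ + 2 ℤ.* ((b ℤ.- d) ℤ.* x ℤ.+ (f ℤ.- h) ℤ.* y)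
  cross = ℤ-solver.solve-∀
  collect : ∀ a b c d e f → a ℤ.+ + 2 ℤ.* b ℤ.+ (c ℤ.+ + 2 ℤ.* d) ℤ.+ (e ℤ.+ + 2 ℤ.* f)
    ≡ a ℤ.+ c ℤ.+ e ℤ.+ + 2 ℤ.* (b ℤ.+ d ℤ.+ f)
  collect = ℤ-solver.solve-∀

Σ²-δ-pair : ∀ m n {f} a b c d (g h : ℕ → ℕ → ℤ) → a < m → b < n → c < m → d < n →
  (∀ i j → f i j ≡ δ a b i j ℤ.* g i j ℤ.+ δ c d i j ℤ.* h i j) → Σ² m n f ≡ g a b ℤ.+ h c d
Σ²-δ-pair m n a b c d g h a< b< c< d< eq = trans (Σ²-cong m n λ i j _ _ → eq i j) (trans
  (Σ²-+ m n (λ i j → δ a b i j ℤ.* g i j) _) (cong₂ ℤ._+_ (Σ²-δ m n a b g a< b<) (Σ²-δ m n c d h c< d<)))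

-- A unit height at an interior point meets two horizontal edges, two vertical edges and the four
-- unit squares around the point. Skew-symmetry rewrites these terms as arrows at the point with
-- coefficient 2, which reverse the existing arrows, and as arrows from east and west to north and
-- south, which complete the paths through the point. This is the change of a quiver under mutation.
form-δ : ∀ n A a b → Skew A → a < n → b < n →
  let i = suc a; j = suc b in
  form n (δ i j) A ≡
    + 2 ℤ.* (A i j (suc i) j ℤ.+ A i j a j ℤ.- A i j i (suc j) ℤ.- A i j i b)
    ℤ.+ (A (suc i) j i (suc j) ℤ.+ A (suc i) j i b ℤ.+ A a j i (suc j) ℤ.+ A a j i b)
form-δ n A a b skew a<n b<n = begin
  form n (δ (suc a) (suc b)) A
    ≡⟨ cong₂ ℤ._+_ (cong₂ ℤ._+_
         (Σ²-δ-pair (suc n) n (suc a) b a b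
            (λ i j → + 2 ℤ.* A i (suc j) (suc i) (suc j)) (λ i j → ℤ.- (+ 2 ℤ.* A i (suc j) (suc i) (suc j)))
            (s≤s a<n) b<n a≤n b<n (λ i j → line (δ (suc a) b i j) (δ a b i j) _))
         (Σ²-δ-pair n (suc n) a b a (suc b)
            (λ i j → + 2 ℤ.* A (suc i) j (suc i) (suc j)) (λ i j → ℤ.- (+ 2 ℤ.* A (suc i) j (suc i) (suc j)))
            a<n b≤n a<n (s≤s b<n) (λ i j → line (δ a b i j) (δ a (suc b) i j) _)))
         (trans (Σ²-+ (suc n) (suc n)
            (λ i j → (δ a (suc b) i j ℤ.- δ (suc a) b i j) ℤ.* A i j (suc i) (suc j))
            (λ i j → (δ a b i j ℤ.- δ (suc a) (suc b) i j) ℤ.* A i (suc j) (suc i) j))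
         (cong₂ ℤ._+_
         (Σ²-δ-pair (suc n) (suc n) a (suc b) (suc a) b
            (λ i j → A i j (suc i) (suc j)) (λ i j → ℤ.- A i j (suc i) (suc j))
            a≤n (s≤s b<n) (s≤s a<n) b≤n (λ i j → dist (δ a (suc b) i j) (δ (suc a) b i j) _))
         (Σ²-δ-pair (suc n) (suc n) a b (suc a) (suc b)
            (λ i j → A i (suc j) (suc i) j) (λ i j → ℤ.- A i (suc j) (suc i) j)
            a≤n b≤n (s≤s a<n) (s≤s b<n) (λ i j → dist (δ a b i j) (δ (suc a) (suc b) i j) _)))) ⟩
  _ ≡⟨ cong₂ ℤ._+_ (cong₂ ℤ._+_
         (cong (λ z → + 2 ℤ.* A i j (suc i) j ℤ.+ ℤ.- (+ 2 ℤ.* z)) (skew a j i j))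
         (cong (λ z → + 2 ℤ.* z ℤ.+ ℤ.- (+ 2 ℤ.* A i j i (suc j))) (skew i b i j)))
         (cong₂ (λ y z → A a j i (suc j) ℤ.+ ℤ.- y ℤ.+ (A a j i b ℤ.+ ℤ.- z)) (skew i b (suc i) j)
             (skew i (suc j) (suc i) j)) ⟩
  _ ≡⟨ collect (A i j (suc i) j) (A i j a j) (A i j i (suc j)) (A i j i b)
         (A (suc i) j i (suc j)) (A (suc i) j i b) (A a j i (suc j)) (A a j i b) ⟩
  _ ∎
  where
  i = suc a
  j = suc b
  a≤n = ℕ.m≤n⇒m≤1+n a<n
  b≤n = ℕ.m≤n⇒m≤1+n b<n
  line : ∀ d e x → + 2 ℤ.* (d ℤ.- e) ℤ.* x ≡ d ℤ.* (+ 2 ℤ.* x) ℤ.+ e ℤ.* (ℤ.- (+ 2 ℤ.* x))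
  line = ℤ-solver.solve-∀
  dist : ∀ d e x → (d ℤ.- e) ℤ.* x ≡ d ℤ.* x ℤ.+ e ℤ.* ℤ.- x
  dist = ℤ-solver.solve-∀
  collect : ∀ e w n s en es wn ws →
    + 2 ℤ.* e ℤ.+ ℤ.- (+ 2 ℤ.* ℤ.- w) ℤ.+ (+ 2 ℤ.* ℤ.- s ℤ.+ ℤ.- (+ 2 ℤ.* n))
      ℤ.+ (wn ℤ.+ ℤ.- (ℤ.- es) ℤ.+ (ws ℤ.+ ℤ.- (ℤ.- en)))
    ≡ + 2 ℤ.* (e ℤ.+ w ℤ.- n ℤ.- s) ℤ.+ (en ℤ.+ es ℤ.+ wn ℤ.+ ws)
  collect = ℤ-solver.solve-∀

-- Between a fixed interior point and a given vertex, the arrow counts are the antisymmetrised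
-- product of `δ` and `ω`, where `ω` marks the points that are the given vertex. At a point whose
-- four neighbours lie one unit higher, the diagonal terms vanish, being differences of heights of
-- neighbours, and the arrows to north and south and from east and west remain.
form-row : ∀ n t (ω : ℕ → ℕ → ℤ) a b → a < n → b < n →
  let i = suc a; j = suc b in
  t (suc i) j ≡ t i j ℤ.+ + 1 → t a j ≡ t i j ℤ.+ + 1 →
  t i (suc j) ≡ t i j ℤ.+ + 1 → t i b ≡ t i j ℤ.+ + 1 →
  form n t (λ k l k′ l′ → δ i j k l ℤ.* ω k′ l′ ℤ.- δ i j k′ l′ ℤ.* ω k l) ≡
    + 2 ℤ.* (ω i (suc j) ℤ.+ ω i b ℤ.- ω (suc i) j ℤ.- ω a j)
form-row n t ω a b a<n b<n east west north south = begin
  form n t A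
    ≡⟨ cong₂ ℤ._+_ (cong₂ ℤ._+_
         (Σ²-δ-pair (suc n) n (suc a) b a b
            (λ i j → + 2 ℤ.* (t i (suc j) ℤ.- t (suc i) (suc j)) ℤ.* ω (suc i) (suc j))
            (λ i j → ℤ.- (+ 2 ℤ.* (t i (suc j) ℤ.- t (suc i) (suc j)) ℤ.* ω i (suc j)))
            (s≤s a<n) b<n a≤n b<n (λ i j → dist (δ (suc a) b i j) (δ a b i j)
                (+ 2 ℤ.* (t i (suc j) ℤ.- t (suc i) (suc j))) (ω (suc i) (suc j)) (ω i (suc j))))
         (Σ²-δ-pair n (suc n) a (suc b) a b
            (λ i j → + 2 ℤ.* (t (suc i) (suc j) ℤ.- t (suc i) j) ℤ.* ω (suc i) (suc j))
            (λ i j → ℤ.- (+ 2 ℤ.* (t (suc i) (suc j) ℤ.- t (suc i) j) ℤ.* ω (suc i) j))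
            a<n (s≤s b<n) a<n b≤n (λ i j → dist (δ a (suc b) i j) (δ a b i j)
                (+ 2 ℤ.* (t (suc i) (suc j) ℤ.- t (suc i) j)) (ω (suc i) (suc j)) (ω (suc i) j))))
         (trans (Σ²-+ (suc n) (suc n)
            (λ i j → (t (suc i) j ℤ.- t i (suc j)) ℤ.* A i j (suc i) (suc j))
            (λ i j → (t (suc i) (suc j) ℤ.- t i j) ℤ.* A i (suc j) (suc i) j))
         (cong₂ ℤ._+_
         (Σ²-δ-pair (suc n) (suc n) (suc a) (suc b) a b
            (λ i j → (t (suc i) j ℤ.- t i (suc j)) ℤ.* ω (suc i) (suc j))
            (λ i j → ℤ.- ((t (suc i) j ℤ.- t i (suc j)) ℤ.* ω i j))
            (s≤s a<n) (s≤s b<n) a≤n b≤n (λ i j → dist (δ (suc a) (suc b) i j) (δ a b i j)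
                (t (suc i) j ℤ.- t i (suc j)) (ω (suc i) (suc j)) (ω i j)))
         (Σ²-δ-pair (suc n) (suc n) (suc a) b a (suc b)
            (λ i j → (t (suc i) (suc j) ℤ.- t i j) ℤ.* ω (suc i) j)
            (λ i j → ℤ.- ((t (suc i) (suc j) ℤ.- t i j) ℤ.* ω i (suc j)))
            (s≤s a<n) b≤n a≤n (s≤s b<n) (λ i j → dist (δ (suc a) b i j) (δ a (suc b) i j)
                (t (suc i) (suc j) ℤ.- t i j) (ω (suc i) j) (ω i (suc j)))))) ⟩
  _ ≡⟨ collect {t = t (suc a) (suc b)} {ω (suc (suc a)) (suc b)} {ω a (suc b)} {ω (suc a) (suc (suc b))}
      {ω (suc a) b}
         {ω (suc (suc a)) (suc (suc b))} {ω a b} {ω (suc (suc a)) b} {ω a (suc (suc b))} east west north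
             south ⟩
  _ ∎
  where
  A : Arrows
  A k l k′ l′ = δ (suc a) (suc b) k l ℤ.* ω k′ l′ ℤ.- δ (suc a) (suc b) k′ l′ ℤ.* ω k l
  a≤n = ℕ.m≤n⇒m≤1+n a<n
  b≤n = ℕ.m≤n⇒m≤1+n b<n
  dist : ∀ d e c x y → c ℤ.* (d ℤ.* x ℤ.- e ℤ.* y) ≡ d ℤ.* (c ℤ.* x) ℤ.+ e ℤ.* ℤ.- (c ℤ.* y)
  dist = ℤ-solver.solve-∀
  collect : ∀ {te tw tn ts t ωe ωw ωn ωs u₁ u₂ u₃ u₄} →
    te ≡ t ℤ.+ + 1 → tw ≡ t ℤ.+ + 1 → tn ≡ t ℤ.+ + 1 → ts ≡ t ℤ.+ + 1 →
      + 2 ℤ.* (t ℤ.- te) ℤ.* ωe ℤ.+ ℤ.- (+ 2 ℤ.* (tw ℤ.- t) ℤ.* ωw)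
      ℤ.+ (+ 2 ℤ.* (tn ℤ.- t) ℤ.* ωn ℤ.+ ℤ.- (+ 2 ℤ.* (t ℤ.- ts) ℤ.* ωs))
      ℤ.+ ((te ℤ.- tn) ℤ.* u₁ ℤ.+ ℤ.- ((ts ℤ.- tw) ℤ.* u₂)
      ℤ.+ ((te ℤ.- ts) ℤ.* u₃ ℤ.+ ℤ.- ((tn ℤ.- tw) ℤ.* u₄)))
    ≡ + 2 ℤ.* (ωn ℤ.+ ωs ℤ.- ωe ℤ.- ωw)
  collect {t = t} {ωe} {ωw} {ωn} {ωs} {u₁} {u₂} {u₃} {u₄} refl refl refl refl =
    lemma t ωe ωw ωn ωs u₁ u₂ u₃ u₄
    where
    lemma : ∀ t ωe ωw ωn ωs u₁ u₂ u₃ u₄ →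
        + 2 ℤ.* (t ℤ.- (t ℤ.+ + 1)) ℤ.* ωe ℤ.+ ℤ.- (+ 2 ℤ.* (t ℤ.+ + 1 ℤ.- t) ℤ.* ωw)
        ℤ.+ (+ 2 ℤ.* (t ℤ.+ + 1 ℤ.- t) ℤ.* ωn ℤ.+ ℤ.- (+ 2 ℤ.* (t ℤ.- (t ℤ.+ + 1)) ℤ.* ωs))
        ℤ.+ ((t ℤ.+ + 1 ℤ.- (t ℤ.+ + 1)) ℤ.* u₁ ℤ.+ ℤ.- ((t ℤ.+ + 1 ℤ.- (t ℤ.+ + 1)) ℤ.* u₂)
        ℤ.+ ((t ℤ.+ + 1 ℤ.- (t ℤ.+ + 1)) ℤ.* u₃ ℤ.+ ℤ.- ((t ℤ.+ + 1 ℤ.- (t ℤ.+ + 1)) ℤ.* u₄)))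
      ≡ + 2 ℤ.* (ωn ℤ.+ ωs ℤ.- ωe ℤ.- ωw)
    lemma = ℤ-solver.solve-∀

-- The lower and the upper faces of the tetrahedron of weights

∣-∣-down : ∀ {i j} → j < i → ∣ i - j ∣ ≡ suc ∣ i - suc j ∣
∣-∣-down {suc i} {zero}  _         = cong suc (sym (ℕ.∣-∣-identityʳ i))
∣-∣-down {suc i} {suc j} (s≤s j<i) = ∣-∣-down j<i

∣-∣-up : ∀ {i j} → i ≤ j → ∣ i - suc j ∣ ≡ suc ∣ i - j ∣
∣-∣-up {zero}  _           = refl
∣-∣-up {suc i} (s≤s i≤j) = ∣-∣-up i≤j

Σ²-mergeʳ : ∀ m n f g → (∀ i → i < m → f i n ≡ + 0) → (∀ i → i < m → g i 0 ≡ + 0) →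
  Σ² m (suc n) (λ i j → f i j ℤ.+ g i j) ≡ Σ² m n (λ i j → f i j ℤ.+ g i (suc j))
Σ²-mergeʳ m n f g f0 g0 = trans (Σ²-+ m (suc n) f g) (trans
  (cong₂ ℤ._+_ (Σ²-last m n f f0) (Σ²-first m n g g0)) (sym (Σ²-+ m n f λ i j → g i (suc j))))

Σ²-mergeˡ : ∀ m n f g → (∀ j → j < n → f m j ≡ + 0) → (∀ j → j < n → g 0 j ≡ + 0) →
  Σ² (suc m) n (λ i j → f i j ℤ.+ g i j) ≡ Σ² m n (λ i j → f i j ℤ.+ g (suc i) j)
Σ²-mergeˡ m n f g f0 g0 = trans (Σ²-+ (suc m) n f g) (trans
  (cong₂ ℤ._+_ (Σ²-last₁ m n f f0) (Σ²-first₁ m n g g0)) (sym (Σ²-+ m n f (g ∘ suc))))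

distribute : ∀ p q a b c d e f →
  p · (a ℤ.+ b ℤ.+ c) ℤ.+ q · (d ℤ.+ e ℤ.+ f) ≡
  (p · a ℤ.+ q · d) ℤ.+ (p · b ℤ.+ q · e) ℤ.+ (p · c ℤ.+ q · f)
distribute = λ where
    true  true  a b c d e f → interchange₃ a b c d e f
    true  false a b c _ _ _ → interchange₃ a b c (+ 0) (+ 0) (+ 0)
    false true  _ _ _ d e f → interchange₃ (+ 0) (+ 0) (+ 0) d e f
    false false _ _ _ _ _ _ → refl
  where
  interchange₃ : ∀ a b c d e f → a ℤ.+ b ℤ.+ c ℤ.+ (d ℤ.+ e ℤ.+ f) ≡ a ℤ.+ d ℤ.+ (b ℤ.+ e) ℤ.+ (c ℤ.+ f)
  interchange₃ = ℤ-solver.solve-∀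

Σ²-+₃ : ∀ m n f g h → Σ² m n (λ i j → f i j ℤ.+ g i j ℤ.+ h i j) ≡ Σ² m n f ℤ.+ Σ² m n g ℤ.+ Σ² m n h
Σ²-+₃ m n f g h = trans (Σ²-+ m n (λ i j → f i j ℤ.+ g i j) h) (cong (ℤ._+ Σ² m n h) (Σ²-+ m n f g))

double : ∀ a b c → + 2 ℤ.* (a ℤ.+ b ℤ.+ c) ≡ + 2 ℤ.* a ℤ.+ + 2 ℤ.* b ℤ.+ + 2 ℤ.* c
double = ℤ-solver.solve-∀

suc-minus : ∀ m → + suc m ℤ.- + m ≡ + 1
suc-minus m = trans (ℤ.m-n≡m⊖n (suc m) m) (trans (ℤ.⊖-≥ (ℕ.n≤1+n m)) (cong +_ (ℕ.m+n∸n≡m 1 m)))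

minus-suc : ∀ m → + m ℤ.- + suc m ≡ -[1+ 0 ]
minus-suc m = trans (lemma (+ m) (+ suc m)) (cong ℤ.-_ (suc-minus m))
  where
  lemma : ∀ a b → a ℤ.- b ≡ ℤ.- (b ℤ.- a)
  lemma = ℤ-solver.solve-∀

-- The 3-cycles of the quiver in a unit square, before the flip and (primed) after it.
lowerCycle upperCycle lowerCycle′ upperCycle′ : Arrows → ℕ → ℕ → ℤ
lowerCycle  A i j = A (suc i) (suc j) i (suc j) ℤ.+ A i (suc j) i j ℤ.+ A i j (suc i) (suc j)
upperCycle  A i j = A i j (suc i) j ℤ.+ A (suc i) j (suc i) (suc j) ℤ.+ A (suc i) (suc j) i j
lowerCycle′ A i j = A (suc i) (suc j) i (suc j) ℤ.+ A (suc i) j (suc i) (suc j) ℤ.+ A i (suc j) (suc i) j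
upperCycle′ A i j = A i j (suc i) j ℤ.+ A i (suc j) i j ℤ.+ A (suc i) j i (suc j)

-- The least and the greatest value of w₁₀ + w₀₁ among nonnegative weights over the point (i , j).
-- The least is attained where w₁₀ or w₀₁ vanishes, the greatest where w₀₀ or w₁₁ does.
startHeight endHeight : ℕ → ℕ → ℕ → ℕ
startHeight n i j = ∣ i - j ∣
endHeight   n i j = suc n ∸ ∣ i + j - suc n ∣

private
  forwards : ∀ d {x y z} → d ≡ + 1 → x ≡ z → y ≡ + 0 → + 2 ℤ.* (x ℤ.+ y) ≡ + 2 ℤ.* d ℤ.* z
  forwards _ refl refl refl = cong (+ 2 ℤ.*_) (ℤ.+-identityʳ _)

  backwards : ∀ d {x y z} → d ≡ -[1+ 0 ] → x ≡ + 0 → y ≡ ℤ.- z → + 2 ℤ.* (x ℤ.+ y) ≡ + 2 ℤ.* d ℤ.* z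
  backwards _ {z = z} refl refl refl = lemma z
    where
    lemma : ∀ z → + 2 ℤ.* (+ 0 ℤ.+ ℤ.- z) ≡ + 2 ℤ.* -[1+ 0 ] ℤ.* z
    lemma = ℤ-solver.solve-∀

-- An edge in the interior of the square borders two unit squares, and exactly one of them has a
-- cycle through it; shifting one of two sums by a row or a column collects both contributions at
-- the same edge. Unit squares on the diagonal carry no cycle, and they are the saddles of
-- `startHeight`.
form-start : ∀ n A → Skew A →
  + 2 ℤ.* Σ² (suc n) (suc n) (λ i j → (j <ᵇ i) · lowerCycle A i j ℤ.+ (i <ᵇ j) · upperCycle A i j)
  ≡ form n (λ i j → + startHeight n i j) A
form-start n A skew = begin
  + 2 ℤ.* Σ² (suc n) (suc n) (λ i j → (j <ᵇ i) · lowerCycle A i j ℤ.+ (i <ᵇ j) · upperCycle A i j)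
    ≡⟨ cong (+ 2 ℤ.*_) (trans (Σ²-cong (suc n) (suc n) λ i j _ _ →
         distribute (j <ᵇ i) (i <ᵇ j)
           (A (suc i) (suc j) i (suc j)) (A i (suc j) i j) (A i j (suc i) (suc j))
           (A i j (suc i) j) (A (suc i) j (suc i) (suc j)) (A (suc i) (suc j) i j))
         (Σ²-+₃ (suc n) (suc n) h v d)) ⟩
  + 2 ℤ.* (Σ² (suc n) (suc n) h ℤ.+ Σ² (suc n) (suc n) v ℤ.+ Σ² (suc n) (suc n) d)
    ≡⟨ double (Σ² (suc n) (suc n) h) (Σ² (suc n) (suc n) v) (Σ² (suc n) (suc n) d) ⟩
  + 2 ℤ.* Σ² (suc n) (suc n) h ℤ.+ + 2 ℤ.* Σ² (suc n) (suc n) v ℤ.+ + 2 ℤ.* Σ² (suc n) (suc n) d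
    ≡⟨ cong₂ ℤ._+_ (cong₂ ℤ._+_ hor ver) dia ⟩
  form n t A ∎
  where
  t : Height
  t i j = + startHeight n i j
  h v d : ℕ → ℕ → ℤ
  h i j = (j <ᵇ i) · A (suc i) (suc j) i (suc j) ℤ.+ (i <ᵇ j) · A i j (suc i) j
  v i j = (j <ᵇ i) · A i (suc j) i j ℤ.+ (i <ᵇ j) · A (suc i) j (suc i) (suc j)
  d i j = (j <ᵇ i) · A i j (suc i) (suc j) ℤ.+ (i <ᵇ j) · A (suc i) (suc j) i j

  hor : + 2 ℤ.* Σ² (suc n) (suc n) h ≡ Σ² (suc n) n (horizontal t A)
  hor = trans (cong (+ 2 ℤ.*_) (Σ²-mergeʳ (suc n) n
      (λ i j → (j <ᵇ i) · A (suc i) (suc j) i (suc j)) (λ i j → (i <ᵇ j) · A i j (suc i) j)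
      (λ { i (s≤s i≤n) → cong (_· A (suc i) (suc n) i (suc n)) (<ᵇ-false i≤n) }) (λ i _ → refl)))
    (trans (sym (Σ²-* (suc n) n (+ 2) λ i j →
        (j <ᵇ i) · A (suc i) (suc j) i (suc j) ℤ.+ (i <ᵇ suc j) · A i (suc j) (suc i) (suc j)))
            (Σ²-cong (suc n) n λ i j _ _ → pointwise i j))
    where
    pointwise : ∀ i j → + 2 ℤ.* ((j <ᵇ i) · A (suc i) (suc j) i (suc j) ℤ.+ (i <ᵇ suc j) · A i (suc j)
        (suc i) (suc j))
                      ≡ horizontal t A i j
    pointwise i j with j ℕ.<? i
    ... | yes j<i rewrite <ᵇ-true j<i | <ᵇ-false {i} {suc j} j<i | ∣-∣-down j<i = trans
      (cong (+ 2 ℤ.*_) (ℤ.+-comm (A (suc i) (suc j) i (suc j)) (+ 0)))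
      (backwards _ (minus-suc ∣ i - suc j ∣) refl (skew (suc i) (suc j) i (suc j)))
    ... | no j≮i rewrite <ᵇ-false (ℕ.≮⇒≥ j≮i) | <ᵇ-true (s≤s (ℕ.≮⇒≥ j≮i)) | ∣-∣-up (ℕ.≮⇒≥ j≮i) = trans
      (cong (+ 2 ℤ.*_) (ℤ.+-comm (+ 0) (A i (suc j) (suc i) (suc j))))
      (forwards _ (suc-minus ∣ i - j ∣) refl refl)

  ver : + 2 ℤ.* Σ² (suc n) (suc n) v ≡ Σ² n (suc n) (vertical t A)
  ver = trans (cong (+ 2 ℤ.*_) (trans (Σ²-cong (suc n) (suc n) λ i j _ _ → ℤ.+-comm
      ((j <ᵇ i) · A i (suc j) i j) ((i <ᵇ j) · A (suc i) j (suc i) (suc j)))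
      (Σ²-mergeˡ n (suc n)
      (λ i j → (i <ᵇ j) · A (suc i) j (suc i) (suc j)) (λ i j → (j <ᵇ i) · A i (suc j) i j)
      (λ { j (s≤s j≤n) → cong (_· A (suc n) j (suc n) (suc j)) (<ᵇ-false j≤n) }) (λ j _ → refl))))
    (trans (sym (Σ²-* n (suc n) (+ 2) λ i j →
        (i <ᵇ j) · A (suc i) j (suc i) (suc j) ℤ.+ (j <ᵇ suc i) · A (suc i) (suc j) (suc i) j))
            (Σ²-cong n (suc n) λ i j _ _ → pointwise i j))
    where
    pointwise : ∀ i j → + 2 ℤ.* ((i <ᵇ j) · A (suc i) j (suc i) (suc j) ℤ.+ (j <ᵇ suc i) · A (suc i)
        (suc j) (suc i) j)
                      ≡ vertical t A i j
    pointwise i j with i ℕ.<? j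
    ... | yes i<j rewrite <ᵇ-true i<j | <ᵇ-false {j} {suc i} i<j | ℕ.∣-∣-comm i j | ℕ.∣-∣-comm
        (suc i) j | ∣-∣-down i<j =
      forwards _ (suc-minus ∣ j - suc i ∣) refl refl
    ... | no i≮j rewrite <ᵇ-false (ℕ.≮⇒≥ i≮j) | <ᵇ-true (s≤s (ℕ.≮⇒≥ i≮j)) | ℕ.∣-∣-comm i j | ℕ.∣-∣-comm
        (suc i) j | ∣-∣-up (ℕ.≮⇒≥ i≮j) =
      backwards _ (minus-suc ∣ j - i ∣) refl (skew (suc i) (suc j) (suc i) j)

  dia : + 2 ℤ.* Σ² (suc n) (suc n) d ≡ Σ² (suc n) (suc n) (diagonal t A)
  dia = trans (sym (Σ²-* (suc n) (suc n) (+ 2) d)) (Σ²-cong (suc n) (suc n) λ i j _ _ → pointwise i j)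
    where
    drop : ∀ a x y m → a ≡ x → a ≡ x ℤ.+ (m ℤ.- m) ℤ.* y
    drop a x y m eq = trans eq (sym (trans (cong (λ z → x ℤ.+ z ℤ.* y) (ℤ.i≡j⇒i-j≡0 {m} refl))
        (ℤ.+-identityʳ x)))
    pointwise : ∀ i j → + 2 ℤ.* d i j ≡ diagonal t A i j
    pointwise i j with ℕ.<-cmp i j
    ... | tri< i<j _ _ rewrite <ᵇ-true i<j | <ᵇ-false (ℕ.<⇒≤ i<j) | ∣-∣-up (ℕ.<⇒≤ i<j)
            | ℕ.∣-∣-comm (suc i) j | ℕ.∣-∣-comm i j | ∣-∣-down i<j = drop _ _ _ (+ suc ∣ j - suc i ∣)
      (trans (cong (λ z → + 2 ℤ.* (+ 0 ℤ.+ z)) (skew (suc i) (suc j) i j)) (lemma (+ ∣ j - suc i ∣)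
          (A i j (suc i) (suc j))))
      where
      lemma : ∀ m a → + 2 ℤ.* (+ 0 ℤ.+ ℤ.- a) ≡ (m ℤ.- (+ 2 ℤ.+ m)) ℤ.* a
      lemma = ℤ-solver.solve-∀
    ... | tri≈ _ refl _ rewrite <ᵇ-false (ℕ.≤-refl {i}) | ℕ.∣-∣-comm (suc i) i = drop _ _ _ (+ ∣ i - i ∣)
      (sym (trans (cong (ℤ._* A i i (suc i) (suc i)) (ℤ.i≡j⇒i-j≡0 {+ ∣ i - suc i ∣} refl)) refl))
    ... | tri> _ _ j<i rewrite <ᵇ-true j<i | <ᵇ-false (ℕ.<⇒≤ j<i) | ℕ.∣-∣-comm (suc i) j | ∣-∣-up
        (ℕ.<⇒≤ j<i) | ℕ.∣-∣-comm j i
            | ∣-∣-down j<i = drop _ _ _ (+ suc ∣ i - suc j ∣) (lemma (+ ∣ i - suc j ∣)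
                (A i j (suc i) (suc j)))
      where
      lemma : ∀ m a → + 2 ℤ.* (a ℤ.+ + 0) ≡ (+ 2 ℤ.+ m ℤ.- m) ℤ.* a
      lemma = ℤ-solver.solve-∀

module _ (n : ℕ) where
  private
    N = suc n
    peak : ℕ → ℕ
    peak s = N ∸ ∣ s - N ∣

  peak-rises : ∀ {s} → s < N → peak (suc s) ≡ suc (peak s)
  peak-rises {s} s<N = begin
    N ∸ ∣ suc s - N ∣            ≡⟨ cong (N ∸_) (ℕ.m≤n⇒∣m-n∣≡n∸m s<N) ⟩
    N ∸ (N ∸ suc s)              ≡⟨ ℕ.m∸[m∸n]≡n s<N ⟩
    suc s                        ≡⟨ cong suc (ℕ.m∸[m∸n]≡n (ℕ.<⇒≤ s<N)) ⟨
    suc (N ∸ (N ∸ s))            ≡⟨ cong (λ x → suc (N ∸ x)) (ℕ.m≤n⇒∣m-n∣≡n∸m (ℕ.<⇒≤ s<N)) ⟨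
    suc (N ∸ ∣ s - N ∣)          ∎

  peak-falls : ∀ {s} → N ≤ s → s < N + N → peak s ≡ suc (peak (suc s))
  peak-falls {s} N≤s s<2N = begin
    N ∸ ∣ s - N ∣                ≡⟨ cong (N ∸_) (ℕ.m≤n⇒∣n-m∣≡n∸m N≤s) ⟩
    N ∸ (s ∸ N)                  ≡⟨ ℕ.+-∸-assoc 1 {N} {suc (s ∸ N)} below ⟩
    suc (N ∸ suc (s ∸ N))        ≡⟨ cong (λ x → suc (N ∸ x)) (ℕ.+-∸-assoc 1 N≤s) ⟨
    suc (N ∸ (suc s ∸ N))        ≡⟨ cong (λ x → suc (N ∸ x)) (ℕ.m≤n⇒∣n-m∣≡n∸m (ℕ.m≤n⇒m≤1+n N≤s)) ⟨
    suc (N ∸ ∣ suc s - N ∣)      ∎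
    where
    below : s ∸ N < N
    below = ℕ.+-cancelʳ-< N (s ∸ N) N (subst (_< N + N) (sym (ℕ.m∸n+n≡m N≤s)) s<2N)

  form-end : ∀ A → Skew A →
    + 2 ℤ.* Σ² N N (λ i j → (i + j <ᵇ n) · lowerCycle′ A i j ℤ.+ (n <ᵇ i + j) · upperCycle′ A i j)
    ≡ form n (λ i j → + endHeight n i j) A
  form-end A skew = begin
    + 2 ℤ.* Σ² N N (λ i j → (i + j <ᵇ n) · lowerCycle′ A i j ℤ.+ (n <ᵇ i + j) · upperCycle′ A i j)
      ≡⟨ cong (+ 2 ℤ.*_) (trans (Σ²-cong N N λ i j _ _ →
           distribute (i + j <ᵇ n) (n <ᵇ i + j)
             (A (suc i) (suc j) i (suc j)) (A (suc i) j (suc i) (suc j)) (A i (suc j) (suc i) j)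
             (A i j (suc i) j) (A i (suc j) i j) (A (suc i) j i (suc j)))
           (Σ²-+₃ N N h v d)) ⟩
    + 2 ℤ.* (Σ² N N h ℤ.+ Σ² N N v ℤ.+ Σ² N N d)
      ≡⟨ double (Σ² N N h) (Σ² N N v) (Σ² N N d) ⟩
    + 2 ℤ.* Σ² N N h ℤ.+ + 2 ℤ.* Σ² N N v ℤ.+ + 2 ℤ.* Σ² N N d
      ≡⟨ cong₂ ℤ._+_ (cong₂ ℤ._+_ hor ver) dia ⟩
    form n t A ∎
    where
    t : Height
    t i j = + endHeight n i j
    h v d : ℕ → ℕ → ℤ
    h i j = (i + j <ᵇ n) · A (suc i) (suc j) i (suc j) ℤ.+ (n <ᵇ i + j) · A i j (suc i) j
    v i j = (i + j <ᵇ n) · A (suc i) j (suc i) (suc j) ℤ.+ (n <ᵇ i + j) · A i (suc j) i j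
    d i j = (i + j <ᵇ n) · A i (suc j) (suc i) j ℤ.+ (n <ᵇ i + j) · A (suc i) j i (suc j)

    hor : + 2 ℤ.* Σ² N N h ≡ Σ² N n (horizontal t A)
    hor = trans (cong (+ 2 ℤ.*_) (Σ²-mergeʳ N n
        (λ i j → (i + j <ᵇ n) · A (suc i) (suc j) i (suc j)) (λ i j → (n <ᵇ i + j) · A i j (suc i) j)
        (λ i _ → cong (_· A (suc i) (suc n) i (suc n)) (<ᵇ-false (ℕ.m≤n+m n i)))
        (λ { i (s≤s i≤n) → cong (_· A i 0 (suc i) 0)
            (<ᵇ-false (subst (_≤ n) (sym (ℕ.+-identityʳ i)) i≤n)) })))
      (trans (sym (Σ²-* N n (+ 2) λ i j →
          (i + j <ᵇ n) · A (suc i) (suc j) i (suc j) ℤ.+ (n <ᵇ i + suc j) · A i (suc j) (suc i)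
              (suc j))) (Σ²-cong N n λ i j i<N j<n → pointwise i j i<N j<n))
      where
      pointwise : ∀ i j → i < N → j < n →
        + 2 ℤ.* ((i + j <ᵇ n) · A (suc i) (suc j) i (suc j) ℤ.+ (n <ᵇ i + suc j) · A i (suc j) (suc i)
            (suc j))
        ≡ horizontal t A i j
      pointwise i j (s≤s i≤n) j<n with i + j ℕ.<? n
      ... | yes lt rewrite ℕ.+-suc i j | <ᵇ-true lt | <ᵇ-false {n} {suc (i + j)} lt | peak-rises
          (s≤s lt) = trans
        (cong (+ 2 ℤ.*_) (ℤ.+-comm (A (suc i) (suc j) i (suc j)) (+ 0)))
        (backwards _ (minus-suc (peak (suc (i + j)))) refl (skew (suc i) (suc j) i (suc j)))
      ... | no ≮ rewrite ℕ.+-suc i j | <ᵇ-false (ℕ.≮⇒≥ ≮) | <ᵇ-true (s≤s (ℕ.≮⇒≥ ≮))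
              | peak-falls (s≤s (ℕ.≮⇒≥ ≮)) (s≤s (ℕ.+-mono-≤-< i≤n (ℕ.m≤n⇒m≤1+n j<n))) = trans
        (cong (+ 2 ℤ.*_) (ℤ.+-comm (+ 0) (A i (suc j) (suc i) (suc j))))
        (forwards _ (suc-minus (peak (suc (suc (i + j))))) refl refl)

    ver : + 2 ℤ.* Σ² N N v ≡ Σ² n N (vertical t A)
    ver = trans (cong (+ 2 ℤ.*_) (Σ²-mergeˡ n N
        (λ i j → (i + j <ᵇ n) · A (suc i) j (suc i) (suc j)) (λ i j → (n <ᵇ i + j) · A i (suc j) i j)
        (λ j _ → cong (_· A (suc n) j (suc n) (suc j)) (<ᵇ-false (ℕ.m≤m+n n j)))
        (λ { j (s≤s j≤n) → cong (_· A 0 (suc j) 0 j) (<ᵇ-false j≤n) })))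
      (trans (sym (Σ²-* n N (+ 2) λ i j →
          (i + j <ᵇ n) · A (suc i) j (suc i) (suc j) ℤ.+ (n <ᵇ suc i + j) · A (suc i) (suc j)
              (suc i) j)) (Σ²-cong n N λ i j i<n j<N → pointwise i j i<n j<N))
      where
      pointwise : ∀ i j → i < n → j < N →
        + 2 ℤ.* ((i + j <ᵇ n) · A (suc i) j (suc i) (suc j) ℤ.+ (n <ᵇ suc i + j) · A (suc i) (suc j)
            (suc i) j)
        ≡ vertical t A i j
      pointwise i j i<n j<N with i + j ℕ.<? n
      ... | yes lt rewrite ℕ.+-suc i j | <ᵇ-true lt | <ᵇ-false {n} {suc (i + j)} lt | peak-rises (s≤s lt) =
        forwards _ (suc-minus (peak (suc (i + j)))) refl refl
      ... | no ≮ rewrite ℕ.+-suc i j | <ᵇ-false (ℕ.≮⇒≥ ≮) | <ᵇ-true (s≤s (ℕ.≮⇒≥ ≮))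
              | peak-falls (s≤s (ℕ.≮⇒≥ ≮)) (s≤s (ℕ.+-mono-≤ i<n (ℕ.<⇒≤ j<N))) =
        backwards _ (minus-suc (peak (suc (suc (i + j))))) refl (skew (suc i) (suc j) (suc i) j)

    dia : + 2 ℤ.* Σ² N N d ≡ Σ² N N (diagonal t A)
    dia = trans (sym (Σ²-* N N (+ 2) d)) (Σ²-cong N N λ i j i<N j<N → pointwise i j i<N j<N)
      where
      drop : ∀ a x y m → a ≡ x → a ≡ (m ℤ.- m) ℤ.* y ℤ.+ x
      drop a x y m eq = trans eq (sym (trans (cong (λ z → z ℤ.* y ℤ.+ x) (ℤ.i≡j⇒i-j≡0 {m} refl))
          (ℤ.+-identityˡ x)))
      pointwise : ∀ i j → i < N → j < N → + 2 ℤ.* d i j ≡ diagonal t A i j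
      pointwise i j i<N j<N rewrite ℕ.+-suc i j with ℕ.<-cmp (i + j) n
      ... | tri< lt _ _ rewrite <ᵇ-true lt | <ᵇ-false (ℕ.<⇒≤ lt) | peak-rises (s≤s lt) | peak-rises
          (ℕ.m≤n⇒m≤1+n lt) =
        drop _ _ _ (+ suc (peak (i + j))) (lemma (+ peak (i + j)) (A i (suc j) (suc i) j))
        where
        lemma : ∀ m a → + 2 ℤ.* (a ℤ.+ + 0) ≡ (+ 2 ℤ.+ m ℤ.- m) ℤ.* a
        lemma = ℤ-solver.solve-∀
      -- A unit square on the antidiagonal is a saddle: one coefficient vanishes because its two
      -- corners have the same coordinate sum, the other because `peak` is symmetric about `N`.
      ... | tri≈ _ eq _ rewrite eq | <ᵇ-false (ℕ.≤-refl {n}) = drop _ _ _ (+ peak N)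
        (sym (trans (cong (ℤ._* A i (suc j) (suc i) j)
          (ℤ.i≡j⇒i-j≡0 (cong +_ (ℕ.suc-injective
              (trans (sym (peak-falls ℕ.≤-refl (ℕ.m<m+n N (s≤s z≤n)))) (peak-rises ℕ.≤-refl)))))) refl))
      ... | tri> _ _ gt rewrite <ᵇ-true gt | <ᵇ-false (ℕ.<⇒≤ gt)
              | peak-falls gt (ℕ.+-mono-<-≤ i<N (ℕ.<⇒≤ j<N))
              | peak-falls (ℕ.m≤n⇒m≤1+n gt) (ℕ.+-mono-≤-< i<N j<N) = drop _ _ _
                  (+ suc (peak (suc (suc (i + j)))))
        (trans (cong (λ z → + 2 ℤ.* (+ 0 ℤ.+ z)) (skew (suc i) j i (suc j)))
            (lemma (+ peak (suc (suc (i + j)))) (A i (suc j) (suc i) j)))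
        where
        lemma : ∀ m a → + 2 ℤ.* (+ 0 ℤ.+ ℤ.- a) ≡ (m ℤ.- (+ 2 ℤ.+ m)) ℤ.* a
        lemma = ℤ-solver.solve-∀

-- Charts

module _ {t : ℕ} where

  Positioned : Set → Set
  Positioned X = Side t → ℕ → ℕ → ℕ → X

  -- f assigns the same value to a point of a triangle in the coordinates of all three sides.
  RotationInvariant : {X : Set} → Positioned X → Set
  RotationInvariant f = ∀ s a b c → f (next s) a b c ≡ f s c a b

  -- A normal form of points: the triangle and the coordinates read from its side 0. Equal normal
  -- forms mean the same point of the same triangle, before any sides are glued.
  position : Positioned (Fin t × ℕ × ℕ × ℕ)
  position (τ , zero)           a b c = τ , a , b , c
  position (τ , suc zero)       a b c = τ , c , a , b
  position (τ , suc (suc zero)) a b c = τ , b , c , a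

  position-rot : RotationInvariant position
  position-rot (τ , zero)           a b c = refl
  position-rot (τ , suc zero)       a b c = refl
  position-rot (τ , suc (suc zero)) a b c = refl

  position-triangle : ∀ s a b c → proj₁ (position s a b c) ≡ proj₁ s
  position-triangle (τ , zero)           a b c = refl
  position-triangle (τ , suc zero)       a b c = refl
  position-triangle (τ , suc (suc zero)) a b c = refl

  position⇒triangle : ∀ {s a b c s′ a′ b′ c′} → position s a b c ≡ position s′ a′ b′ c′ → proj₁ s ≡ proj₁ s′
  position⇒triangle {s} {a} {b} {c} {s′} eq =
    trans (sym (position-triangle s a b c)) (trans (cong proj₁ eq) (position-triangle s′ _ _ _))

  position-injective : ∀ s {a b c a′ b′ c′} → position s a b c ≡ position s a′ b′ c′ →
    a ≡ a′ × b ≡ b′ × c ≡ c′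
  position-injective (τ , zero)           refl = refl , refl , refl
  position-injective (τ , suc zero)       refl = refl , refl , refl
  position-injective (τ , suc (suc zero)) refl = refl , refl , refl

  position-cong : ∀ {X} {f : Positioned X} → RotationInvariant f →
    ∀ {s a b c s′ a′ b′ c′} → position s a b c ≡ position s′ a′ b′ c′ → f s a b c ≡ f s′ a′ b′ c′
  position-cong {f = f} rot {s} {a} {b} {c} {s′} eq =
    trans (normal s a b c) (trans (cong (λ (τ , a , b , c) → f (τ , zero) a b c) eq) (sym (normal s′ _ _ _)))
    where
    normal : ∀ s a b c → f s a b c ≡ (λ (τ , a , b , c) → f (τ , zero) a b c) (position s a b c)
    normal (τ , zero)           a b c = refl
    normal (τ , suc zero)       a b c = rot (τ , zero) a b c
    normal (τ , suc (suc zero)) a b c = trans (rot (τ , suc zero) a b c) (rot (τ , zero) c a b)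

  position-sum : ∀ s {a b c} s′ {a′ b′ c′} → position s a b c ≡ position s′ a′ b′ c′ →
    a + b + c ≡ a′ + b′ + c′
  position-sum s s′ = position-cong {f = λ _ a b c → a + b + c} rotated {s} {s′ = s′}
    where
    rotated : ∀ (_ : Side t) a b c → a + b + c ≡ c + a + b
    rotated _ a b c = trans (ℕ.+-comm (a + b) c) (sym (ℕ.+-assoc c a b))

  position-all : ∀ {P : ℕ → Set} s {a b c} s′ {a′ b′ c′} → position s a b c ≡ position s′ a′ b′ c′ →
    P a × P b × P c → P a′ × P b′ × P c′
  position-all {P} s s′ eq ps = from s′ (subst All₃ eq (to s ps))
    where
    All₃ : Fin t × ℕ × ℕ × ℕ → Set
    All₃ (_ , a , b , c) = P a × P b × P c
    to : ∀ s {a b c} → P a × P b × P c → All₃ (position s a b c)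
    to (τ , zero)           (p , q , r) = p , q , r
    to (τ , suc zero)       (p , q , r) = r , p , q
    to (τ , suc (suc zero)) (p , q , r) = q , r , p
    from : ∀ s {a b c} → All₃ (position s a b c) → P a × P b × P c
    from (τ , zero)           (p , q , r) = p , q , r
    from (τ , suc zero)       (p , q , r) = q , r , p
    from (τ , suc (suc zero)) (p , q , r) = r , p , q

  next³ : ∀ (s : Side t) → next (next (next s)) ≡ s
  next³ (τ , zero)           = refl
  next³ (τ , suc zero)       = refl
  next³ (τ , suc (suc zero)) = refl

  next≢ : ∀ (s : Side t) → next s ≢ s
  next≢ (τ , zero)           ()
  next≢ (τ , suc zero)       ()
  next≢ (τ , suc (suc zero)) ()

  prev≢ : ∀ (s : Side t) → prev s ≢ s
  prev≢ (τ , zero)           ()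
  prev≢ (τ , suc zero)       ()
  prev≢ (τ , suc (suc zero)) ()

  sameTriangle : ∀ (s s′ : Side t) → proj₁ s ≡ proj₁ s′ → s ≡ s′ ⊎ s ≡ next s′ ⊎ s ≡ prev s′
  sameTriangle (_ , zero)           (_ , zero)           refl = inj₁ refl
  sameTriangle (_ , zero)           (_ , suc zero)       refl = inj₂ (inj₂ refl)
  sameTriangle (_ , zero)           (_ , suc (suc zero)) refl = inj₂ (inj₁ refl)
  sameTriangle (_ , suc zero)       (_ , zero)           refl = inj₂ (inj₁ refl)
  sameTriangle (_ , suc zero)       (_ , suc zero)       refl = inj₁ refl
  sameTriangle (_ , suc zero)       (_ , suc (suc zero)) refl = inj₂ (inj₂ refl)
  sameTriangle (_ , suc (suc zero)) (_ , zero)           refl = inj₂ (inj₂ refl)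
  sameTriangle (_ , suc (suc zero)) (_ , suc zero)       refl = inj₂ (inj₁ refl)
  sameTriangle (_ , suc (suc zero)) (_ , suc (suc zero)) refl = inj₁ refl

∈-positiveTriples : ∀ {s a b c} → a < s → b < s → c < s → 1 ≤ a × 1 ≤ b × 1 ≤ c × a + b + c ≡ s →
  (a , b , c) ∈ positiveTriples s
∈-positiveTriples {s} a< b< c< = ∈-filter⁺
  (λ (a , b , c) → 1 ℕ.≤? a ×-dec 1 ℕ.≤? b ×-dec 1 ℕ.≤? c ×-dec a + b + c ℕ.≟ s)
  (∈-cartesianProduct⁺ (∈-upTo⁺ a<) (∈-cartesianProduct⁺ (∈-upTo⁺ b<) (∈-upTo⁺ c<)))

vertices-unique : ∀ {t m} n → Unique (vertices {t} {m} n)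
vertices-unique {t} {m} n = Unique.++⁺
  (Unique.cartesianProductWith⁺ onE (λ { refl → refl , refl }) (Unique.allFin⁺ m) (Unique.upTo⁺ n))
  (Unique.cartesianProductWith⁺ inT (λ { refl → refl , refl }) (Unique.allFin⁺ t) (Unique.filter⁺
    (λ (a , b , c) → 1 ℕ.≤? a ×-dec 1 ℕ.≤? b ×-dec 1 ℕ.≤? c ×-dec a + b + c ℕ.≟ suc n)
    (Unique.cartesianProduct⁺ (Unique.upTo⁺ (suc n)) (Unique.cartesianProduct⁺ (Unique.upTo⁺ (suc n))
        (Unique.upTo⁺ (suc n))))))
  (λ (v∈ , v∈′) → disjoint (∈-cartesianProductWith⁻ onE (allFin m) (upTo n) v∈)
                            (∈-cartesianProductWith⁻ inT (allFin t) (positiveTriples (suc n)) v∈′))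
  where
  onE : Fin m → ℕ → Vertex t m
  onE e s = onEdge e (suc s)
  inT : Fin t → ℕ × ℕ × ℕ → Vertex t m
  inT τ (a , b , c) = inTriangle τ a b c
  disjoint : ∀ {v} → (∃ λ e → ∃ λ s → e ∈ allFin m × s ∈ upTo n × v ≡ onE e s) →
    ¬ (∃ λ τ → ∃ λ abc → τ ∈ allFin t × abc ∈ positiveTriples (suc n) × v ≡ inT τ abc)
  disjoint (_ , _ , _ , _ , refl) (_ , _ , _ , _ , ())

opposite-involutive : ∀ {m} (e : OrientedEdge m) → opposite (opposite e) ≡ e
opposite-involutive (e , b) = cong (e ,_) (Bool.not-involutive b)

-- Gluings of sides and identifications of points

module TriangulationProperties {t m : ℕ} (T : Triangulation t m) where
  open Triangulation T

  glued-sym : ∀ {s s′} → Glued s s′ → Glued s′ s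
  glued-sym {s} g = sym (trans (cong opposite g) (opposite-involutive (edge T s)))

  glued-unique : ∀ {s k k′} → Glued s k → Glued s k′ → k ≡ k′
  glued-unique g g′ = edge-injective (trans g (sym g′))

  glued-irreflexive : ∀ {s} → ¬ Glued s s
  glued-irreflexive {s} g = Bool.not-¬ refl (cong proj₂ g)

  -- Folding a triangle along two adjacent sides makes their common corner a puncture: turning
  -- around it leads from `next h` through `h` back to `next h`, so the finite witness
  -- `ReachesBoundary` never ends.
  unglued-next : ∀ {h} → ¬ Glued (next h) h
  unglued-next {h} g = go (unpunctured (next h))
    where
    go : ReachesBoundary (next h) → ⊥
    go (here free)  = free h g
    go (turn g′ r) with refl ← glued-unique g g′ = go r

  unglued-prev : ∀ {h} → ¬ Glued (prev h) h
  unglued-prev {h} g = unglued-next {prev h} (subst (λ s → Glued s (prev h)) (sym (next³ h)) (glued-sym g))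

  -- Otherwise the final corner of h would be a puncture.
  unglued-adjacent : ∀ {h k} → Glued h k → ¬ Glued (next h) (prev k)
  unglued-adjacent {h} {k} g g₁ = go (unpunctured (next h))
    where
    -- The two triangles alternate around this corner, `next h` leading to `k` and `k` back to
    -- `next h`. As `next (prev k)` is `k` only by `next³`, the second half carries an equation.
    mutual
      go : ReachesBoundary (next h) → ⊥
      go (here free)  = free (prev k) g₁
      go (turn g′ r) with refl ← glued-unique g₁ g′ = go′ refl r
      go′ : ∀ {s} → s ≡ next (prev k) → ReachesBoundary s → ⊥
      go′ refl (here free) = free h (subst (λ s → Glued s h) (sym (next³ k)) (glued-sym g))
      go′ refl (turn g′ r) with refl ← glued-unique (subst (λ s → Glued s h) (sym (next³ k)) (glued-sym g)) g′ = go r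

  glued⇒triangles≢ : ∀ {h k} → Glued h k → proj₁ h ≢ proj₁ k
  glued⇒triangles≢ {h} {k} g eq with sameTriangle h k eq
  ... | inj₁ refl        = glued-irreflexive {h} g
  ... | inj₂ (inj₁ refl) = unglued-next g
  ... | inj₂ (inj₂ refl) = unglued-prev {k} g

  -- How the chart of an n-triangulated quiver of T identifies points: points inside a triangle
  -- are on their own, points inside an arc lie on its two sides, and corners are irrelevant.
  record IsChart (n : ℕ) (χ : Chart t m) : Set where
    field
      rotation : RotationInvariant χ
      glue     : ∀ {s s′ a b} → Glued s s′ → 1 ≤ a → 1 ≤ b → a + b ≡ suc n → χ s a b 0 ≡ χ s′ b a 0
      member   : ∀ s {a b c} → a + b + c ≡ suc n → a ≤ n × b ≤ n × c ≤ n → χ s a b c ∈ vertices n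
      inner    : ∀ s s′ {a b c a′ b′ c′} → a + b + c ≡ suc n → a′ + b′ + c′ ≡ suc n → 1 ≤ a × 1 ≤ b × 1 ≤ c →
                 χ s a b c ≡ χ s′ a′ b′ c′ → position s a b c ≡ position s′ a′ b′ c′
      onSides  : ∀ s s′ {a b a′ b′} → a + b ≡ suc n → a′ + b′ ≡ suc n → 1 ≤ a × 1 ≤ b → 1 ≤ a′ × 1 ≤ b′ →
                 χ s a b 0 ≡ χ s′ a′ b′ 0 → (s ≡ s′ × a ≡ a′) ⊎ (Glued s s′ × a ≡ b′)
      corner   : ∀ s s′ {a b} → a + b ≡ suc n → 1 ≤ a × 1 ≤ b → χ s a b 0 ≢ χ s′ (suc n) 0 0

  module Initial (n : ℕ) where
    private χ = initialChart T

    onSide : OrientedEdge m → ℕ → ℕ → Vertex t m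
    onSide (e , true)  a b = onEdge e b
    onSide (e , false) a b = onEdge e a

    initial-onSide : ∀ s a b → χ s (suc a) (suc b) 0 ≡ onSide (edge T s) (suc a) (suc b)
    initial-onSide (τ , zero) a b with edge T (τ , zero)
    ... | e , true  = refl
    ... | e , false = refl
    initial-onSide (τ , suc zero) a b with edge T (τ , suc zero)
    ... | e , true  = refl
    ... | e , false = refl
    initial-onSide (τ , suc (suc zero)) a b with edge T (τ , suc (suc zero))
    ... | e , true  = refl
    ... | e , false = refl

    -- Charts are total, so corners receive junk names. These have distance 0 or n + 1 on their
    -- edge, which separates them from the vertices on edges, whose distances lie strictly between.
    initial-corner : ∀ s → ∃ λ e → χ s (suc n) 0 0 ≡ onEdge e 0 ⊎ χ s (suc n) 0 0 ≡ onEdge e (suc n)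
    initial-corner (τ , zero) with edge T (τ , suc (suc zero))
    ... | e , true  = e , inj₂ refl
    ... | e , false = e , inj₁ refl
    initial-corner (τ , suc zero) with edge T (τ , suc zero)
    ... | e , true  = e , inj₁ refl
    ... | e , false = e , inj₂ refl
    initial-corner (τ , suc (suc zero)) with edge T (τ , suc (suc zero))
    ... | e , true  = e , inj₁ refl
    ... | e , false = e , inj₂ refl

    initial-rotation : RotationInvariant χ
    initial-rotation (τ , zero)           a b c = refl
    initial-rotation (τ , suc zero)       a b c = refl
    initial-rotation (τ , suc (suc zero)) a b c = refl

    onSide-glued : ∀ {s s′} a b → Glued s s′ → onSide (edge T s) a b ≡ onSide (edge T s′) b a
    onSide-glued {s} {s′} a b g with edge T s | edge T s′ | g
    ... | e , true  | _ | refl = refl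
    ... | e , false | _ | refl = refl

    onEdge-member : ∀ e x → suc x ≤ n → _∈_ {A = Vertex t m} (onEdge e (suc x)) (vertices n)
    onEdge-member e x x<n = ∈-++⁺ˡ (∈-cartesianProductWith⁺ (λ e s → onEdge e (suc s)) (∈-allFin e)
        (∈-upTo⁺ x<n))

    initial-member : ∀ τ a b c → a + b + c ≡ suc n → a ≤ n → b ≤ n → c ≤ n → χ (τ , zero) a b c ∈ vertices n
    initial-member τ zero zero c sum _ _ c≤n = contradiction (subst (_≤ n) sum c≤n) ℕ.1+n≰n
    initial-member τ (suc a) zero zero sum a≤n _ _ =
      contradiction (subst (_≤ n) (trans (sym (trans (ℕ.+-identityʳ _) (ℕ.+-identityʳ _))) sum) a≤n) ℕ.1+n≰n
    initial-member τ (suc a) zero (suc c) sum a≤n _ c≤n with edge T (τ , suc (suc zero))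
    ... | e , true  = onEdge-member e a a≤n
    ... | e , false = onEdge-member e c c≤n
    initial-member τ zero (suc b) zero sum _ b≤n _ =
      contradiction (subst (_≤ n) (trans (sym (ℕ.+-identityʳ _)) sum) b≤n) ℕ.1+n≰n
    initial-member τ zero (suc b) (suc c) sum _ b≤n c≤n with edge T (τ , suc zero)
    ... | e , true  = onEdge-member e c c≤n
    ... | e , false = onEdge-member e b b≤n
    initial-member τ (suc a) (suc b) zero sum a≤n b≤n _ with edge T (τ , zero)
    ... | e , true  = onEdge-member e b b≤n
    ... | e , false = onEdge-member e a a≤n
    initial-member τ (suc a) (suc b) (suc c) sum a≤n b≤n c≤n = ∈-++⁺ʳ _ (∈-cartesianProductWith⁺
      (λ τ (a , b , c) → inTriangle τ a b c) (∈-allFin τ)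
      (∈-positiveTriples (s≤s a≤n) (s≤s b≤n) (s≤s c≤n) (s≤s z≤n , s≤s z≤n , s≤s z≤n , sum)))

    initial-inner : ∀ τ τ′ {a b c} a′ b′ c′ → χ (τ , zero) (suc a) (suc b) (suc c) ≡ χ (τ′ , zero) a′ b′ c′ →
      position (τ , zero) (suc a) (suc b) (suc c) ≡ position (τ′ , zero) a′ b′ c′
    initial-inner τ τ′ zero zero c′ eq with edge T (τ′ , suc (suc zero))
    initial-inner τ τ′ zero zero c′ () | _ , true
    initial-inner τ τ′ zero zero c′ () | _ , false
    initial-inner τ τ′ (suc a′) zero c′ eq with edge T (τ′ , suc (suc zero))
    initial-inner τ τ′ (suc a′) zero c′ () | _ , true
    initial-inner τ τ′ (suc a′) zero c′ () | _ , false
    initial-inner τ τ′ zero (suc b′) c′ eq with edge T (τ′ , suc zero)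
    initial-inner τ τ′ zero (suc b′) c′ () | _ , true
    initial-inner τ τ′ zero (suc b′) c′ () | _ , false
    initial-inner τ τ′ (suc a′) (suc b′) zero eq with edge T (τ′ , zero)
    initial-inner τ τ′ (suc a′) (suc b′) zero () | _ , true
    initial-inner τ τ′ (suc a′) (suc b′) zero () | _ , false
    initial-inner τ τ′ (suc a′) (suc b′) (suc c′) refl = refl

    normal : ∀ s a b c → let (τ , x , y , z) = position s a b c in χ s a b c ≡ χ (τ , zero) x y z
    normal (τ , zero)           a b c = refl
    normal (τ , suc zero)       a b c = refl
    normal (τ , suc (suc zero)) a b c = refl

    onSide-injective : ∀ s s′ {a b a′ b′} → a + b ≡ suc n → a′ + b′ ≡ suc n →
      onSide (edge T s) a b ≡ onSide (edge T s′) a′ b′ → (s ≡ s′ × a ≡ a′) ⊎ (Glued s s′ × a ≡ b′)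
    onSide-injective s s′ {a} {b} {a′} {b′} sum sum′ eq = go (edge T s) (edge T s′) refl refl eq
      where
      sums : a + b ≡ a′ + b′
      sums = trans sum (sym sum′)
      go : ∀ e e′ → e ≡ edge T s → e′ ≡ edge T s′ → onSide e a b ≡ onSide e′ a′ b′ →
        (s ≡ s′ × a ≡ a′) ⊎ (Glued s s′ × a ≡ b′)
      go (e , true)  (e , true)  p q refl = inj₁ (edge-injective (trans (sym p) q) , ℕ.+-cancelʳ-≡ b _ _ sums)
      go (e , false) (e , false) p q refl = inj₁ (edge-injective (trans (sym p) q) , refl)
      go (e , true)  (e , false) p q refl =
        inj₂ (trans (sym q) (cong opposite p) , ℕ.+-cancelʳ-≡ b _ _ (trans sums (ℕ.+-comm b b′)))
      go (e , false) (e , true)  p q refl = inj₂ (trans (sym q) (cong opposite p) , refl)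

    onSide-middle : ∀ e {a b} → a + b ≡ suc n → 1 ≤ a → 1 ≤ b →
      ∃ λ x → onSide e a b ≡ onEdge (proj₁ e) x × 1 ≤ x × x ≤ n
    onSide-middle (e , true)  {suc a} {suc b} sum _ _ = _ , refl , s≤s z≤n ,
      subst (suc b ≤_) (ℕ.suc-injective sum) (ℕ.m≤n+m (suc b) a)
    onSide-middle (e , false) {suc a} {suc b} sum _ _ = _ , refl , s≤s z≤n ,
      subst (suc a ≤_) (ℕ.suc-injective (trans (sym (ℕ.+-suc (suc a) b)) sum)) (ℕ.m≤m+n (suc a) b)

    initial-isChart : IsChart n χ
    initial-isChart = record
      { rotation = initial-rotation
      ; glue     = λ { {s} {s′} {suc a} {suc b} g _ _ _ →
          trans (initial-onSide s a b) (trans (onSide-glued {s} {s′} (suc a) (suc b) g)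
              (sym (initial-onSide s′ b a))) }
      ; member   = λ s sum ≤n → subst (_∈ vertices n) (sym (normal s _ _ _))
          (let (τ , x , y , z) = position s _ _ _
               eq : position s _ _ _ ≡ position (τ , zero) x y z
               eq = refl
               (x≤ , y≤ , z≤) = position-all {P = _≤ n} s (τ , zero) eq ≤n
           in initial-member τ x y z (trans (sym (position-sum s (τ , zero) eq)) sum) x≤ y≤ z≤)
      ; inner    = λ s s′ {a} {b} {c} {a′} {b′} {c′} _ _ pos eq →
          let (τ , x , y , z) = position s a b c
              (τ′ , x′ , y′ , z′) = position s′ a′ b′ c′
          in go (position-all {P = 1 ≤_} s (τ , zero) {x} {y} {z} refl pos)
               (trans (sym (normal s a b c)) (trans eq (normal s′ a′ b′ c′)))
      ; onSides  = λ { s s′ {suc a} {suc b} {suc a′} {suc b′} sum sum′ _ _ eq → onSide-injective s s′ sum sum′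
          (trans (sym (initial-onSide s a b)) (trans eq (initial-onSide s′ a′ b′))) }
      ; corner   = λ { s s′ {suc a} {suc b} sum (1≤a , 1≤b) eq →
          apart sum 1≤a 1≤b (trans (sym eq) (initial-onSide s a b)) (initial-corner s′) }
      }
      where
      go : ∀ {τ x y z τ′ x′ y′ z′} → 1 ≤ x × 1 ≤ y × 1 ≤ z → χ (τ , zero) x y z ≡ χ (τ′ , zero) x′ y′ z′ →
        (τ , x , y , z) ≡ (τ′ , x′ , y′ , z′)
      go (s≤s _ , s≤s _ , s≤s _) eq = initial-inner _ _ _ _ _ eq
      apart : ∀ {a b v e} → a + b ≡ suc n → 1 ≤ a → 1 ≤ b → v ≡ onSide e a b →
        ¬ ∃ λ e → v ≡ onEdge e 0 ⊎ v ≡ onEdge e (suc n)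
      apart {e = e} sum 1≤a 1≤b refl (_ , eq) with onSide-middle e sum 1≤a 1≤b
      ... | x , p , 1≤x , x≤n with eq
      ... | inj₁ q with refl ← trans (sym p) q = contradiction 1≤x λ ()
      ... | inj₂ q with refl ← trans (sym p) q = contradiction x≤n ℕ.1+n≰n

-- The square of two adjacent triangles

module Square {t m : ℕ} (T : Triangulation t m) (n : ℕ) (χ : Chart t m)
  (isChart : TriangulationProperties.IsChart T n χ) (h k : Side t)
  (glued : Triangulation.Glued T h k) where

  open Triangulation T using (Glued)
  open TriangulationProperties T
  open IsChart isChart

  N : ℕ
  N = suc n

  opaque
    □ : ℕ → ℕ → Vertex t m
    □ = Cluster.square n h k χ

    □≡square : □ ≡ Cluster.square n h k χ
    □≡square = refl

  h≢k : proj₁ h ≢ proj₁ k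
  h≢k = glued⇒triangles≢ glued

  opaque
    unfolding □

    □-lower : ∀ {i j} → j ≤ i → □ i j ≡ χ h (N ∸ i) j (i ∸ j)
    □-lower {i} {j} j≤i with j ℕ.≤? i
    ... | yes _   = refl
    ... | no j≰i = contradiction j≤i j≰i

    □-upper : ∀ {i j} → i < j → □ i j ≡ χ k i (N ∸ j) (j ∸ i)
    □-upper {i} {j} i<j with j ℕ.≤? i
    ... | yes j≤i = contradiction i<j (ℕ.≤⇒≯ j≤i)
    ... | no _    = refl

  lower-sum : ∀ {i j} → j ≤ i → i ≤ N → N ∸ i + j + (i ∸ j) ≡ N
  lower-sum {i} {j} j≤i i≤N = trans (ℕ.+-assoc (N ∸ i) j _)
    (trans (cong (_+_ (N ∸ i)) (ℕ.m+[n∸m]≡n j≤i)) (ℕ.m∸n+n≡m i≤N))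

  upper-sum : ∀ {i j} → i ≤ j → j ≤ N → i + (N ∸ j) + (j ∸ i) ≡ N
  upper-sum {i} {j} i≤j j≤N = trans (cong (_+ (j ∸ i)) (ℕ.+-comm i (N ∸ j))) (lower-sum i≤j j≤N)

  Interior : ℕ → ℕ → Set
  Interior i j = (1 ≤ i × i ≤ n) × (1 ≤ j × j ≤ n)

  n∸-bounds : ∀ {i} → 1 ≤ i → i ≤ n → 1 ≤ N ∸ i × N ∸ i ≤ n
  n∸-bounds {suc i} _ i≤n = ℕ.m<n⇒0<n∸m (s≤s i≤n) , ℕ.m∸n≤m n i

  -- The constructors overlap for `i ≡ j`, since a point of the arc has one position in each of the
  -- two triangles.
  data Located (i j : ℕ) (s : Side t) (a b c : ℕ) : Set where
    below : j ≤ i → position s a b c ≡ position h (N ∸ i) j (i ∸ j) → Located i j s a b c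
    above : i ≤ j → position s a b c ≡ position k i (N ∸ j) (j ∸ i) → Located i j s a b c

  Located-resp : ∀ {i j s a b c s′ a′ b′ c′} → position s a b c ≡ position s′ a′ b′ c′ →
    Located i j s′ a′ b′ c′ → Located i j s a b c
  Located-resp eq (below j≤i e) = below j≤i (trans eq e)
  Located-resp eq (above i≤j e) = above i≤j (trans eq e)

  diagonal-separated : ∀ {i} → 1 ≤ i → i ≤ n → ∀ s {a b} → a + b ≡ N →
    χ s a b 0 ≡ χ h (N ∸ i) i 0 → Located i i s a b 0
  diagonal-separated {i} 1≤i i≤n s {zero} refl eq = contradiction
    (sym (trans (rotation s N 0 0) eq))
    (corner h (next s) (ℕ.m∸n+n≡m (ℕ.m≤n⇒m≤1+n i≤n)) (proj₁ (n∸-bounds 1≤i i≤n) , 1≤i))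
  diagonal-separated {i} 1≤i i≤n s {suc a} {zero} sum eq = contradiction
    (sym (trans (cong (λ x → χ s x 0 0) (sym (trans (sym (ℕ.+-identityʳ (suc a))) sum))) eq))
    (corner h s (ℕ.m∸n+n≡m (ℕ.m≤n⇒m≤1+n i≤n)) (proj₁ (n∸-bounds 1≤i i≤n) , 1≤i))
  diagonal-separated {i} 1≤i i≤n s {suc a} {suc b} sum eq
    with onSides h s sum-i sum (proj₁ (n∸-bounds 1≤i i≤n) , 1≤i) (s≤s z≤n , s≤s z≤n) (sym eq)
    where
    sum-i = ℕ.m∸n+n≡m (ℕ.m≤n⇒m≤1+n i≤n)
  ... | inj₁ (refl , e) = below ℕ.≤-refl (trans
    (cong (position h (suc a) (suc b)) (sym (ℕ.n∸n≡0 i)))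
      (cong₂ (λ x y → position h x y (i ∸ i)) (sym e)
        (ℕ.+-cancelˡ-≡ (suc a) _ _ (trans sum (trans (sym (ℕ.m∸n+n≡m (ℕ.m≤n⇒m≤1+n i≤n))) (cong (_+ i) e))))))
  ... | inj₂ (g , e) with refl ← glued-unique glued g = above ℕ.≤-refl
    (trans (cong (position k (suc a) (suc b)) (sym (ℕ.n∸n≡0 i)))
      (cong₂ (λ x y → position k x y (i ∸ i))
        (ℕ.+-cancelʳ-≡ (suc b) _ _ (trans sum (trans (sym (ℕ.m∸n+n≡m (ℕ.m≤n⇒m≤1+n i≤n)))
            (trans (ℕ.+-comm (N ∸ i) i) (cong (_+_ i) e)))))
        (sym e)))

  -- An interior point of the square has no further names: off the diagonal it lies inside a
  -- triangle, on the diagonal inside an arc, whose only sides are `h` and `k`. A point on the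
  -- boundary of the square can have names in other triangles, or a second one in the square if
  -- opposite sides are glued. Hence the condition `Interior` here and, for one of the two points,
  -- in `□-injective`.
  □-separated : ∀ {i j} → Interior i j → ∀ s {a b c} → a + b + c ≡ N → χ s a b c ≡ □ i j → Located i j s a b c
  □-separated {i} {j} ((1≤i , i≤n) , (1≤j , j≤n)) s {a} {b} {c} sum eq with ℕ.<-cmp j i
  ... | tri< j<i _ _ = below (ℕ.<⇒≤ j<i) (sym (inner h s (lower-sum (ℕ.<⇒≤ j<i) (ℕ.m≤n⇒m≤1+n i≤n)) sum
          (proj₁ (n∸-bounds 1≤i i≤n) , 1≤j , ℕ.m<n⇒0<n∸m j<i) (sym (trans eq (□-lower (ℕ.<⇒≤ j<i))))))
  ... | tri> _ _ i<j = above (ℕ.<⇒≤ i<j) (sym (inner k s (upper-sum (ℕ.<⇒≤ i<j) (ℕ.m≤n⇒m≤1+n j≤n)) sum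
          (1≤i , proj₁ (n∸-bounds 1≤j j≤n) , ℕ.m<n⇒0<n∸m i<j) (sym (trans eq (□-upper i<j)))))
  ... | tri≈ _ refl _ = go a b c sum (trans eq (trans (□-lower ℕ.≤-refl) (cong (χ h (N ∸ i) i) (ℕ.n∸n≡0 i))))
    where
    go : ∀ a b c → a + b + c ≡ N → χ s a b c ≡ χ h (N ∸ i) i 0 → Located i i s a b c
    go zero b c sum eq = Located-resp (sym (position-rot s b c 0))
      (diagonal-separated 1≤i i≤n (next s) sum (trans (rotation s b c 0) eq))
    go (suc a) zero c sum eq = Located-resp (sym (trans (position-rot (next s) c (suc a) 0)
        (position-rot s 0 c (suc a))))
      (diagonal-separated 1≤i i≤n (prev s) (trans (ℕ.+-comm c (suc a))
          (trans (cong (_+ c) (sym (ℕ.+-identityʳ (suc a)))) sum))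
        (trans (rotation (next s) c (suc a) 0) (trans (rotation s 0 c (suc a)) eq)))
    go (suc a) (suc b) zero sum eq =
      diagonal-separated 1≤i i≤n s (trans (sym (ℕ.+-identityʳ _)) sum) eq
    go (suc a) (suc b) (suc c) sum eq = below ℕ.≤-refl (trans
      (inner s h sum (trans (ℕ.+-identityʳ _) (ℕ.m∸n+n≡m (ℕ.m≤n⇒m≤1+n i≤n))) (s≤s z≤n , s≤s z≤n , s≤s z≤n) eq)
      (cong (position h (N ∸ i) i) (sym (ℕ.n∸n≡0 i))))

  □-outside : ∀ {i j} → Interior i j → ∀ s {a b c} → a + b + c ≡ N →
    proj₁ s ≢ proj₁ h → proj₁ s ≢ proj₁ k → χ s a b c ≢ □ i j
  □-outside int s sum s≢h s≢k eq with □-separated int s sum eq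
  ... | below _ e = s≢h (position⇒triangle {s = s} {s′ = h} e)
  ... | above _ e = s≢k (position⇒triangle {s = s} {s′ = k} e)

  □-injective : ∀ {i j i′ j′} → Interior i j → i′ ≤ N → j′ ≤ N → □ i′ j′ ≡ □ i j → i′ ≡ i × j′ ≡ j
  □-injective {i} {j} {i′} {j′} int@((_ , i≤n) , (_ , j≤n)) i′≤N j′≤N eq with j′ ℕ.≤? i′
  ... | yes j′≤i′ with □-separated int h (lower-sum j′≤i′ i′≤N) (trans (sym (□-lower j′≤i′)) eq)
  ...   | below _ e = let (e₁ , e₂ , _) = position-injective h e in ℕ.∸-cancelˡ-≡ i′≤N (ℕ.m≤n⇒m≤1+n i≤n) e₁ , e₂
  ...   | above _ e = contradiction (position⇒triangle {s = h} {s′ = k} e) h≢k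
  □-injective {i} {j} {i′} {j′} int@((_ , i≤n) , (_ , j≤n)) i′≤N j′≤N eq | no j′≰i′
    with □-separated int k (upper-sum (ℕ.<⇒≤ (ℕ.≰⇒> j′≰i′)) j′≤N) (trans (sym (□-upper (ℕ.≰⇒> j′≰i′))) eq)
  ...   | below _ e = contradiction (sym (position⇒triangle {s = k} {s′ = h} e)) h≢k
  ...   | above _ e = let (e₁ , e₂ , _) = position-injective k e in e₁ , ℕ.∸-cancelˡ-≡ j′≤N (ℕ.m≤n⇒m≤1+n j≤n) e₂

  extreme : ∀ {x} → 1 ≤ x × x ≤ n → ¬ (x ≡ 0 ⊎ x ≡ N)
  extreme (1≤x , _) (inj₁ refl) = contradiction 1≤x λ ()
  extreme (_ , x≤n) (inj₂ refl) = ℕ.1+n≰n x≤n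

  □-corner : ∀ {i j} → Interior i j → ∀ s → χ s N 0 0 ≢ □ i j
  □-corner {i} {j} ((1≤i , i≤n) , (1≤j , j≤n)) s eq
    with □-separated ((1≤i , i≤n) , (1≤j , j≤n)) s (trans (ℕ.+-identityʳ _) (ℕ.+-identityʳ _)) eq
  -- All coordinates of a corner are `0` or `N`. This property passes through `position-all` to the
  -- interior point, one of whose coordinates lies between `1` and `n`.
  ... | below _ e = extreme (n∸-bounds 1≤i i≤n) (proj₁ (position-all {P = λ x → x ≡ 0 ⊎ x ≡ N} s h e
      (inj₂ refl , inj₁ refl , inj₁ refl)))
  ... | above _ e = extreme (1≤i , i≤n) (proj₁ (position-all {P = λ x → x ≡ 0 ⊎ x ≡ N} s k e
      (inj₂ refl , inj₁ refl , inj₁ refl)))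

  -- The last four hypotheses exclude the corners (0 , 0), (N , N), (0 , N) and (N , 0) in this
  -- order.
  □-member : ∀ {i j} → i ≤ N → j ≤ N → 1 ≤ i + j → i + j < N + N → (i ≢ 0 ⊎ j ≢ N) → (i ≢ N ⊎ j ≢ 0) →
    □ i j ∈ vertices n
  □-member {i} {j} i≤N j≤N _ _ _ _ with j ℕ.≤? i
  □-member {i} {j} i≤N j≤N 1≤ <2N _ ¬corner | yes j≤i = subst (_∈ vertices n) (sym (□-lower j≤i))
      (member h (lower-sum j≤i i≤N)
    (ℕ.≤-trans (ℕ.∸-monoʳ-≤ N (positive j≤i 1≤)) ℕ.≤-refl , ℕ.≤-pred
        (ℕ.≤∧≢⇒< j≤N (λ e → ℕ.<⇒≢ <2N (cong₂ _+_ (ℕ.≤-antisym i≤N (subst (_≤ i) e j≤i)) e))) , bound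
        ¬corner))
    where
    positive : ∀ {i j} → j ≤ i → 1 ≤ i + j → 1 ≤ i
    positive {suc i} _   _ = s≤s z≤n
    positive {zero} z≤n ()
    bound : (i ≢ N ⊎ j ≢ 0) → i ∸ j ≤ n
    bound (inj₁ i≢N) = ℕ.≤-trans (ℕ.m∸n≤m i j) (ℕ.≤-pred (ℕ.≤∧≢⇒< i≤N i≢N))
    bound (inj₂ j≢0) = ℕ.≤-trans (ℕ.∸-mono i≤N (ℕ.n≢0⇒n>0 j≢0)) ℕ.≤-refl
  □-member {i} {j} i≤N j≤N 1≤ <2N ¬corner _ | no j≰i = subst (_∈ vertices n) (sym (□-upper i<j))
      (member k (upper-sum (ℕ.<⇒≤ i<j) j≤N)
    (ℕ.≤-pred (ℕ.<-≤-trans i<j j≤N) , ℕ.∸-monoʳ-≤ N (ℕ.≤-trans (s≤s z≤n) i<j) , bound ¬corner))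
    where
    i<j = ℕ.≰⇒> j≰i
    bound : (i ≢ 0 ⊎ j ≢ N) → j ∸ i ≤ n
    bound (inj₁ i≢0) = ℕ.∸-mono j≤N (ℕ.n≢0⇒n>0 i≢0)
    bound (inj₂ j≢N) = ℕ.≤-trans (ℕ.m∸n≤m j i) (ℕ.≤-pred (ℕ.≤∧≢⇒< j≤N j≢N))

-- The chart after a flip

module _ {t : ℕ} (h k : Side t) where

  data SideView : Side t → Set where
    h₀ : SideView h
    h₁ : SideView (next h)
    h₂ : SideView (prev h)
    k₀ : SideView k
    k₁ : SideView (next k)
    k₂ : SideView (prev k)
    outside : ∀ {s} → proj₁ s ≢ proj₁ h → proj₁ s ≢ proj₁ k → SideView s

  sideView : ∀ s → SideView s
  sideView s with proj₁ s Fin.≟ proj₁ h | proj₁ s Fin.≟ proj₁ k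
  ... | no s≢h | no s≢k = outside s≢h s≢k
  ... | yes s≡h | _ with sameTriangle s h s≡h
  ...   | inj₁ refl        = h₀
  ...   | inj₂ (inj₁ refl) = h₁
  ...   | inj₂ (inj₂ refl) = h₂
  sideView s | no _ | yes s≡k with sameTriangle s k s≡k
  ...   | inj₁ refl        = k₀
  ...   | inj₂ (inj₁ refl) = k₁
  ...   | inj₂ (inj₂ refl) = k₂

  replaced : ∀ {X : Set} (x₁ x₂ x₃ y₁ y₂ y₃ : X) (f : Side t → X) {s} → SideView s → X
  replaced x₁ x₂ x₃ y₁ y₂ y₃ f h₀ = x₁
  replaced x₁ x₂ x₃ y₁ y₂ y₃ f h₁ = x₂
  replaced x₁ x₂ x₃ y₁ y₂ y₃ f h₂ = x₃
  replaced x₁ x₂ x₃ y₁ y₂ y₃ f k₀ = y₁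
  replaced x₁ x₂ x₃ y₁ y₂ y₃ f k₁ = y₂
  replaced x₁ x₂ x₃ y₁ y₂ y₃ f k₂ = y₃
  replaced x₁ x₂ x₃ y₁ y₂ y₃ f {s} (outside _ _) = f s

  -- As the two triangles are different, the six sides are too. Otherwise an earlier test in
  -- `replace` could shadow a later one.
  replace≡replaced : ∀ {X : Set} {x₁ x₂ x₃ y₁ y₂ y₃ : X} {f : Side t → X} → proj₁ h ≢ proj₁ k →
    ∀ {s} (v : SideView s) → replace h k x₁ x₂ x₃ y₁ y₂ y₃ f s ≡ replaced x₁ x₂ x₃ y₁ y₂ y₃ f v
  replace≡replaced h≢k {s} v
    with s ≟ˢ h | s ≟ˢ next h | s ≟ˢ prev h | s ≟ˢ k | s ≟ˢ next k | s ≟ˢ prev k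
  replace≡replaced h≢k h₀ | yes _ | _ | _ | _ | _ | _ = refl
  replace≡replaced h≢k h₀ | no ≢ | _ | _ | _ | _ | _ = contradiction refl ≢
  replace≡replaced h≢k h₁ | yes e | _ | _ | _ | _ | _ = contradiction e (next≢ h)
  replace≡replaced h≢k h₁ | no _ | yes _ | _ | _ | _ | _ = refl
  replace≡replaced h≢k h₁ | no _ | no ≢ | _ | _ | _ | _ = contradiction refl ≢
  replace≡replaced h≢k h₂ | yes e | _ | _ | _ | _ | _ = contradiction e (prev≢ h)
  replace≡replaced h≢k h₂ | no _ | yes e | _ | _ | _ | _ = contradiction e (next≢ (next h))
  replace≡replaced h≢k h₂ | no _ | no _ | yes _ | _ | _ | _ = refl
  replace≡replaced h≢k h₂ | no _ | no _ | no ≢ | _ | _ | _ = contradiction refl ≢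
  replace≡replaced h≢k k₀ | yes e | _ | _ | _ | _ | _ = contradiction (sym (cong proj₁ e)) h≢k
  replace≡replaced h≢k k₀ | no _ | yes e | _ | _ | _ | _ = contradiction (sym (cong proj₁ e)) h≢k
  replace≡replaced h≢k k₀ | no _ | no _ | yes e | _ | _ | _ = contradiction (sym (cong proj₁ e)) h≢k
  replace≡replaced h≢k k₀ | no _ | no _ | no _ | yes _ | _ | _ = refl
  replace≡replaced h≢k k₀ | no _ | no _ | no _ | no ≢ | _ | _ = contradiction refl ≢
  replace≡replaced h≢k k₁ | yes e | _ | _ | _ | _ | _ = contradiction (sym (cong proj₁ e)) h≢k
  replace≡replaced h≢k k₁ | no _ | yes e | _ | _ | _ | _ = contradiction (sym (cong proj₁ e)) h≢k
  replace≡replaced h≢k k₁ | no _ | no _ | yes e | _ | _ | _ = contradiction (sym (cong proj₁ e)) h≢k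
  replace≡replaced h≢k k₁ | no _ | no _ | no _ | yes e | _ | _ = contradiction e (next≢ k)
  replace≡replaced h≢k k₁ | no _ | no _ | no _ | no _ | yes _ | _ = refl
  replace≡replaced h≢k k₁ | no _ | no _ | no _ | no _ | no ≢ | _ = contradiction refl ≢
  replace≡replaced h≢k k₂ | yes e | _ | _ | _ | _ | _ = contradiction (sym (cong proj₁ e)) h≢k
  replace≡replaced h≢k k₂ | no _ | yes e | _ | _ | _ | _ = contradiction (sym (cong proj₁ e)) h≢k
  replace≡replaced h≢k k₂ | no _ | no _ | yes e | _ | _ | _ = contradiction (sym (cong proj₁ e)) h≢k
  replace≡replaced h≢k k₂ | no _ | no _ | no _ | yes e | _ | _ = contradiction e (prev≢ k)
  replace≡replaced h≢k k₂ | no _ | no _ | no _ | no _ | yes e | _ = contradiction e (next≢ (next k))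
  replace≡replaced h≢k k₂ | no _ | no _ | no _ | no _ | no _ | yes _ = refl
  replace≡replaced h≢k k₂ | no _ | no _ | no _ | no _ | no _ | no ≢ = contradiction refl ≢
  replace≡replaced h≢k (outside s≢h s≢k) | yes e | _ | _ | _ | _ | _ = contradiction (cong proj₁ e) s≢h
  replace≡replaced h≢k (outside s≢h s≢k) | no _ | yes e | _ | _ | _ | _ = contradiction (cong proj₁ e) s≢h
  replace≡replaced h≢k (outside s≢h s≢k) | no _ | no _ | yes e | _ | _ | _ = contradiction (cong proj₁ e) s≢h
  replace≡replaced h≢k (outside s≢h s≢k) | no _ | no _ | no _ | yes e | _ | _ = contradiction
      (cong proj₁ e) s≢k
  replace≡replaced h≢k (outside s≢h s≢k) | no _ | no _ | no _ | no _ | yes e | _ = contradiction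
      (cong proj₁ e) s≢k
  replace≡replaced h≢k (outside s≢h s≢k) | no _ | no _ | no _ | no _ | no _ | yes e = contradiction
      (cong proj₁ e) s≢k
  replace≡replaced h≢k (outside s≢h s≢k) | no _ | no _ | no _ | no _ | no _ | no _ = refl

module FlippedChart {t m : ℕ} {T T′ : Triangulation t m} (fl : Flip T T′) (n : ℕ) (χ : Chart t m)
  (isChart : TriangulationProperties.IsChart T n χ) where

  open Flip fl
  open Square T n χ isChart h k glued public
  open TriangulationProperties T
  open IsChart isChart
  open Triangulation T using (Glued)
  open Triangulation T′ using () renaming (Glued to Glued′; edge-injective to edge′-injective)
  private module ′ = TriangulationProperties T′

  opaque
    χ′ : Chart t m
    χ′ = replace h k (λ a b c → □ b a)             (λ a b c → □ a c)             (λ a b c → □ c b)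
                     (λ a b c → □ (a + c) (b + c)) (λ a b c → □ (b + c) (a + b)) (λ a b c → □ (a + b) (a + c))
                     χ

    χ′≡ : ∀ {s} (v : SideView h k s) a b c → χ′ s a b c ≡ replaced h k
      (λ a b c → □ b a)             (λ a b c → □ a c)             (λ a b c → □ c b)
      (λ a b c → □ (a + c) (b + c)) (λ a b c → □ (b + c) (a + b)) (λ a b c → □ (a + b) (a + c)) χ v a b c
    χ′≡ v a b c = cong (λ (f : ℕ → ℕ → ℕ → Vertex t m) → f a b c) (replace≡replaced h k h≢k v)

  opaque
    unfolding □ χ′

    χ′≡replace : χ′ ≡ (let □ = Cluster.square n h k χ in
      replace h k (λ a b c → □ b a)             (λ a b c → □ a c)             (λ a b c → □ c b)
                  (λ a b c → □ (a + c) (b + c)) (λ a b c → □ (b + c) (a + b)) (λ a b c → □ (a + b) (a + c))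
                  χ)
    χ′≡replace = refl

  edge′≡ : ∀ {s} (v : SideView h k s) → edge T′ s ≡
    replaced h k (edge T h) (edge T (prev h)) (edge T (next k)) (edge T k) (edge T (prev k))
        (edge T (next h)) (edge T) v
  edge′≡ {s} v = trans (result s) (replace≡replaced h k h≢k v)

  glued′ : Glued′ h k
  glued′ = trans (edge′≡ k₀) (trans glued (cong opposite (sym (edge′≡ h₀))))

  -- The triangle at `h` is now the half i + j ≤ N of the square, with coordinates (j , i , N - i -
  -- j), and the triangle at `k` is the half i + j ≥ N, with coordinates (N - j , N - i , i + j -
  -- N). With `cover` the six sides reduce to these two formulas.
  data Cover (s : Side t) (a b c : ℕ) : Set where
    inH : ∀ A B C → position s a b c ≡ position h A B C → χ′ s a b c ≡ □ B A → Cover s a b c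
    inK : ∀ A B C → position s a b c ≡ position k A B C → χ′ s a b c ≡ □ (A + C) (B + C) → Cover s a b c
    out : proj₁ s ≢ proj₁ h → proj₁ s ≢ proj₁ k → χ′ s a b c ≡ χ s a b c → Cover s a b c

  position-next² : ∀ (s : Side t) a b c → position (prev s) a b c ≡ position s b c a
  position-next² s a b c = trans (position-rot (next s) a b c) (position-rot s c a b)

  cover : ∀ s a b c → Cover s a b c
  cover s a b c with sideView h k s
  ... | h₀ = inH a b c refl (χ′≡ h₀ a b c)
  ... | h₁ = inH c a b (position-rot h a b c) (χ′≡ h₁ a b c)
  ... | h₂ = inH b c a (position-next² h a b c) (χ′≡ h₂ a b c)
  ... | k₀ = inK a b c refl (χ′≡ k₀ a b c)
  ... | k₁ = inK c a b (position-rot k a b c) (trans (χ′≡ k₁ a b c) (cong (λ x → □ x (a + b)) (ℕ.+-comm b c)))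
  ... | k₂ = inK b c a (position-next² k a b c)
               (trans (χ′≡ k₂ a b c) (cong₂ □ (ℕ.+-comm a b) (ℕ.+-comm a c)))
  ... | outside s≢h s≢k = out s≢h s≢k (χ′≡ (outside s≢h s≢k) a b c)

  rotation′ : RotationInvariant χ′
  rotation′ s a b c with sideView h k s
  ... | h₀ = trans (χ′≡ h₁ a b c) (sym (χ′≡ h₀ c a b))
  ... | h₁ = trans (χ′≡ h₂ a b c) (sym (χ′≡ h₁ c a b))
  ... | h₂ = trans (cong (λ s → χ′ s a b c) (next³ h)) (trans (χ′≡ h₀ a b c) (sym (χ′≡ h₂ c a b)))
  ... | k₀ = trans (χ′≡ k₁ a b c) (trans (cong (λ x → □ x (a + b)) (ℕ.+-comm b c)) (sym (χ′≡ k₀ c a b)))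
  ... | k₁ = trans (χ′≡ k₂ a b c) (trans (cong (□ (a + b)) (ℕ.+-comm a c)) (sym (χ′≡ k₁ c a b)))
  ... | k₂ = trans (cong (λ s → χ′ s a b c) (next³ k)) (trans (χ′≡ k₀ a b c)
               (trans (cong₂ □ (ℕ.+-comm a c) (ℕ.+-comm b c)) (sym (χ′≡ k₂ c a b))))
  ... | outside s≢h s≢k = trans (χ′≡ {next s} (outside s≢h s≢k) a b c)
               (trans (rotation s a b c) (sym (χ′≡ {s} (outside s≢h s≢k) c a b)))

  rotation² : ∀ s a b c → χ (prev s) a b c ≡ χ s b c a
  rotation² s a b c = trans (rotation (next s) a b c) (rotation s c a b)

  complement : ∀ {a b} → a + b ≡ N → N ∸ a ≡ b
  complement {a} {b} sum = trans (cong (_∸ a) (sym sum)) (ℕ.m+n∸m≡n a b)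

  -- Apart from the two sides of the new arc, every side is an old side `s*` under a possibly
  -- different name, and its points avoid the interior of the square. Gluings and coincidences of
  -- such sides can thus be pulled back to `T`.
  data NewSide (s : Side t) : Set where
    atH : s ≡ h → NewSide s
    atK : s ≡ k → NewSide s
    old : ∀ s* → edge T′ s ≡ edge T s* →
      (∀ {a b} → 1 ≤ a → 1 ≤ b → a + b ≡ N → χ′ s a b 0 ≡ χ s* a b 0) →
      (∀ {a b i j} → a + b ≡ N → Interior i j → χ′ s a b 0 ≢ □ i j) → NewSide s

  newSide : ∀ s → NewSide s
  newSide s with sideView h k s
  ... | h₀ = atH refl
  ... | k₀ = atK refl
  ... | h₁ = old (prev h) (edge′≡ h₁)
    (λ {a} {b} _ _ sum → begin
      χ′ (next h) a b 0     ≡⟨ χ′≡ h₁ a b 0 ⟩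
      □ a 0                 ≡⟨ □-lower z≤n ⟩
      χ h (N ∸ a) 0 a       ≡⟨ cong (λ x → χ h x 0 a) (complement sum) ⟩
      χ h b 0 a             ≡⟨ rotation² h a b 0 ⟨
      χ (prev h) a b 0      ∎)
    (λ {a} {b} sum int eq → contradiction
      (proj₁ (proj₂ int)) (ℕ.<⇒≱ (s≤s
          (ℕ.≤-reflexive (sym (proj₂ (□-injective int (ℕ.m+n≤o⇒m≤o a (ℕ.≤-reflexive sum)) z≤n
        (trans (sym (χ′≡ h₁ a b 0)) eq))))))))
  ... | h₂ = old (next k) (edge′≡ h₂)
    (λ {a} {b} _ 1≤b sum → begin
      χ′ (prev h) a b 0     ≡⟨ χ′≡ h₂ a b 0 ⟩
      □ 0 b                 ≡⟨ □-upper 1≤b ⟩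
      χ k 0 (N ∸ b) b       ≡⟨ cong (λ x → χ k 0 x b) (complement (trans (ℕ.+-comm b a) sum)) ⟩
      χ k 0 a b             ≡⟨ rotation k a b 0 ⟨
      χ (next k) a b 0      ∎)
    (λ {a} {b} sum int eq → contradiction
      (proj₁ (proj₁ int)) (ℕ.<⇒≱ (s≤s
          (ℕ.≤-reflexive (sym (proj₁ (□-injective int z≤n (ℕ.m+n≤o⇒n≤o a (ℕ.≤-reflexive sum))
        (trans (sym (χ′≡ h₂ a b 0)) eq))))))))
  ... | k₁ = old (prev k) (edge′≡ k₁)
    (λ {a} {b} 1≤a _ sum → begin
      χ′ (next k) a b 0       ≡⟨ χ′≡ k₁ a b 0 ⟩
      □ (b + 0) (a + b)       ≡⟨ cong₂ □ (ℕ.+-identityʳ b) sum ⟩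
      □ b N                   ≡⟨ □-upper (subst (b <_) sum (ℕ.m<n+m b 1≤a)) ⟩
      χ k b (N ∸ N) (N ∸ b)   ≡⟨ cong₂ (χ k b) (ℕ.n∸n≡0 N) (complement (trans (ℕ.+-comm b a) sum)) ⟩
      χ k b 0 a               ≡⟨ rotation² k a b 0 ⟨
      χ (prev k) a b 0        ∎)
    (λ {a} {b} sum int eq → contradiction
      (proj₂ (proj₂ int)) (ℕ.<⇒≱ (ℕ.≤-reflexive (proj₂ (□-injective int
        (ℕ.m+n≤o⇒n≤o a (ℕ.≤-reflexive sum)) ℕ.≤-refl
        (trans (sym (trans (χ′≡ k₁ a b 0) (cong₂ □ (ℕ.+-identityʳ b) sum))) eq))))))
  ... | k₂ = old (next h) (edge′≡ k₂)
    (λ {a} {b} _ _ sum → begin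
      χ′ (prev k) a b 0       ≡⟨ χ′≡ k₂ a b 0 ⟩
      □ (a + b) (a + 0)       ≡⟨ cong₂ □ sum (ℕ.+-identityʳ a) ⟩
      □ N a                   ≡⟨ □-lower (ℕ.m+n≤o⇒m≤o a (ℕ.≤-reflexive sum)) ⟩
      χ h (N ∸ N) a (N ∸ a)   ≡⟨ cong₂ (λ x → χ h x a) (ℕ.n∸n≡0 N) (complement sum) ⟩
      χ h 0 a b               ≡⟨ rotation h a b 0 ⟨
      χ (next h) a b 0        ∎)
    (λ {a} {b} sum int eq → contradiction
      (proj₂ (proj₁ int)) (ℕ.<⇒≱ (ℕ.≤-reflexive (proj₁ (□-injective int
        ℕ.≤-refl (ℕ.m+n≤o⇒m≤o a (ℕ.≤-reflexive sum))
        (trans (sym (trans (χ′≡ k₂ a b 0) (cong₂ □ sum (ℕ.+-identityʳ a)))) eq))))))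
  ... | outside s≢h s≢k = old s (edge′≡ {s} (outside s≢h s≢k))
    (λ _ _ _ → χ′≡ {s} (outside s≢h s≢k) _ _ _)
    (λ sum int eq → □-outside int s (trans (ℕ.+-identityʳ _) sum) s≢h s≢k
        (trans (sym (χ′≡ {s} (outside s≢h s≢k) _ _ _)) eq))

  corner′ : ∀ s → ∃ λ s* → χ′ s N 0 0 ≡ χ s* N 0 0
  corner′ s with sideView h k s
  ... | h₀ = prev k , trans (χ′≡ h₀ N 0 0) 0N
    where
    0N : □ 0 N ≡ χ (prev k) N 0 0
    0N = trans (□-upper (s≤s z≤n)) (trans (cong (λ x → χ k 0 x N) (ℕ.n∸n≡0 N)) (sym (rotation² k N 0 0)))
  ... | h₁ = prev h , trans (χ′≡ h₁ N 0 0) N0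
    where
    N0 : □ N 0 ≡ χ (prev h) N 0 0
    N0 = trans (□-lower z≤n) (trans (cong (λ x → χ h x 0 N) (ℕ.n∸n≡0 N)) (sym (rotation² h N 0 0)))
  ... | h₂ = h , trans (χ′≡ h₂ N 0 0) (□-lower z≤n)
  ... | k₀ = prev h , trans (χ′≡ k₀ N 0 0) (trans (cong (λ x → □ x 0) (ℕ.+-identityʳ N)) (trans (□-lower z≤n)
               (trans (cong (λ x → χ h x 0 N) (ℕ.n∸n≡0 N)) (sym (rotation² h N 0 0)))))
  ... | k₁ = prev k , trans (χ′≡ k₁ N 0 0) (trans (cong (□ 0) (ℕ.+-identityʳ N)) (trans (□-upper (s≤s z≤n))
               (trans (cong (λ x → χ k 0 x N) (ℕ.n∸n≡0 N)) (sym (rotation² k N 0 0)))))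
  ... | k₂ = next h , trans (χ′≡ k₂ N 0 0) (trans (cong₂ □ (ℕ.+-identityʳ N) (ℕ.+-identityʳ N))
      (trans (□-lower ℕ.≤-refl)
               (trans (cong₂ (λ x y → χ h x N y) (ℕ.n∸n≡0 N) (ℕ.n∸n≡0 N)) (sym (rotation h N 0 0)))))
  ... | outside s≢h s≢k = s , χ′≡ {s} (outside s≢h s≢k) N 0 0

  corner-interior : ∀ {i j} → Interior i j → ∀ s → χ′ s N 0 0 ≢ □ i j
  corner-interior int s eq = let (s* , e) = corner′ s in □-corner int s* (trans (sym e) eq)

  arc-interior : ∀ {a b} → a + b ≡ N → 1 ≤ a × 1 ≤ b → Interior b a
  arc-interior {suc a} {suc b} sum (1≤a , 1≤b) =
    (1≤b , subst (suc b ≤_) (ℕ.suc-injective sum) (ℕ.m≤n+m (suc b) a)) ,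
    (1≤a , subst (suc a ≤_) (ℕ.suc-injective (trans (sym (ℕ.+-suc (suc a) b)) sum)) (ℕ.m≤m+n (suc a) b))

  χ′-arcK : ∀ a b → χ′ k a b 0 ≡ □ a b
  χ′-arcK a b = trans (χ′≡ k₀ a b 0) (cong₂ □ (ℕ.+-identityʳ a) (ℕ.+-identityʳ b))

  glue′ : ∀ {s s′ a b} → Glued′ s s′ → 1 ≤ a → 1 ≤ b → a + b ≡ N → χ′ s a b 0 ≡ χ′ s′ b a 0
  glue′ {s} {s′} {a} {b} g 1≤a 1≤b sum with newSide s
  ... | atH refl with refl ← ′.glued-unique glued′ g = trans (χ′≡ h₀ a b 0) (sym (χ′-arcK b a))
  ... | atK refl with refl ← ′.glued-unique (′.glued-sym {h} glued′) g = trans (χ′-arcK a b) (sym (χ′≡ h₀ b a 0))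
  ... | old s* e f sep with newSide s′
  -- Impossible: the only side glued to `h` is `k`, whose points lie in the interior of the square,
  -- and `s` avoids it. The same holds with `h` and `k` exchanged.
  ...   | atH refl = ⊥-elim (sep sum (arc-interior (trans (ℕ.+-comm b a) sum) (1≤b , 1≤a))
            (trans (cong (λ s → χ′ s a b 0) (′.glued-unique (′.glued-sym {s} g) glued′)) (χ′-arcK a b)))
  ...   | atK refl = ⊥-elim (sep sum (arc-interior sum (1≤a , 1≤b))
            (trans (cong (λ s → χ′ s a b 0) (′.glued-unique (′.glued-sym {s} g)
                (′.glued-sym {h} glued′))) (χ′≡ h₀ a b 0)))
  ...   | old s′* e′ f′ _ = trans (f 1≤a 1≤b sum) (trans
            (glue (trans (sym e′) (trans g (cong opposite e))) 1≤a 1≤b sum)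
            (sym (f′ 1≤b 1≤a (trans (ℕ.+-comm b a) sum))))

  covered-sum : ∀ (s s′ : Side t) {a b c A B C} → a + b + c ≡ N → position s a b c ≡ position s′ A B C →
      A + B + C ≡ N
  covered-sum s s′ sum e = trans (sym (position-sum s s′ e)) sum

  below-bounds : ∀ A B C → A + B + C ≡ N → B ≤ N × A ≤ N
  below-bounds A B C sum = ℕ.m+n≤o⇒n≤o A AB≤N , ℕ.m+n≤o⇒m≤o A AB≤N
    where
    AB≤N = ℕ.m+n≤o⇒m≤o (A + B) (ℕ.≤-reflexive sum)

  above-bounds : ∀ A B C → A + B + C ≡ N → A + C ≤ N × B + C ≤ N
  above-bounds A B C sum =
    subst (A + C ≤_) sum (ℕ.+-monoˡ-≤ C (ℕ.m≤m+n A B)) , subst (B + C ≤_) sum (ℕ.+-monoˡ-≤ C (ℕ.m≤n+m B A))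

  below-interior : ∀ A B C → A + B + C ≡ N → 1 ≤ A × 1 ≤ B × 1 ≤ C → Interior B A
  below-interior A B C sum (1≤A , 1≤B , 1≤C) = (1≤B , ℕ.m+n≤o⇒n≤o A A+B≤n) , (1≤A , ℕ.m+n≤o⇒m≤o A A+B≤n)
    where
    A+B≤n : A + B ≤ n
    A+B≤n = ℕ.≤-pred (subst (A + B <_) sum (ℕ.m<m+n (A + B) 1≤C))

  above-interior : ∀ A B C → A + B + C ≡ N → 1 ≤ A × 1 ≤ B × 1 ≤ C → Interior (A + C) (B + C)
  above-interior A B C sum (1≤A , 1≤B , 1≤C) =
    (ℕ.≤-trans 1≤A (ℕ.m≤m+n A C) , ℕ.≤-pred (subst (A + C <_) sum (ℕ.+-monoˡ-< C (ℕ.m<m+n A 1≤B)))) ,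
    (ℕ.≤-trans 1≤B (ℕ.m≤m+n B C) , ℕ.≤-pred (subst (B + C <_) sum (ℕ.+-monoˡ-< C (ℕ.m<n+m B 1≤A))))

  -- Only the new arc itself lies in both new triangles.
  below∩above : ∀ A B C A′ B′ C′ → A + B + C ≡ N → A′ + B′ + C′ ≡ N →
    B ≡ A′ + C′ → A ≡ B′ + C′ → C ≡ 0 × C′ ≡ 0
  below∩above A B C A′ B′ C′ sum sum′ refl refl = ℕ.m+n≡0⇒m≡0 C C+C′≡0 , ℕ.m+n≡0⇒n≡0 C C+C′≡0
    where
    shuffle : ∀ x y z w → y + z + (x + z) + w ≡ x + y + z + (w + z)
    shuffle = ℕ-solver.solve-∀
    C+C′≡0 : C + C′ ≡ 0
    C+C′≡0 = ℕ.+-cancelˡ-≡ N (C + C′) 0 (trans (cong (_+ (C + C′)) (sym sum′))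
      (trans (sym (shuffle A′ B′ C′ C)) (trans sum (sym (ℕ.+-identityʳ N)))))

  below-injective : ∀ (s : Side t) A B C A′ B′ C′ → A + B + C ≡ N → A′ + B′ + C′ ≡ N →
    B′ ≡ B × A′ ≡ A → position s A B C ≡ position s A′ B′ C′
  below-injective s A B C A′ B′ C′ sum sum′ (refl , refl) =
    cong (position s A B) (ℕ.+-cancelˡ-≡ (A + B) _ _ (trans sum (sym sum′)))

  above-injective : ∀ (s : Side t) A B C A′ B′ C′ → A + B + C ≡ N → A′ + B′ + C′ ≡ N →
    A′ + C′ ≡ A + C × B′ + C′ ≡ B + C → position s A B C ≡ position s A′ B′ C′
  above-injective s A B C A′ B′ C′ sum sum′ (p , q) = below-injective s A B C A′ B′ C′ sum sum′
    ( ℕ.+-cancelˡ-≡ (A′ + C′) _ _ (trans (swap A′ B′ C′)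
        (trans sum′ (trans (sym sum) (trans (sym (swap A B C)) (cong (_+ B) (sym p))))))
    , ℕ.+-cancelʳ-≡ (B′ + C′) _ _ (trans (sym (ℕ.+-assoc A′ B′ C′))
        (trans sum′ (trans (sym sum) (trans (ℕ.+-assoc A B C) (cong (_+_ A) (sym q))))))
    )
    where
    swap : ∀ x y z → x + z + y ≡ x + y + z
    swap = ℕ-solver.solve-∀

  inner-outside : ∀ s {a b c} → a + b + c ≡ N → 1 ≤ a × 1 ≤ b × 1 ≤ c → proj₁ s ≢ proj₁ h → proj₁ s ≢
      proj₁ k →
    ∀ i j → i ≤ N × j ≤ N → χ s a b c ≢ □ i j
  inner-outside s sum pos s≢h s≢k i j (i≤N , j≤N) eq with j ℕ.≤? i
  ... | yes j≤i = s≢h (position⇒triangle {s = s} {s′ = h} (inner s h sum (lower-sum j≤i i≤N) pos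
      (trans eq (□-lower j≤i))))
  ... | no j≰i = s≢k (position⇒triangle {s = s} {s′ = k}
      (inner s k sum (upper-sum (ℕ.<⇒≤ (ℕ.≰⇒> j≰i)) j≤N) pos (trans eq (□-upper (ℕ.≰⇒> j≰i)))))

  -- A point inside one of the two new triangles is an interior point of the square, where the
  -- vertex determines the position. A point inside any other triangle was already such a point for
  -- `χ`.
  inner′ : ∀ s s′ {a b c a′ b′ c′} → a + b + c ≡ N → a′ + b′ + c′ ≡ N → 1 ≤ a × 1 ≤ b × 1 ≤ c →
    χ′ s a b c ≡ χ′ s′ a′ b′ c′ → position s a b c ≡ position s′ a′ b′ c′
  inner′ s s′ {a} {b} {c} {a′} {b′} {c′} sum sum′ pos eq = go (cover s a b c) (cover s′ a′ b′ c′)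
    where
    go : Cover s a b c → Cover s′ a′ b′ c′ → position s a b c ≡ position s′ a′ b′ c′
    go (inH A B C e f) = λ where
        (inH A′ B′ C′ e′ f′) → let sum₂ = covered-sum s′ h sum′ e′; (i≤ , j≤) = below-bounds A′ B′ C′ sum₂ in
          trans e (trans (below-injective h A B C A′ B′ C′ sum₁ sum₂ (□-injective int i≤ j≤
              (match f f′))) (sym e′))
        (inK A′ B′ C′ e′ f′) →
          let sum₂ = covered-sum s′ k sum′ e′
              (i≤ , j≤) = above-bounds A′ B′ C′ sum₂
              (p , q) = □-injective int i≤ j≤ (match f f′)
          in contradiction (proj₁ (below∩above A B C A′ B′ C′ sum₁ sum₂ (sym p) (sym q)))
              (ℕ.m<n⇒n≢0 (proj₂ (proj₂ pos₁)))
        (out s′≢h s′≢k f′) → ⊥-elim (□-outside int s′ sum′ s′≢h s′≢k (match f f′))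
      where
      sum₁ = covered-sum s h sum e
      pos₁ = position-all {P = 1 ≤_} s h e pos
      int = below-interior A B C sum₁ pos₁
      match : ∀ {x y} → χ′ s a b c ≡ x → χ′ s′ a′ b′ c′ ≡ y → y ≡ x
      match f f′ = trans (sym f′) (trans (sym eq) f)
    go (inK A B C e f) = λ where
        (inH A′ B′ C′ e′ f′) →
          let sum₂ = covered-sum s′ h sum′ e′
              (i≤ , j≤) = below-bounds A′ B′ C′ sum₂
              (p , q) = □-injective int i≤ j≤ (match f f′)
          in contradiction (proj₂ (below∩above A′ B′ C′ A B C sum₂ sum₁ p q)) (ℕ.m<n⇒n≢0 (proj₂ (proj₂ pos₁)))
        (inK A′ B′ C′ e′ f′) → let sum₂ = covered-sum s′ k sum′ e′; (i≤ , j≤) = above-bounds A′ B′ C′ sum₂ in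
          trans e (trans (above-injective k A B C A′ B′ C′ sum₁ sum₂ (□-injective int i≤ j≤
              (match f f′))) (sym e′))
        (out s′≢h s′≢k f′) → ⊥-elim (□-outside int s′ sum′ s′≢h s′≢k (match f f′))
      where
      sum₁ = covered-sum s k sum e
      pos₁ = position-all {P = 1 ≤_} s k e pos
      int = above-interior A B C sum₁ pos₁
      match : ∀ {x y} → χ′ s a b c ≡ x → χ′ s′ a′ b′ c′ ≡ y → y ≡ x
      match f f′ = trans (sym f′) (trans (sym eq) f)
    go (out s≢h s≢k f) = λ where
      (inH A′ B′ C′ e′ f′) → ⊥-elim (inner-outside s sum pos s≢h s≢k B′ A′
        (below-bounds A′ B′ C′ (covered-sum s′ h sum′ e′)) (trans (sym f) (trans eq f′)))
      (inK A′ B′ C′ e′ f′) → ⊥-elim (inner-outside s sum pos s≢h s≢k (A′ + C′) (B′ + C′)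
        (above-bounds A′ B′ C′ (covered-sum s′ k sum′ e′)) (trans (sym f) (trans eq f′)))
      (out _ _ f′) → inner s s′ sum sum′ pos (trans (sym f) (trans eq f′))

  onSides′ : ∀ s s′ {a b a′ b′} → a + b ≡ N → a′ + b′ ≡ N → 1 ≤ a × 1 ≤ b → 1 ≤ a′ × 1 ≤ b′ →
    χ′ s a b 0 ≡ χ′ s′ a′ b′ 0 → (s ≡ s′ × a ≡ a′) ⊎ (Glued′ s s′ × a ≡ b′)
  onSides′ s s′ {a} {b} {a′} {b′} sum sum′ pos pos′ eq = go (newSide s) (newSide s′)
    where
    swapped : b + a ≡ N
    swapped = trans (ℕ.+-comm b a) sum
    a≤N = ℕ.m+n≤o⇒m≤o a (ℕ.≤-reflexive sum)
    a′≤N = ℕ.m+n≤o⇒m≤o a′ (ℕ.≤-reflexive sum′)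
    b′≤N = ℕ.m+n≤o⇒n≤o a′ (ℕ.≤-reflexive sum′)
    go : NewSide s → NewSide s′ → (s ≡ s′ × a ≡ a′) ⊎ (Glued′ s s′ × a ≡ b′)
    go (atH refl) (atH refl) = inj₁ (refl , sym (proj₂ (□-injective (arc-interior sum pos) b′≤N a′≤N
      (trans (sym (χ′≡ h₀ a′ b′ 0)) (trans (sym eq) (χ′≡ h₀ a b 0))))))
    go (atH refl) (atK refl) = inj₂ (glued′ , sym (proj₂ (□-injective (arc-interior sum pos) a′≤N b′≤N
      (trans (sym (χ′-arcK a′ b′)) (trans (sym eq) (χ′≡ h₀ a b 0))))))
    go (atH refl) (old _ _ _ sep) =
      ⊥-elim (sep sum′ (arc-interior sum pos) (trans (sym eq) (χ′≡ h₀ a b 0)))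
    go (atK refl) (atH refl) = inj₂ (′.glued-sym {h} glued′ , sym (proj₁ (□-injective
      (arc-interior swapped (proj₂ pos , proj₁ pos)) b′≤N a′≤N (trans (sym (χ′≡ h₀ a′ b′ 0))
          (trans (sym eq) (χ′-arcK a b))))))
    go (atK refl) (atK refl) = inj₁ (refl , sym (proj₁ (□-injective
      (arc-interior swapped (proj₂ pos , proj₁ pos)) a′≤N b′≤N (trans (sym (χ′-arcK a′ b′))
          (trans (sym eq) (χ′-arcK a b))))))
    go (atK refl) (old _ _ _ sep) =
      ⊥-elim (sep sum′ (arc-interior swapped (proj₂ pos , proj₁ pos)) (trans (sym eq) (χ′-arcK a b)))
    go (old _ _ _ sep) (atH refl) =
      ⊥-elim (sep sum (arc-interior sum′ pos′) (trans eq (χ′≡ h₀ a′ b′ 0)))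
    go (old _ _ _ sep) (atK refl) =
      ⊥-elim (sep sum (arc-interior (trans (ℕ.+-comm b′ a′) sum′) (proj₂ pos′ , proj₁ pos′))
          (trans eq (χ′-arcK a′ b′)))
    go (old s* e f _) (old s′* e′ f′ _)
      with onSides s* s′* sum sum′ pos pos′ (trans (sym (f (proj₁ pos) (proj₂ pos) sum))
          (trans eq (f′ (proj₁ pos′) (proj₂ pos′) sum′)))
    ... | inj₁ (refl , a≡a′) = inj₁ (edge′-injective (trans e (sym e′)) , a≡a′)
    ... | inj₂ (g , a≡b′)    = inj₂ (trans e′ (trans g (cong opposite (sym e))) , a≡b′)

  corner-side′ : ∀ s s′ {a b} → a + b ≡ N → 1 ≤ a × 1 ≤ b → χ′ s a b 0 ≢ χ′ s′ N 0 0
  corner-side′ s s′ {a} {b} sum pos eq with newSide s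
  ... | atH refl = corner-interior (arc-interior sum pos) s′ (trans (sym eq) (χ′≡ h₀ a b 0))
  ... | atK refl = corner-interior (arc-interior (trans (ℕ.+-comm b a) sum) (proj₂ pos , proj₁ pos)) s′
      (trans (sym eq) (χ′-arcK a b))
  ... | old s* _ f _ = let (s′* , e) = corner′ s′ in
    corner s* s′* sum pos (trans (sym (f (proj₁ pos) (proj₂ pos) sum)) (trans eq e))

  member′ : ∀ s {a b c} → a + b + c ≡ N → a ≤ n × b ≤ n × c ≤ n → χ′ s a b c ∈ vertices n
  member′ s {a} {b} {c} sum ≤n with cover s a b c
  ... | inH A B C e f = subst (_∈ vertices n) (sym f) (□-member (proj₁ bounds) (proj₂ bounds)
      (ℕ.n≢0⇒n>0 λ B+A≡0 → ℕ.1+n≰n (subst (_≤ n) (trans (cong (_+ C) (sym (trans (ℕ.+-comm A B) B+A≡0)))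
          sumA) C≤n))
      (ℕ.+-mono-<-≤ (s≤s B≤n) (ℕ.m≤n⇒m≤1+n A≤n))
      (inj₂ (ℕ.<⇒≢ (s≤s A≤n))) (inj₁ (ℕ.<⇒≢ (s≤s B≤n))))
    where
    sumA = covered-sum s h sum e
    bounds = below-bounds A B C sumA
    bound = position-all {P = _≤ n} s h e ≤n
    A≤n = proj₁ bound
    B≤n = proj₁ (proj₂ bound)
    C≤n = proj₂ (proj₂ bound)
  ... | inK A B C e f = subst (_∈ vertices n) (sym f) (□-member (proj₁ bounds) (proj₂ bounds)
      (ℕ.≤-trans (ℕ.n≢0⇒n>0 A+C≢0) (ℕ.m≤m+n (A + C) (B + C)))
      (subst (_< N + N) (shuffle A B C) (subst (λ x → x + C < N + N) (sym sumA) (ℕ.+-monoʳ-< N (s≤s C≤n))))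
      (inj₁ A+C≢0) (inj₂ B+C≢0))
    where
    sumA = covered-sum s k sum e
    bounds = above-bounds A B C sumA
    bound = position-all {P = _≤ n} s k e ≤n
    A≤n = proj₁ bound
    B≤n = proj₁ (proj₂ bound)
    C≤n = proj₂ (proj₂ bound)
    shuffle : ∀ x y z → x + y + z + z ≡ x + z + (y + z)
    shuffle = ℕ-solver.solve-∀
    shuffle₁ : ∀ x y z → x + y + z ≡ y + (x + z)
    shuffle₁ = ℕ-solver.solve-∀
    A+C≢0 : A + C ≢ 0
    A+C≢0 eq = ℕ.1+n≰n (subst (_≤ n)
        (trans (sym (trans (shuffle₁ A B C) (trans (cong (_+_ B) eq) (ℕ.+-identityʳ B)))) sumA) B≤n)
    B+C≢0 : B + C ≢ 0
    B+C≢0 eq = ℕ.1+n≰n (subst (_≤ n)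
        (trans (sym (trans (ℕ.+-assoc A B C) (trans (cong (_+_ A) eq) (ℕ.+-identityʳ A)))) sumA) A≤n)

  ... | out _ _ f = subst (_∈ vertices n) (sym f) (member s sum ≤n)

  isChart′ : ′.IsChart n χ′
  isChart′ = record
    { rotation = rotation′
    ; glue     = glue′
    ; member   = member′
    ; inner    = inner′
    ; onSides  = onSides′
    ; corner   = corner-side′
    }

-- Mutation at a vertex with four neighbours

-- The booleans say whether a vertex is the northern, southern, eastern or western neighbour. By the
-- hypotheses it is not an out-neighbour and an in-neighbour at once, so nothing cancels, while
-- being both northern and southern gives a double arrow.
positivePart-count : ∀ n s e w →
  (n ≡ true → e ≡ false) → (n ≡ true → w ≡ false) → (s ≡ true → e ≡ false) → (s ≡ true → w ≡ false) →
  positivePart (n · + 1 ℤ.+ s · + 1 ℤ.- e · + 1 ℤ.- w · + 1) ≡ (if n then 1 else 0) + (if s then 1 else 0)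
positivePart-count true  s     e w ne nw se sw rewrite ne refl | nw refl with s
... | true  = refl
... | false = refl
positivePart-count false true  e w ne nw se sw rewrite se refl | sw refl = refl
positivePart-count false false true  true  _ _ _ _ = refl
positivePart-count false false true  false _ _ _ _ = refl
positivePart-count false false false true  _ _ _ _ = refl
positivePart-count false false false false _ _ _ _ = refl

positivePart-neg-count : ∀ n s e w →
  (n ≡ true → e ≡ false) → (n ≡ true → w ≡ false) → (s ≡ true → e ≡ false) → (s ≡ true → w ≡ false) →
  positivePart (ℤ.- (n · + 1 ℤ.+ s · + 1 ℤ.- e · + 1 ℤ.- w · + 1)) ≡ (if e then 1 else 0) +
      (if w then 1 else 0)
positivePart-neg-count true  s     e w ne nw se sw rewrite ne refl | nw refl with s
... | true  = refl
... | false = refl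
positivePart-neg-count false true  e w ne nw se sw rewrite se refl | sw refl = refl
positivePart-neg-count false false true  true  _ _ _ _ = refl
positivePart-neg-count false false true  false _ _ _ _ = refl
positivePart-neg-count false false false true  _ _ _ _ = refl
positivePart-neg-count false false false false _ _ _ _ = refl

module SeedProperties {V : Set} (_≟_ : DecidableEquality V) (vars : List V) where
  open RationalFunctions _≟_ vars
  open Seeds _≟_ vars
  open Evaluation _≟_ vars

  opaque
    indicator : V → V → ℤ
    indicator v x = does (v ≟ x) · + 1

  opaque
    unfolding indicator

    indicator-≡ : ∀ {v x} → v ≡ x → indicator v x ≡ + 1
    indicator-≡ {v} {x} eq = cong (_· + 1) (dec-true (v ≟ x) eq)

    indicator-≢ : ∀ {v x} → v ≢ x → indicator v x ≡ + 0
    indicator-≢ {v} {x} ne = cong (_· + 1) (dec-false (v ≟ x) ne)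

  opaque
    -- The entry at `(v , w)` of the skew-symmetric matrix of the quiver with a single arrow from
    -- `x` to `y`. Loops contribute 0 and opposite arrows cancel, so sums of these entries remain
    -- correct when different points of the square are the same vertex.
    arrowCount : V → V → V × V → ℤ
    arrowCount v w (x , y) = indicator v x ℤ.* indicator w y ℤ.- indicator w x ℤ.* indicator v y

  opaque
    unfolding arrowCount

    arrowCount-skew : ∀ v w x y → arrowCount v w (x , y) ≡ ℤ.- arrowCount v w (y , x)
    arrowCount-skew v w x y = lemma (indicator v x) (indicator w y) (indicator w x) (indicator v y)
      where
      lemma : ∀ a b c d → a ℤ.* b ℤ.- c ℤ.* d ≡ ℤ.- (d ℤ.* c ℤ.- b ℤ.* a)
      lemma = ℤ-solver.solve-∀

  opaque
    unfolding arrowCount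

    arrowCount≡ : ∀ v w x y → arrowCount v w (x , y) ≡
      indicator v x ℤ.* indicator w y ℤ.- indicator w x ℤ.* indicator v y
    arrowCount≡ v w x y = refl

    arrowCount-from-absent : ∀ {v} w {x y} → v ≢ x → v ≢ y → arrowCount v w (x , y) ≡ + 0
    arrowCount-from-absent {v} w {x} {y} v≢x v≢y = trans
      (cong₂ (λ p q → p ℤ.* indicator w y ℤ.- indicator w x ℤ.* q) (indicator-≢ v≢x) (indicator-≢ v≢y))
      (lemma (indicator w x) (indicator w y))
      where
      lemma : ∀ a b → + 0 ℤ.* b ℤ.- a ℤ.* + 0 ≡ + 0
      lemma = ℤ-solver.solve-∀

    arrowCount-to-absent : ∀ v {w x y} → w ≢ x → w ≢ y → arrowCount v w (x , y) ≡ + 0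
    arrowCount-to-absent v {w} {x} {y} w≢x w≢y = trans
      (cong₂ (λ p q → indicator v x ℤ.* q ℤ.- p ℤ.* indicator v y) (indicator-≢ w≢x) (indicator-≢ w≢y))
      (lemma (indicator v x) (indicator v y))
      where
      lemma : ∀ a b → a ℤ.* + 0 ℤ.- + 0 ℤ.* b ≡ + 0
      lemma = ℤ-solver.solve-∀

  occurrences : V × V → List (V × V) → ℕ
  occurrences a as = length (filter (Product.≡-dec _≟_ _≟_ a) as)

  opaque
    unfolding indicator

    occurrences-∷ : ∀ v w x y as →
      + occurrences (v , w) ((x , y) ∷ as) ≡ indicator v x ℤ.* indicator w y ℤ.+ + occurrences (v , w) as
    occurrences-∷ v w x y as with v ≟ x
    ... | no _ = sym (ℤ.+-identityˡ _)
    ... | yes refl with w ≟ y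
    ...   | no _  = sym (ℤ.+-identityˡ _)
    ...   | yes _ = refl

  opaque
    unfolding arrowCount

    quiver-∑ : ∀ as v w → quiver as v w ≡ ∑ as (arrowCount v w)
    quiver-∑ []             v w = refl
    quiver-∑ ((x , y) ∷ as) v w = begin
      + occurrences (v , w) ((x , y) ∷ as) ℤ.- + occurrences (w , v) ((x , y) ∷ as)
        ≡⟨ cong₂ ℤ._-_ (occurrences-∷ v w x y as) (occurrences-∷ w v x y as) ⟩
      (indicator v x ℤ.* indicator w y ℤ.+ + occurrences (v , w) as) ℤ.-
      (indicator w x ℤ.* indicator v y ℤ.+ + occurrences (w , v) as)
        ≡⟨ lemma (indicator v x ℤ.* indicator w y) _ (indicator w x ℤ.* indicator v y) _ ⟩
      arrowCount v w (x , y) ℤ.+ quiver as v w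
        ≡⟨ cong (ℤ._+_ (arrowCount v w (x , y))) (quiver-∑ as v w) ⟩
      arrowCount v w (x , y) ℤ.+ ∑ as (arrowCount v w) ∎
      where
      lemma : ∀ a b c d → a ℤ.+ b ℤ.- (c ℤ.+ d) ≡ a ℤ.- c ℤ.+ (b ℤ.- d)
      lemma = ℤ-solver.solve-∀

  ∏ : List V → (V → ℚ) → ℚ
  ∏ []       f = 1ℚ
  ∏ (v ∷ vs) f = f v ℚ.* ∏ vs f

  ∏-* : ∀ vs f g → ∏ vs (λ v → f v ℚ.* g v) ≡ ∏ vs f ℚ.* ∏ vs g
  ∏-* []       f g = refl
  ∏-* (v ∷ vs) f g = trans (cong (f v ℚ.* g v ℚ.*_) (∏-* vs f g))
    (solve 4 (λ a b c d → a :* b :* (c :* d) := a :* c :* (b :* d)) refl (f v) (g v) _ _)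
    where open ℚ-solver.+-*-Solver

  only : V → ℚ → V → ℚ
  only y a v = if does (v ≟ y) then a else 1ℚ

  ∏-none : ∀ {y a} vs → All (y ≢_) vs → ∏ vs (only y a) ≡ 1ℚ
  ∏-none []       All.[]       = refl
  ∏-none {y} {a} (v ∷ vs) (ne All.∷ nes) rewrite dec-false (v ≟ y) (λ e → ne (sym e)) =
    trans (ℚ.*-identityˡ _) (∏-none vs nes)

  ∏-only : ∀ {y a vs} → Unique vs → y ∈ vs → ∏ vs (only y a) ≡ a
  ∏-only {y} {a} {v ∷ vs} (ne ∷ _) (here refl) rewrite dec-true (v ≟ v) refl =
    trans (cong (a ℚ.*_) (∏-none vs ne)) (ℚ.*-identityʳ a)
  ∏-only {y} {a} {v ∷ vs} (ne ∷ unique) (there y∈vs) rewrite dec-false (v ≟ y) (All.lookup ne y∈vs) =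
    trans (ℚ.*-identityˡ _) (∏-only unique y∈vs)

  multiplicity : V → V → V → ℕ
  multiplicity y z v = (if does (v ≟ y) then 1 else 0) + (if does (v ≟ z) then 1 else 0)

  -- As `y` and `z` occur exactly once in the duplicate-free list `vars`, only their two values
  -- remain as factors. The case `y ≡ z` is included and gives a square.
  product-hasValue : (x : V → Rational) (e : V → ℕ) → Unique vars → ∀ y z {a b} → y ∈ vars → z ∈ vars →
    x y hasValue a → x z hasValue b → (∀ v → e v ≡ multiplicity y z v) →
    foldr (λ v r → mul (power (x v) (e v)) r) one vars hasValue (a ℚ.* b)
  product-hasValue x e unique y z {a} {b} y∈ z∈ x-y x-z e≡ = subst (_ hasValue_)
    (trans (∏-* vars (only y a) (only z b)) (cong₂ ℚ._*_ (∏-only unique y∈) (∏-only unique z∈))) (go vars)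
    where
    factor : ∀ v → power (x v) (e v) hasValue (only y a v ℚ.* only z b v)
    factor v = subst (λ k → power (x v) k hasValue (only y a v ℚ.* only z b v)) (sym (e≡ v))
        (cases (v ≟ y) (v ≟ z))
      where
      cases : (p : Dec (v ≡ y)) (q : Dec (v ≡ z)) →
        power (x v) ((if does p then 1 else 0) + (if does q then 1 else 0))
          hasValue ((if does p then a else 1ℚ) ℚ.* (if does q then b else 1ℚ))
      cases (no _)     (no _)     = subst (one hasValue_) (sym (ℚ.*-identityˡ 1ℚ)) one-hasValue
      cases (no _)     (yes refl) = subst (_ hasValue_) (ℚ.*-comm b 1ℚ) (mul-hasValue x-z one-hasValue)
      cases (yes refl) (no _)     = mul-hasValue x-y one-hasValue
      cases (yes refl) (yes refl) = mul-hasValue x-y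
        (subst (_ hasValue_) (ℚ.*-identityʳ b) (mul-hasValue x-z one-hasValue))
    go : ∀ vs → foldr (λ v r → mul (power (x v) (e v)) r) one vs hasValue ∏ vs
        (λ v → only y a v ℚ.* only z b v)
    go []       = one-hasValue
    go (v ∷ vs) = mul-hasValue (factor v) (go vs)

  mutate-arrows-away : ∀ s {k v w} → v ≢ k → w ≢ k → arrows (mutate k s) v w ≡
    arrows s v w ℤ.+ + (positivePart (arrows s v k) * positivePart (arrows s k w))
                 ℤ.- + (positivePart (arrows s w k) * positivePart (arrows s k v))
  mutate-arrows-away s {k} {v} {w} v≢k w≢k with v ≟ k | w ≟ k
  ... | yes v≡k | _       = contradiction v≡k v≢k
  ... | no _    | yes w≡k = contradiction w≡k w≢k
  ... | no _    | no _    = refl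

  mutate-arrows-from : ∀ s {k} w → arrows (mutate k s) k w ≡ ℤ.- arrows s k w
  mutate-arrows-from s {k} w with k ≟ k | w ≟ k
  ... | yes _   | _ = refl
  ... | no k≢k | _ = contradiction refl k≢k

  mutate-arrows-to : ∀ s {k} v → arrows (mutate k s) v k ≡ ℤ.- arrows s v k
  mutate-arrows-to s {k} v with v ≟ k | k ≟ k
  ... | yes _ | _       = refl
  ... | no _  | yes _   = refl
  ... | no _  | no k≢k = contradiction refl k≢k

  variableProduct : (V → Rational) → (V → ℕ) → Rational
  variableProduct x e = foldr (λ v r → mul (power (x v) (e v)) r) one vars

  mutate-cluster-at : ∀ s k → cluster (mutate k s) k ≡
    div (add (variableProduct (cluster s) (λ v → positivePart (arrows s k v)))
             (variableProduct (cluster s) (λ v → positivePart (arrows s v k))))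
        (cluster s k)
  mutate-cluster-at s k with k ≟ k
  ... | yes _   = refl
  ... | no k≢k = contradiction refl k≢k

  -- The vertex k has the four neighbours north and south (to which its arrows go) and
  -- east and west (from which its arrows come).
  record IsCrossing (s : Seed) (k north south east west : V) : Set where
    field
      out-arrows : ∀ w → arrows s k w ≡
        indicator w north ℤ.+ indicator w south ℤ.- indicator w east ℤ.- indicator w west
      in-arrows  : ∀ w → arrows s w k ≡
        ℤ.- (indicator w north ℤ.+ indicator w south ℤ.- indicator w east ℤ.- indicator w west)
      -- North and south may be the same vertex, and so may east and west: for n = 1 opposite sides
      -- of the quadrilateral can be glued. What has to be excluded is the cancellation of arrows.
      n≢e        : north ≢ east
      n≢w        : north ≢ west
      s≢e        : south ≢ east
      s≢w        : south ≢ west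

    apart : ∀ w {x y} → x ≢ y → does (w ≟ x) ≡ true → does (w ≟ y) ≡ false
    apart w {x} {y} x≢y w≡x with w ≟ x
    ... | yes refl = dec-false (w ≟ y) x≢y

    opaque
      unfolding indicator

      positive-out : ∀ w → positivePart (arrows s k w) ≡ multiplicity north south w
      positive-out w = trans (cong positivePart (out-arrows w))
        (positivePart-count (does (w ≟ north)) (does (w ≟ south)) (does (w ≟ east)) (does (w ≟ west))
          (apart w n≢e) (apart w n≢w) (apart w s≢e) (apart w s≢w))

      positive-in : ∀ w → positivePart (arrows s w k) ≡ multiplicity east west w
      positive-in w = trans (cong positivePart (in-arrows w))
        (positivePart-neg-count (does (w ≟ north)) (does (w ≟ south)) (does (w ≟ east)) (does (w ≟ west))
          (apart w n≢e) (apart w n≢w) (apart w s≢e) (apart w s≢w))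

      multiplicity-indicator : ∀ y z v → + multiplicity y z v ≡ indicator v y ℤ.+ indicator v z
      multiplicity-indicator y z v with does (v ≟ y) | does (v ≟ z)
      ... | true  | true  = refl
      ... | true  | false = refl
      ... | false | true  = refl
      ... | false | false = refl

    -- The arrows at k are reversed and every path through k contributes an arrow; this is the
    -- combination that appears in form-δ.
    change : V → V → ℤ
    change v w =
      + 2 ℤ.* (arrowCount v w (k , east) ℤ.+ arrowCount v w (k , west)
           ℤ.- arrowCount v w (k , north) ℤ.- arrowCount v w (k , south))
      ℤ.+ (arrowCount v w (east , north) ℤ.+ arrowCount v w (east , south)
           ℤ.+ arrowCount v w (west , north) ℤ.+ arrowCount v w (west , south))

    -- `vn`, `ws` and so on are the indicators of `v` and `w` at the neighbours and at `k`. The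
    -- paths through `k` are counted by products of such numbers, which expand into the four arrows
    -- of `change` from east and west to north and south; the reversal terms vanish as neither
    -- vertex is `k`. In `change-from` and `change-to` one vertex is `k`, which is none of its
    -- neighbours, and only the reversal survives.
    change-away : ∀ b {vk} vn vs ve vw {wk} wn ws we ww → vk ≡ + 0 → wk ≡ + 0 →
      b ℤ.+ (ve ℤ.+ vw) ℤ.* (wn ℤ.+ ws) ℤ.- (we ℤ.+ ww) ℤ.* (vn ℤ.+ vs) ≡
      b ℤ.+ (+ 2 ℤ.* (vk ℤ.* we ℤ.- wk ℤ.* ve ℤ.+ (vk ℤ.* ww ℤ.- wk ℤ.* vw)
                  ℤ.- (vk ℤ.* wn ℤ.- wk ℤ.* vn) ℤ.- (vk ℤ.* ws ℤ.- wk ℤ.* vs))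
        ℤ.+ (ve ℤ.* wn ℤ.- we ℤ.* vn ℤ.+ (ve ℤ.* ws ℤ.- we ℤ.* vs)
        ℤ.+ (vw ℤ.* wn ℤ.- ww ℤ.* vn) ℤ.+ (vw ℤ.* ws ℤ.- ww ℤ.* vs)))
    change-away b vn vs ve vw wn ws we ww refl refl = lemma b vn vs ve vw wn ws we ww
      where
      lemma : ∀ b vn vs ve vw wn ws we ww →
        b ℤ.+ (ve ℤ.+ vw) ℤ.* (wn ℤ.+ ws) ℤ.- (we ℤ.+ ww) ℤ.* (vn ℤ.+ vs) ≡
        b ℤ.+ (+ 2 ℤ.* (+ 0 ℤ.* we ℤ.- + 0 ℤ.* ve ℤ.+ (+ 0 ℤ.* ww ℤ.- + 0 ℤ.* vw)
                    ℤ.- (+ 0 ℤ.* wn ℤ.- + 0 ℤ.* vn) ℤ.- (+ 0 ℤ.* ws ℤ.- + 0 ℤ.* vs))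
          ℤ.+ (ve ℤ.* wn ℤ.- we ℤ.* vn ℤ.+ (ve ℤ.* ws ℤ.- we ℤ.* vs)
          ℤ.+ (vw ℤ.* wn ℤ.- ww ℤ.* vn) ℤ.+ (vw ℤ.* ws ℤ.- ww ℤ.* vs)))
      lemma = ℤ-solver.solve-∀

    change-from : ∀ {b vk vn vs ve vw} wk wn ws we ww → b ≡ wn ℤ.+ ws ℤ.- we ℤ.- ww →
      vk ≡ + 1 → vn ≡ + 0 → vs ≡ + 0 → ve ≡ + 0 → vw ≡ + 0 →
      ℤ.- b ≡
      b ℤ.+ (+ 2 ℤ.* (vk ℤ.* we ℤ.- wk ℤ.* ve ℤ.+ (vk ℤ.* ww ℤ.- wk ℤ.* vw)
                  ℤ.- (vk ℤ.* wn ℤ.- wk ℤ.* vn) ℤ.- (vk ℤ.* ws ℤ.- wk ℤ.* vs))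
        ℤ.+ (ve ℤ.* wn ℤ.- we ℤ.* vn ℤ.+ (ve ℤ.* ws ℤ.- we ℤ.* vs)
        ℤ.+ (vw ℤ.* wn ℤ.- ww ℤ.* vn) ℤ.+ (vw ℤ.* ws ℤ.- ww ℤ.* vs)))
    change-from wk wn ws we ww refl refl refl refl refl refl = lemma wk wn ws we ww
      where
      lemma : ∀ wk wn ws we ww →
        ℤ.- (wn ℤ.+ ws ℤ.- we ℤ.- ww) ≡
        wn ℤ.+ ws ℤ.- we ℤ.- ww ℤ.+ (+ 2 ℤ.* (+ 1 ℤ.* we ℤ.- wk ℤ.* + 0 ℤ.+ (+ 1 ℤ.* ww ℤ.- wk ℤ.* + 0)
                    ℤ.- (+ 1 ℤ.* wn ℤ.- wk ℤ.* + 0) ℤ.- (+ 1 ℤ.* ws ℤ.- wk ℤ.* + 0))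
          ℤ.+ (+ 0 ℤ.* wn ℤ.- we ℤ.* + 0 ℤ.+ (+ 0 ℤ.* ws ℤ.- we ℤ.* + 0)
          ℤ.+ (+ 0 ℤ.* wn ℤ.- ww ℤ.* + 0) ℤ.+ (+ 0 ℤ.* ws ℤ.- ww ℤ.* + 0)))
      lemma = ℤ-solver.solve-∀

    change-to : ∀ {b} vk vn vs ve vw {wk wn ws we ww} → b ≡ ℤ.- (vn ℤ.+ vs ℤ.- ve ℤ.- vw) →
      wk ≡ + 1 → wn ≡ + 0 → ws ≡ + 0 → we ≡ + 0 → ww ≡ + 0 →
      ℤ.- b ≡
      b ℤ.+ (+ 2 ℤ.* (vk ℤ.* we ℤ.- wk ℤ.* ve ℤ.+ (vk ℤ.* ww ℤ.- wk ℤ.* vw)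
                  ℤ.- (vk ℤ.* wn ℤ.- wk ℤ.* vn) ℤ.- (vk ℤ.* ws ℤ.- wk ℤ.* vs))
        ℤ.+ (ve ℤ.* wn ℤ.- we ℤ.* vn ℤ.+ (ve ℤ.* ws ℤ.- we ℤ.* vs)
        ℤ.+ (vw ℤ.* wn ℤ.- ww ℤ.* vn) ℤ.+ (vw ℤ.* ws ℤ.- ww ℤ.* vs)))
    change-to vk vn vs ve vw refl refl refl refl refl refl = lemma vk vn vs ve vw
      where
      lemma : ∀ vk vn vs ve vw →
        ℤ.- (ℤ.- (vn ℤ.+ vs ℤ.- ve ℤ.- vw)) ≡
        ℤ.- (vn ℤ.+ vs ℤ.- ve ℤ.- vw) ℤ.+ (+ 2 ℤ.* (vk ℤ.* + 0 ℤ.- + 1 ℤ.* ve ℤ.+ (vk ℤ.* + 0 ℤ.- + 1 ℤ.* vw)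
                    ℤ.- (vk ℤ.* + 0 ℤ.- + 1 ℤ.* vn) ℤ.- (vk ℤ.* + 0 ℤ.- + 1 ℤ.* vs))
          ℤ.+ (ve ℤ.* + 0 ℤ.- + 0 ℤ.* vn ℤ.+ (ve ℤ.* + 0 ℤ.- + 0 ℤ.* vs)
          ℤ.+ (vw ℤ.* + 0 ℤ.- + 0 ℤ.* vn) ℤ.+ (vw ℤ.* + 0 ℤ.- + 0 ℤ.* vs)))
      lemma = ℤ-solver.solve-∀

    module _ (k≢n : k ≢ north) (k≢s : k ≢ south) (k≢e : k ≢ east) (k≢w : k ≢ west) where

      opaque
        unfolding arrowCount

        mutate-arrows : ∀ v w → arrows (mutate k s) v w ≡ arrows s v w ℤ.+ change v w
        mutate-arrows v w = go (v ≟ k) (w ≟ k)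
          where
          contribution : ∀ x y → + (positivePart (arrows s x k) * positivePart (arrows s k y)) ≡
            (indicator x east ℤ.+ indicator x west) ℤ.* (indicator y north ℤ.+ indicator y south)
          contribution x y = trans (cong₂ (λ p q → + (p * q)) (positive-in x) (positive-out y))
            (trans (ℤ.pos-* (multiplicity east west x) (multiplicity north south y))
              (cong₂ ℤ._*_ (multiplicity-indicator east west x) (multiplicity-indicator north south y)))
          go : Dec (v ≡ k) → Dec (w ≡ k) → arrows (mutate k s) v w ≡ arrows s v w ℤ.+ change v w
          go (no v≢k) (no w≢k) = trans (mutate-arrows-away s v≢k w≢k)
            (trans (cong₂ (λ p q → arrows s v w ℤ.+ p ℤ.- q) (contribution v w) (contribution w v))
            (change-away (arrows s v w) (indicator v north) (indicator v south) (indicator v east)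
                (indicator v west)
              (indicator w north) (indicator w south) (indicator w east) (indicator w west)
              (indicator-≢ v≢k) (indicator-≢ w≢k)))
          go (yes refl) _ = trans (mutate-arrows-from s w)
            (change-from (indicator w k) (indicator w north) (indicator w south) (indicator w east)
                (indicator w west)
              (out-arrows w) (indicator-≡ refl) (indicator-≢ k≢n) (indicator-≢ k≢s) (indicator-≢ k≢e)
                  (indicator-≢ k≢w))
          go (no v≢k) (yes refl) = trans (mutate-arrows-to s v)
            (change-to (indicator v k) (indicator v north) (indicator v south) (indicator v east)
                (indicator v west)
              (in-arrows v) (indicator-≡ refl) (indicator-≢ k≢n) (indicator-≢ k≢s) (indicator-≢ k≢e)
                  (indicator-≢ k≢w))

    mutate-hasValue : Unique vars → north ∈ vars → south ∈ vars → east ∈ vars → west ∈ vars →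
      ∀ {a b c d e} f → cluster s k hasValue a →
      cluster s north hasValue b → cluster s south hasValue c →
      cluster s east hasValue d → cluster s west hasValue e →
      f ℚ.* a ≡ b ℚ.* c ℚ.+ d ℚ.* e → cluster (mutate k s) k hasValue f
    mutate-hasValue unique n∈ s∈ e∈ w∈ {a} {b} {c} {d} {e} f x-k x-n x-s x-e x-w eq =
      subst (_hasValue f) (sym (mutate-cluster-at s k)) (div-hasValue f
        (add-hasValue
          (product-hasValue (cluster s) (λ v → positivePart (arrows s k v)) unique north south n∈ s∈ x-n
              x-s positive-out)
          (product-hasValue (cluster s) (λ v → positivePart (arrows s v k)) unique east west e∈ w∈ x-e
              x-w positive-in))
        x-k eq)

  mutate-cluster : ∀ s {k v} → v ≢ k → cluster (mutate k s) v ≡ cluster s v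
  mutate-cluster s {k} {v} v≢k with v ≟ k
  ... | yes v≡k = contradiction v≡k v≢k
  ... | no _    = refl

-- The variables of a quadrilateral with corners 00 , 10 , 11 , 01 of total weight n + 1, as
-- monomials in the variables of its six edges for n = 1.
module Quadrilateral (x₁₀₀₁ x₀₀₁₁ x₀₀₁₀ x₁₁₁₀ x₀₀₀₁ x₀₁₁₁ : ℚ) where

  monomial : (a b c d e f : ℕ) → ℚ
  monomial a b c d e f =
    x₁₀₀₁ ^ℚ a ℚ.* x₀₀₁₁ ^ℚ b ℚ.* (x₀₀₁₀ ^ℚ c ℚ.* x₁₁₁₀ ^ℚ d) ℚ.* (x₀₀₀₁ ^ℚ e ℚ.* x₀₁₁₁ ^ℚ f)

  weighted : (w₀₀ w₁₀ w₁₁ w₀₁ : ℕ) → ℚ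
  weighted w₀₀ w₁₀ w₁₁ w₀₁ =
    monomial (w₁₀ * w₀₁) (w₀₀ * w₁₁) (w₀₀ * w₁₀) (w₁₁ * w₁₀) (w₀₀ * w₀₁) (w₀₁ * w₁₁)

  monomial-* : ∀ a b c d e f a′ b′ c′ d′ e′ f′ →
    monomial a b c d e f ℚ.* monomial a′ b′ c′ d′ e′ f′ ≡
    monomial (a + a′) (b + b′) (c + c′) (d + d′) (e + e′) (f + f′)
  monomial-* a b c d e f a′ b′ c′ d′ e′ f′ =
    trans (*-interchange (u ℚ.* v) w (u′ ℚ.* v′) w′) (cong₂ ℚ._*_
      (trans (*-interchange u v u′ v′) (cong₂ ℚ._*_ (pair x₁₀₀₁ x₀₀₁₁ a b a′ b′)
          (pair x₀₀₁₀ x₁₁₁₀ c d c′ d′)))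
      (pair x₀₀₀₁ x₀₁₁₁ e f e′ f′))
    where
    u  = x₁₀₀₁ ^ℚ a ℚ.* x₀₀₁₁ ^ℚ b
    u′ = x₁₀₀₁ ^ℚ a′ ℚ.* x₀₀₁₁ ^ℚ b′
    v  = x₀₀₁₀ ^ℚ c ℚ.* x₁₁₁₀ ^ℚ d
    v′ = x₀₀₁₀ ^ℚ c′ ℚ.* x₁₁₁₀ ^ℚ d′
    w  = x₀₀₀₁ ^ℚ e ℚ.* x₀₁₁₁ ^ℚ f
    w′ = x₀₀₀₁ ^ℚ e′ ℚ.* x₀₁₁₁ ^ℚ f′
    *-interchange : ∀ p q r s → (p ℚ.* q) ℚ.* (r ℚ.* s) ≡ (p ℚ.* r) ℚ.* (q ℚ.* s)
    *-interchange = solve 4 (λ p q r s → (p :* q) :* (r :* s) := (p :* r) :* (q :* s)) refl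
      where open ℚ-solver.+-*-Solver
    pair : ∀ x y a b a′ b′ → (x ^ℚ a ℚ.* y ^ℚ b) ℚ.* (x ^ℚ a′ ℚ.* y ^ℚ b′) ≡ x ^ℚ (a + a′) ℚ.* y ^ℚ (b + b′)
    pair x y a b a′ b′ = trans (*-interchange (x ^ℚ a) (y ^ℚ b) (x ^ℚ a′) (y ^ℚ b′))
      (sym (cong₂ ℚ._*_ (^ℚ-homo-* x a a′) (^ℚ-homo-* y b b′)))

  monomial-cong : ∀ {a a′ b b′ c c′ d d′ e e′ f f′} →
    a ≡ a′ → b ≡ b′ → c ≡ c′ → d ≡ d′ → e ≡ e′ → f ≡ f′ → monomial a b c d e f ≡ monomial a′ b′ c′ d′ e′ f′
  monomial-cong refl refl refl refl refl refl = refl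

  -- The exponents are products of two weights, and `suc x * suc y + x * y` exceeds
  -- `x * suc y + suc x * y` by exactly 1. In each of the three products this excess occurs for one
  -- pair of opposite edges of the tetrahedron, so all three are `rest` times a product of two edge
  -- variables, and what remains is Ptolemy's relation.
  weighted-octahedron : x₁₀₀₁ ℚ.* x₀₀₁₁ ≡ x₀₀₁₀ ℚ.* x₀₁₁₁ ℚ.+ x₁₁₁₀ ℚ.* x₀₀₀₁ → ∀ α β γ δ →
    weighted α (suc β) γ (suc δ) ℚ.* weighted (suc α) β (suc γ) δ ≡
    weighted α β (suc γ) (suc δ) ℚ.* weighted (suc α) (suc β) γ δ ℚ.+
    weighted α (suc β) (suc γ) δ ℚ.* weighted (suc α) β γ (suc δ)
  weighted-octahedron ptolemy α β γ δ = begin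
    weighted α (suc β) γ (suc δ) ℚ.* weighted (suc α) β (suc γ) δ
      ≡⟨ trans (monomial-* (suc β * suc δ) (α * γ) (α * suc β) (γ * suc β) (α * suc δ) (suc δ * γ)
          (β * δ) (suc α * suc γ) (suc α * β) (suc γ * β) (suc α * δ) (δ * suc γ))
           (monomial-cong (up β δ) (up′ α γ) (same α β) (same γ β) (same α δ) (same′ δ γ)) ⟩
    monomial (suc (base β δ)) (suc (base α γ)) (base α β) (base γ β) (base α δ) (base δ γ)
      ≡⟨ monomial-* 1 1 0 0 0 0 (base β δ) (base α γ) (base α β) (base γ β) (base α δ) (base δ γ) ⟨
    monomial 1 1 0 0 0 0 ℚ.* rest
      ≡⟨ cong (ℚ._* rest) (trans (trans (unit₁ x₁₀₀₁ x₀₀₁₁) ptolemy)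
           (sym (cong₂ ℚ._+_ (unit₂ x₀₀₁₀ x₀₁₁₁) (unit₃ x₁₁₁₀ x₀₀₀₁)))) ⟩
    (monomial 0 0 1 0 0 1 ℚ.+ monomial 0 0 0 1 1 0) ℚ.* rest
      ≡⟨ ℚ.*-distribʳ-+ rest (monomial 0 0 1 0 0 1) (monomial 0 0 0 1 1 0) ⟩
    monomial 0 0 1 0 0 1 ℚ.* rest ℚ.+ monomial 0 0 0 1 1 0 ℚ.* rest
      ≡⟨ cong₂ ℚ._+_
           (trans (monomial-* 0 0 1 0 0 1 (base β δ) (base α γ) (base α β) (base γ β) (base α δ)
               (base δ γ)) (sym
           (trans (monomial-* (β * suc δ) (α * suc γ) (α * β) (suc γ * β) (α * suc δ) (suc δ * suc γ)
               (suc β * δ) (suc α * γ) (suc α * suc β) (γ * suc β) (suc α * δ) (δ * γ))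
             (monomial-cong (same β δ) (same α γ) (up′ α β) (same′ γ β) (same α δ) (up δ γ)))))
           (trans (monomial-* 0 0 0 1 1 0 (base β δ) (base α γ) (base α β) (base γ β) (base α δ)
               (base δ γ)) (sym
           (trans (monomial-* (suc β * δ) (α * suc γ) (α * suc β) (suc γ * suc β) (α * δ) (δ * suc γ)
               (β * suc δ) (suc α * γ) (suc α * β) (γ * β) (suc α * suc δ) (suc δ * γ))
             (monomial-cong (same′ β δ) (same α γ) (same α β) (up γ β) (up′ α δ) (same δ γ))))) ⟩
    weighted α β (suc γ) (suc δ) ℚ.* weighted (suc α) (suc β) γ δ ℚ.+
    weighted α (suc β) (suc γ) δ ℚ.* weighted (suc α) β γ (suc δ) ∎
    where
    open ℚ-solver.+-*-Solver
    unit₁ : ∀ x y → x ℚ.* 1ℚ ℚ.* (y ℚ.* 1ℚ) ℚ.* (1ℚ ℚ.* 1ℚ) ℚ.* (1ℚ ℚ.* 1ℚ) ≡ x ℚ.* y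
    unit₁ = solve 2 (λ x y → x :* con 1ℚ :* (y :* con 1ℚ) :* (con 1ℚ :* con 1ℚ) :*
        (con 1ℚ :* con 1ℚ) := x :* y) refl
    unit₂ : ∀ x y → 1ℚ ℚ.* 1ℚ ℚ.* (x ℚ.* 1ℚ ℚ.* 1ℚ) ℚ.* (1ℚ ℚ.* (y ℚ.* 1ℚ)) ≡ x ℚ.* y
    unit₂ = solve 2 (λ x y → con 1ℚ :* con 1ℚ :* (x :* con 1ℚ :* con 1ℚ) :* (con 1ℚ :* (y :* con 1ℚ)) :=
        x :* y) refl
    unit₃ : ∀ x y → 1ℚ ℚ.* 1ℚ ℚ.* (1ℚ ℚ.* (x ℚ.* 1ℚ)) ℚ.* (y ℚ.* 1ℚ ℚ.* 1ℚ) ≡ x ℚ.* y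
    unit₃ = solve 2 (λ x y → con 1ℚ :* con 1ℚ :* (con 1ℚ :* (x :* con 1ℚ)) :* (y :* con 1ℚ :* con 1ℚ) :=
        x :* y) refl
    base : ℕ → ℕ → ℕ
    base x y = x * y + x * y + x + y
    rest = monomial (base β δ) (base α γ) (base α β) (base γ β) (base α δ) (base δ γ)
    up : ∀ x y → suc x * suc y + x * y ≡ suc (x * y + x * y + x + y)
    up = ℕ-solver.solve-∀
    up′ : ∀ x y → x * y + suc x * suc y ≡ suc (x * y + x * y + x + y)
    up′ = ℕ-solver.solve-∀
    same : ∀ x y → x * suc y + suc x * y ≡ x * y + x * y + x + y
    same = ℕ-solver.solve-∀
    same′ : ∀ x y → suc x * y + x * suc y ≡ x * y + x * y + x + y
    same′ = ℕ-solver.solve-∀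

-- The arrows inside a square

module _ {t : ℕ} (a b : Fin t) where

  without : (Fin t → ℤ) → Fin t → ℤ
  without F τ = if does (τ Fin.≟ a) then + 0 else if does (τ Fin.≟ b) then + 0 else F τ

  ∑-none : ∀ (F : Fin t → ℤ) {c} τs → All (c ≢_) τs → ∑ τs (λ τ → does (τ Fin.≟ c) · F τ) ≡ + 0
  ∑-none F []       All.[] = refl
  ∑-none F {c} (τ ∷ τs) (ne All.∷ nes) rewrite dec-false (τ Fin.≟ c) (ne ∘ sym) =
    trans (ℤ.+-identityˡ _) (∑-none F τs nes)

  ∑-single : ∀ (F : Fin t → ℤ) {c τs} → Unique τs → c ∈ τs → ∑ τs (λ τ → does (τ Fin.≟ c) · F τ) ≡ F c
  ∑-single F {c} {τ ∷ τs} (ne ∷ _) (here refl) rewrite dec-true (c Fin.≟ c) refl =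
    trans (cong (ℤ._+_ (F c)) (∑-none F τs ne)) (ℤ.+-identityʳ (F c))
  ∑-single F {c} {τ ∷ τs} (ne ∷ unique) (there c∈) rewrite dec-false (τ Fin.≟ c) (All.lookup ne c∈) =
    trans (ℤ.+-identityˡ _) (∑-single F unique c∈)

  ∑-without : a ≢ b → ∀ F → ∑ (allFin t) F ≡ F a ℤ.+ F b ℤ.+ ∑ (allFin t) (without F)
  ∑-without a≢b F = begin
    ∑ (allFin t) F
      ≡⟨ ∑-cong (allFin t) split ⟩
    ∑ (allFin t) (λ τ → does (τ Fin.≟ a) · F τ ℤ.+ does (τ Fin.≟ b) · F τ ℤ.+ without F τ)
      ≡⟨ ∑-+ (allFin t) (λ τ → does (τ Fin.≟ a) · F τ ℤ.+ does (τ Fin.≟ b) · F τ) (without F) ⟩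
    ∑ (allFin t) (λ τ → does (τ Fin.≟ a) · F τ ℤ.+ does (τ Fin.≟ b) · F τ) ℤ.+ ∑ (allFin t) (without F)
      ≡⟨ cong (ℤ._+ ∑ (allFin t) (without F)) (trans
           (∑-+ (allFin t) (λ τ → does (τ Fin.≟ a) · F τ) (λ τ → does (τ Fin.≟ b) · F τ))
           (cong₂ ℤ._+_ (∑-single F (Unique.allFin⁺ t) (∈-allFin a)) (∑-single F (Unique.allFin⁺ t)
               (∈-allFin b)))) ⟩
    F a ℤ.+ F b ℤ.+ ∑ (allFin t) (without F) ∎
    where
    split : ∀ τ → F τ ≡ does (τ Fin.≟ a) · F τ ℤ.+ does (τ Fin.≟ b) · F τ ℤ.+ without F τ
    split τ = go (τ Fin.≟ a) (τ Fin.≟ b)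
      where
      go : (p : Dec (τ ≡ a)) (q : Dec (τ ≡ b)) → F τ ≡
        does p · F τ ℤ.+ does q · F τ ℤ.+ (if does p then + 0 else if does q then + 0 else F τ)
      go (yes refl) (yes e) = contradiction e a≢b
      go (yes _)    (no _)  = sym (trans (ℤ.+-identityʳ _) (ℤ.+-identityʳ _))
      go (no _)     (yes _) = sym (trans (ℤ.+-identityʳ _) (ℤ.+-identityˡ _))
      go (no _)     (no _)  = sym (ℤ.+-identityˡ _)

  ∑-without-cong : ∀ F G → (∀ τ → τ ≢ a → τ ≢ b → F τ ≡ G τ) →
    ∑ (allFin t) (without F) ≡ ∑ (allFin t) (without G)
  ∑-without-cong F G eq = ∑-cong (allFin t) λ τ → go τ (τ Fin.≟ a) (τ Fin.≟ b)
    where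
    go : ∀ τ (p : Dec (τ ≡ a)) (q : Dec (τ ≡ b)) →
      (if does p then + 0 else if does q then + 0 else F τ) ≡ (if does p then + 0 else if does q then +
          0 else G τ)
    go τ (yes _)  _        = refl
    go τ (no _)   (yes _)  = refl
    go τ (no τ≢a) (no τ≢b) = eq τ τ≢a τ≢b

  ∑-without-zero : ∀ F → (∀ τ → τ ≢ a → τ ≢ b → F τ ≡ + 0) → ∑ (allFin t) (without F) ≡ + 0
  ∑-without-zero F eq = trans (∑-without-cong F (λ _ → + 0) eq) (zeros (allFin t))
    where
    zeros : ∀ τs → ∑ τs (without (λ _ → + 0)) ≡ + 0
    zeros []       = refl
    zeros (τ ∷ τs) with does (τ Fin.≟ a) | does (τ Fin.≟ b)
    ... | true  | _     = trans (ℤ.+-identityˡ _) (zeros τs)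
    ... | false | true  = trans (ℤ.+-identityˡ _) (zeros τs)
    ... | false | false = trans (ℤ.+-identityˡ _) (zeros τs)

·-cong : ∀ {p q} {x y : ℤ} → p ≡ q → (q ≡ true → x ≡ y) → p · x ≡ q · y
·-cong {q = true}  refl eq = eq refl
·-cong {q = false} refl eq = refl

<ᵇ-cong : ∀ {a b c d} → (a < b → c < d) → (c < d → a < b) → (a <ᵇ b) ≡ (c <ᵇ d)
<ᵇ-cong {a} {b} {c} {d} = does-cong (a ℕ.<? b) (c ℕ.<? d)

<ᵇ-sound : ∀ {m n} → (m <ᵇ n) ≡ true → m < n
<ᵇ-sound {m} {n} eq with m ℕ.<? n
... | yes m<n = m<n
... | no m≮n  = contradiction (trans (sym eq) (<ᵇ-false (ℕ.≮⇒≥ m≮n))) λ ()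

-- Counting arrows triangle by triangle

module TriangleCounts {t m : ℕ} (n : ℕ) where
  open Cluster {t} {m} n
  open SeedProperties {Vertex t m} _≟ᵛ_ (vertices n) public

  V : Set
  V = Vertex t m

  opaque
    cycle₃ : V → V → V → V → V → ℤ
    cycle₃ v w x y z = arrowCount v w (x , y) ℤ.+ arrowCount v w (y , z) ℤ.+ arrowCount v w (z , x)

    cycle₃≡ : ∀ v w x y z → cycle₃ v w x y z ≡
      arrowCount v w (x , y) ℤ.+ arrowCount v w (y , z) ℤ.+ arrowCount v w (z , x)
    cycle₃≡ v w x y z = refl

  cycle₃-cong : ∀ v w {x y z x′ y′ z′} → x ≡ x′ → y ≡ y′ → z ≡ z′ → cycle₃ v w x y z ≡ cycle₃ v w x′ y′ z′
  cycle₃-cong v w refl refl refl = refl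

  cycle₃-rotate : ∀ v w x y z → cycle₃ v w x y z ≡ cycle₃ v w y z x
  cycle₃-rotate v w x y z = trans (cycle₃≡ v w x y z) (trans
    (lemma (arrowCount v w (x , y)) (arrowCount v w (y , z)) (arrowCount v w (z , x)))
        (sym (cycle₃≡ v w y z x)))
    where
    lemma : ∀ a b c → a ℤ.+ b ℤ.+ c ≡ b ℤ.+ c ℤ.+ a
    lemma = ℤ-solver.solve-∀

  cycleCount : (ℕ → ℕ → ℕ → V) → V → V → ℕ × ℕ × ℕ → ℤ
  cycleCount p v w (u₁ , u₂ , u₃) =
    cycle₃ v w (p (pred u₁) u₂ u₃) (p u₁ u₂ (pred u₃)) (p u₁ (pred u₂) u₃)

  triangleCount : (ℕ → ℕ → ℕ → V) → V → V → ℤ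
  triangleCount p v w = ∑ (positiveTriples (2 + n)) (cycleCount p v w)

  quiver-triangles : ∀ χ v w →
    quiver (quiverArrows χ) v w ≡ ∑ (allFin t) (λ τ → triangleCount (χ (τ , zero)) v w)
  quiver-triangles χ v w = trans (quiver-∑ (quiverArrows χ) v w) (trans
    (∑-concatMap _ (allFin t) (arrowCount v w)) (∑-cong (allFin t) λ τ → trans
    (∑-concatMap _ (positiveTriples (2 + n)) (arrowCount v w))
        (∑-cong (positiveTriples (2 + n)) λ (u₁ , u₂ , u₃) →
      let p = χ (τ , zero) in three (p (pred u₁) u₂ u₃) (p u₁ u₂ (pred u₃)) (p u₁ (pred u₂) u₃))))
    where
    lemma : ∀ a b c → a ℤ.+ (b ℤ.+ (c ℤ.+ + 0)) ≡ a ℤ.+ b ℤ.+ c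
    lemma = ℤ-solver.solve-∀
    three : ∀ x y z → ∑ ((x , y) ∷ (y , z) ∷ (z , x) ∷ []) (arrowCount v w) ≡ cycle₃ v w x y z
    three x y z = trans (lemma (arrowCount v w (x , y)) (arrowCount v w (y , z))
        (arrowCount v w (z , x))) (sym (cycle₃≡ v w x y z))

  triangleCount-next : ∀ {χ : Chart t m} → RotationInvariant χ → ∀ s v w →
    triangleCount (χ (next s)) v w ≡ triangleCount (χ s) v w
  triangleCount-next {χ} rot s v w = trans
    (∑-cong (positiveTriples (2 + n)) λ (u₁ , u₂ , u₃) →
      trans (cycle₃-cong v w (rot s (pred u₁) u₂ u₃) (rot s u₁ u₂ (pred u₃)) (rot s u₁ (pred u₂) u₃))
        (cycle₃-rotate v w (χ s u₃ (pred u₁) u₂) (χ s (pred u₃) u₁ u₂) (χ s u₃ u₁ (pred u₂))))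
    (∑-rotateTriples (2 + n) (cycleCount (χ s) v w))

  triangleCount-side : ∀ {χ : Chart t m} → RotationInvariant χ → ∀ s v w →
    triangleCount (χ (proj₁ s , zero)) v w ≡ triangleCount (χ s) v w
  triangleCount-side rot (τ , zero)           v w = refl
  triangleCount-side rot (τ , suc zero)       v w = sym (triangleCount-next rot (τ , zero) v w)
  triangleCount-side rot (τ , suc (suc zero)) v w =
    sym (trans (triangleCount-next rot (τ , suc zero) v w) (triangleCount-next rot (τ , zero) v w))

  triangleCount-pairs : ∀ p v w → triangleCount p v w ≡
    Σ² (suc n) (suc n) (λ x y → (x + y <ᵇ n) · cycleCount p v w (suc x , suc y , n ∸ (x + y)))
  triangleCount-pairs p v w = ∑-triples n (cycleCount p v w)

  -- The coordinates of the three corners of the cycle at (x + 1 , y + 1 , d).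
  corner-sums : ∀ {x y} → x + y < n → let d = n ∸ (x + y) in
    x + suc y + d ≡ suc n × suc x + suc y + pred d ≡ suc n × suc x + y + d ≡ suc n
  corner-sums {x} {y} lt with n ∸ (x + y) | ℕ.m+[n∸m]≡n (ℕ.<⇒≤ lt)
  ... | zero  | e = contradiction (trans (sym (ℕ.+-identityʳ (x + y))) e) (ℕ.<⇒≢ lt)
  ... | suc d | e = trans (first x y d) (cong suc e) , trans (second x y d) (cong suc e) , cong suc e
    where
    first : ∀ x y d → x + suc y + suc d ≡ suc (x + y + suc d)
    first = ℕ-solver.solve-∀
    second : ∀ x y d → suc x + suc y + d ≡ suc (x + y + suc d)
    second = ℕ-solver.solve-∀

  triangleCount-cong : ∀ {p q} v w → (∀ a b c → a + b + c ≡ suc n → p a b c ≡ q a b c) →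
    triangleCount p v w ≡ triangleCount q v w
  triangleCount-cong {p} {q} v w eq = trans (triangleCount-pairs p v w) (trans
    (Σ²-cong (suc n) (suc n) λ x y _ _ → ·-cong {x + y <ᵇ n} refl λ lt →
      let d = n ∸ (x + y)
          (s₁ , s₂ , s₃) = corner-sums {x} {y} (<ᵇ-sound lt)
      in cycle₃-cong v w (eq x (suc y) d s₁) (eq (suc x) (suc y) (pred d) s₂) (eq (suc x) y d s₃))
    (sym (triangleCount-pairs q v w)))

  triangleCount-zero : ∀ {p} v w →
    (∀ a b c a′ b′ c′ → a + b + c ≡ suc n → a′ + b′ + c′ ≡ suc n → arrowCount v w
        (p a b c , p a′ b′ c′) ≡ + 0) →
    triangleCount p v w ≡ + 0
  triangleCount-zero {p} v w eq = trans (triangleCount-pairs p v w)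
    (Σ<-zero (suc n) λ x _ → Σ<-zero (suc n) λ y _ → trans (·-cong {x + y <ᵇ n} refl λ lt →
      let d = n ∸ (x + y)
          (s₁ , s₂ , s₃) = corner-sums {x} {y} (<ᵇ-sound lt)
      in trans (cycle₃≡ v w (p x (suc y) d) (p (suc x) (suc y) (pred d)) (p (suc x) y d))
          (cong₂ ℤ._+_ (cong₂ ℤ._+_
           (eq x (suc y) d (suc x) (suc y) (pred d) s₁ s₂) (eq (suc x) (suc y) (pred d) (suc x) y d s₂ s₃))
           (eq (suc x) y d x (suc y) d s₃ s₁))) (·-0 (x + y <ᵇ n)))

module SquareCounts {t m : ℕ} (T : Triangulation t m) (n : ℕ) (χ : Chart t m)
  (isChart : TriangulationProperties.IsChart T n χ) (h k : Side t)
  (glued : Triangulation.Glued T h k) where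

  open Square T n χ isChart h k glued
  open TriangulationProperties T
  open IsChart isChart
  open TriangleCounts {t} {m} n

  squareArrows : V → V → Arrows
  squareArrows v w i j i′ j′ = arrowCount v w (□ i j , □ i′ j′)

  squareArrows-skew : ∀ v w → Skew (squareArrows v w)
  squareArrows-skew v w i j i′ j′ = arrowCount-skew v w (□ i j) (□ i′ j′)

  -- On the diagonal `square` uses the chart of `h`, and the gluing translates to that of `k`. In
  -- `upper-count` this concerns the cycles with `j ≡ suc i`, which have one corner on the arc.
  □-upper′ : ∀ {i j} → i ≤ j → 1 ≤ i → j ≤ n → □ i j ≡ χ k i (N ∸ j) (j ∸ i)
  □-upper′ {i} {j} i≤j 1≤i j≤n with ℕ.m≤n⇒m<n∨m≡n i≤j
  ... | inj₁ i<j  = □-upper i<j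
  ... | inj₂ refl = begin
    □ i i                  ≡⟨ □-lower ℕ.≤-refl ⟩
    χ h (N ∸ i) i (i ∸ i)  ≡⟨ cong (χ h (N ∸ i) i) (ℕ.n∸n≡0 i) ⟩
    χ h (N ∸ i) i 0        ≡⟨ glue glued (proj₁ (n∸-bounds 1≤i j≤n)) 1≤i (ℕ.m∸n+n≡m (ℕ.m≤n⇒m≤1+n j≤n)) ⟩
    χ k i (N ∸ i) 0        ≡⟨ cong (χ k i (N ∸ i)) (ℕ.n∸n≡0 i) ⟨
    χ k i (N ∸ i) (i ∸ i)  ∎

  suc-∸ : ∀ {i} → i ≤ n → suc (n ∸ i) ≡ N ∸ i
  suc-∸ i≤n = sym (ℕ.+-∸-assoc 1 i≤n)

  <-complement : ∀ {i j} → i ≤ n → (n ∸ i + j <ᵇ n) ≡ (j <ᵇ i)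
  <-complement {i} {j} i≤n = <ᵇ-cong
    (λ lt → ℕ.+-cancelˡ-< (n ∸ i) j i (subst (n ∸ i + j <_) (sym (ℕ.m∸n+n≡m i≤n)) lt))
    (λ lt → subst (n ∸ i + j <_) (ℕ.m∸n+n≡m i≤n) (ℕ.+-monoʳ-< (n ∸ i) lt))

  third-coordinate : ∀ {i} j → i ≤ n → n ∸ (n ∸ i + j) ≡ i ∸ j
  third-coordinate {i} j i≤n = trans (sym (ℕ.∸-+-assoc n (n ∸ i) j)) (cong (_∸ j) (ℕ.m∸[m∸n]≡n i≤n))

  -- The cycle with first two entries `suc x` and `suc y` lies in the unit square with lower left
  -- corner (n - x , y), which is below the diagonal exactly if `x + y < n`. Hence the reversal of
  -- the outer sum.
  lower-count : ∀ v w → triangleCount (χ h) v w ≡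
    Σ² N N (λ i j → (j <ᵇ i) · lowerCycle (squareArrows v w) i j)
  lower-count v w = trans (triangleCount-pairs (χ h) v w) (trans
    (Σ<-reverse n (λ x → Σ< N λ y → (x + y <ᵇ n) · cycleCount (χ h) v w (suc x , suc y , n ∸ (x + y))))
    (Σ²-cong N N λ i j i<N j<N → let i≤n = ℕ.≤-pred i<N in
      ·-cong (<-complement i≤n) λ lt → let j<i = <ᵇ-sound lt in
      trans (cycle₃-cong v w
        (sym (trans (□-lower (s≤s (ℕ.<⇒≤ j<i))) (cong (χ h (n ∸ i) (suc j)) (sym (third-coordinate j i≤n)))))
        (sym (trans (□-lower j<i) (cong₂ (λ x → χ h x (suc j)) (sym (suc-∸ i≤n))
          (trans (sym (ℕ.pred[m∸n]≡m∸[1+n] i j)) (cong pred (sym (third-coordinate j i≤n)))))))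
        (sym (trans (□-lower (ℕ.<⇒≤ j<i)) (cong₂ (λ x → χ h x j) (sym (suc-∸ i≤n))
            (sym (third-coordinate j i≤n))))))
        (cycle₃≡ v w (□ (suc i) (suc j)) (□ i (suc j)) (□ i j))))

  upper-count : ∀ v w → triangleCount (χ k) v w ≡
    Σ² N N (λ i j → (i <ᵇ j) · upperCycle (squareArrows v w) i j)
  upper-count v w = trans (triangleCount-pairs (χ k) v w) (Σ<-cong N λ i i<N → trans
    (Σ<-reverse n (λ y → (i + y <ᵇ n) · cycleCount (χ k) v w (suc i , suc y , n ∸ (i + y))))
    (Σ<-cong N λ j j<N → let j≤n = ℕ.≤-pred j<N; e = trans (cong (n ∸_) (ℕ.+-comm i (n ∸ j))) (third-coordinate i j≤n) in
      ·-cong (trans (cong (_<ᵇ n) (ℕ.+-comm i (n ∸ j))) (<-complement j≤n)) λ lt → let i<j = <ᵇ-sound lt in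
      trans (cycle₃-cong v w
        (sym (trans (□-upper i<j) (cong₂ (χ k i) (sym (suc-∸ j≤n)) (sym e))))
        (sym (trans (□-upper′ i<j (s≤s z≤n) j≤n) (cong₂ (χ k (suc i)) (sym (suc-∸ j≤n))
          (trans (sym (ℕ.pred[m∸n]≡m∸[1+n] j i)) (cong pred (sym e))))))
        (sym (trans (□-upper (s≤s i<j)) (cong (χ k (suc i) (n ∸ j)) (sym e)))))
        (cycle₃≡ v w (□ i j) (□ (suc i) j) (□ (suc i) (suc j)))))

-- The quiver before and after a flip

module FlippedCounts {t m : ℕ} {T T′ : Triangulation t m} (fl : Flip T T′) (n : ℕ) (χ : Chart t m)
  (isChart : TriangulationProperties.IsChart T n χ) where

  open Flip fl
  open FlippedChart fl n χ isChart
  open SquareCounts T n χ isChart h k glued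
  open TriangleCounts {t} {m} n

  lower-count′ : ∀ v w → triangleCount (χ′ h) v w ≡
    Σ² N N (λ i j → (i + j <ᵇ n) · lowerCycle′ (squareArrows v w) i j)
  lower-count′ v w = trans (triangleCount-pairs (χ′ h) v w) (trans
    (Σ<-swap N N (λ x y → (x + y <ᵇ n) · cycleCount (χ′ h) v w (suc x , suc y , n ∸ (x + y))))
    (Σ²-cong N N λ i j _ _ → ·-cong (cong (_<ᵇ n) (ℕ.+-comm j i)) λ _ → trans
      (cycle₃-cong v w (χ′≡ h₀ j (suc i) (n ∸ (j + i))) (χ′≡ h₀ (suc j) (suc i) (pred (n ∸ (j + i))))
          (χ′≡ h₀ (suc j) i (n ∸ (j + i))))
      (trans (cycle₃≡ v w (□ (suc i) j) (□ (suc i) (suc j)) (□ i (suc j)))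
      (lemma (squareArrows v w (suc i) j (suc i) (suc j)) (squareArrows v w (suc i) (suc j) i (suc j))
          (squareArrows v w i (suc j) (suc i) j)))))
    where
    lemma : ∀ a b c → a ℤ.+ b ℤ.+ c ≡ b ℤ.+ a ℤ.+ c
    lemma = ℤ-solver.solve-∀

  -- In the triangle at `k` both axes are reversed and exchanged: the cycle with first two entries
  -- `suc x` and `suc y` lies in the unit square with lower left corner (n - y , n - x).
  upper-count′ : ∀ v w → triangleCount (χ′ k) v w ≡
    Σ² N N (λ i j → (n <ᵇ i + j) · upperCycle′ (squareArrows v w) i j)
  upper-count′ v w = trans (triangleCount-pairs (χ′ k) v w) (trans
    (Σ<-swap N N g) (trans
    (Σ<-reverse n (λ y → Σ< N λ x → g x y)) (Σ<-cong N λ i i<N → trans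
    (Σ<-reverse n (λ x → g x (n ∸ i))) (Σ<-cong N λ j j<N → pointwise i j (ℕ.≤-pred i<N) (ℕ.≤-pred j<N)))))
    where
    g : ℕ → ℕ → ℤ
    g x y = (x + y <ᵇ n) · cycleCount (χ′ k) v w (suc x , suc y , n ∸ (x + y))
    lemma : ∀ a b c → a ℤ.+ b ℤ.+ c ≡ b ℤ.+ a ℤ.+ c
    lemma = ℤ-solver.solve-∀
    pointwise : ∀ i j → i ≤ n → j ≤ n →
      g (n ∸ j) (n ∸ i) ≡ (n <ᵇ i + j) · upperCycle′ (squareArrows v w) i j
    pointwise i j i≤n j≤n = ·-cong (trans (<-complement j≤n) (<ᵇ-cong
        (λ lt → subst (_< i + j) (ℕ.m+[n∸m]≡n i≤n) (ℕ.+-monoʳ-< i lt))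
        (λ lt → ℕ.+-cancelˡ-< i (n ∸ i) j (subst (_< i + j) (sym (ℕ.m+[n∸m]≡n i≤n)) lt)))) λ lt →
      let n<i+j = <ᵇ-sound lt
          d = n ∸ (n ∸ j + (n ∸ i))
          lt′ : n ∸ j + (n ∸ i) < n
          lt′ = <ᵇ-sound (trans (<-complement j≤n) (<ᵇ-true (ℕ.+-cancelˡ-< i (n ∸ i) j (subst (_< i + j)
              (sym (ℕ.m+[n∸m]≡n i≤n)) n<i+j))))
          total : n ∸ j + (n ∸ i) + d ≡ n
          total = ℕ.m+[n∸m]≡n (ℕ.<⇒≤ lt′)
          e₁ : n ∸ j + d ≡ i
          e₁ = ℕ.+-cancelʳ-≡ (n ∸ i) _ _ (trans (swap (n ∸ j) (n ∸ i) d)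
              (trans total (sym (ℕ.m+[n∸m]≡n i≤n))))
          e₂ : n ∸ i + d ≡ j
          e₂ = ℕ.+-cancelʳ-≡ (n ∸ j) _ _ (trans (swap′ (n ∸ i) (n ∸ j) d)
              (trans total (sym (ℕ.m+[n∸m]≡n j≤n))))
          pred-d : suc (pred d) ≡ d
          pred-d = ℕ.suc-pred d ⦃ ℕ.>-nonZero (ℕ.m<n⇒0<n∸m lt′) ⦄
      in trans (cycle₃-cong v w
          (trans (χ′≡ k₀ (n ∸ j) (suc (n ∸ i)) d) (cong₂ □ e₁ (cong suc e₂)))
          (trans (χ′≡ k₀ (suc (n ∸ j)) (suc (n ∸ i)) (pred d))
            (cong₂ □ (trans (sym (ℕ.+-suc (n ∸ j) (pred d))) (trans (cong (_+_ (n ∸ j)) pred-d) e₁))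
                     (trans (sym (ℕ.+-suc (n ∸ i) (pred d))) (trans (cong (_+_ (n ∸ i)) pred-d) e₂))))
          (trans (χ′≡ k₀ (suc (n ∸ j)) (n ∸ i) d) (cong₂ □ (cong suc e₁) e₂)))
        (trans (cycle₃≡ v w (□ i (suc j)) (□ i j) (□ (suc i) j))
        (lemma (squareArrows v w i (suc j) i j) (squareArrows v w i j (suc i) j) (squareArrows v w
            (suc i) j i (suc j))))
      where
      swap : ∀ x y z → x + z + y ≡ x + y + z
      swap = ℕ-solver.solve-∀
      swap′ : ∀ x y z → x + z + y ≡ y + x + z
      swap′ = ℕ-solver.solve-∀

  -- The flip leaves these arrows alone. They can join points on the boundary of the square and
  -- there add to or cancel arrows of the square, so they remain a separate summand throughout the
  -- flip; at interior points of the square they vanish.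
  outerArrows : V → V → ℤ
  outerArrows v w = ∑ (allFin t) (without (proj₁ h) (proj₁ k) λ τ → triangleCount (χ (τ , zero)) v w)

  outerArrows-from : ∀ {i j} → Interior i j → ∀ w → outerArrows (□ i j) w ≡ + 0
  outerArrows-from int w = ∑-without-zero (proj₁ h) (proj₁ k) _ λ τ τ≢h τ≢k →
    triangleCount-zero {χ (τ , zero)} (□ _ _) w λ a b c a′ b′ c′ s s′ → arrowCount-from-absent w
      (λ e → □-outside int (τ , zero) {a} {b} {c} s τ≢h τ≢k (sym e)) (λ e → □-outside int
          (τ , zero) {a′} {b′} {c′} s′ τ≢h τ≢k (sym e))

  outerArrows-to : ∀ {i j} → Interior i j → ∀ v → outerArrows v (□ i j) ≡ + 0
  outerArrows-to int v = ∑-without-zero (proj₁ h) (proj₁ k) _ λ τ τ≢h τ≢k →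
    triangleCount-zero {χ (τ , zero)} v (□ _ _) λ a b c a′ b′ c′ s s′ → arrowCount-to-absent v
      (λ e → □-outside int (τ , zero) {a} {b} {c} s τ≢h τ≢k (sym e)) (λ e → □-outside int
          (τ , zero) {a′} {b′} {c′} s′ τ≢h τ≢k (sym e))

  open Cluster {t} {m} n using (quiver; quiverArrows)

  quiver-split : ∀ (ψ : Chart t m) → RotationInvariant ψ → (∀ τ → τ ≢ proj₁ h → τ ≢ proj₁ k → ∀ a b c →
      ψ (τ , zero) a b c ≡ χ (τ , zero) a b c) →
    ∀ {f g : ℕ → ℕ → ℤ} v w →
    triangleCount (ψ h) v w ≡ Σ² N N f → triangleCount (ψ k) v w ≡ Σ² N N g →
    + 2 ℤ.* quiver (quiverArrows ψ) v w ≡ + 2 ℤ.* outerArrows v w ℤ.+ + 2 ℤ.* Σ² N N (λ i j → f i j ℤ.+ g i j)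
  quiver-split ψ rot same {f = f} {g} v w lower upper = begin
    + 2 ℤ.* quiver (quiverArrows ψ) v w
      ≡⟨ cong (+ 2 ℤ.*_) (trans (quiver-triangles ψ v w) (trans
           (∑-without (proj₁ h) (proj₁ k) h≢k (λ τ → triangleCount (ψ (τ , zero)) v w))
           (cong₂ ℤ._+_
             (cong₂ ℤ._+_ (trans (triangleCount-side rot h v w) lower)
                 (trans (triangleCount-side rot k v w) upper))
             (∑-without-cong (proj₁ h) (proj₁ k) _ _ λ τ τ≢h τ≢k →
               triangleCount-cong v w λ a b c _ → same τ τ≢h τ≢k a b c)))) ⟩
    + 2 ℤ.* (Σ² N N f ℤ.+ Σ² N N g ℤ.+ outerArrows v w)
      ≡⟨ lemma (Σ² N N f) (Σ² N N g) (outerArrows v w) ⟩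
    + 2 ℤ.* outerArrows v w ℤ.+ + 2 ℤ.* (Σ² N N f ℤ.+ Σ² N N g)
      ≡⟨ cong (λ z → + 2 ℤ.* outerArrows v w ℤ.+ + 2 ℤ.* z) (Σ²-+ N N f g) ⟨
    + 2 ℤ.* outerArrows v w ℤ.+ + 2 ℤ.* Σ² N N (λ i j → f i j ℤ.+ g i j) ∎
    where
    lemma : ∀ a b c → + 2 ℤ.* (a ℤ.+ b ℤ.+ c) ≡ + 2 ℤ.* c ℤ.+ + 2 ℤ.* (a ℤ.+ b)
    lemma = ℤ-solver.solve-∀

  quiver-start : ∀ v w → + 2 ℤ.* quiver (quiverArrows χ) v w ≡
    + 2 ℤ.* outerArrows v w ℤ.+ form n (λ i j → + startHeight n i j) (squareArrows v w)
  quiver-start v w = trans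
    (quiver-split χ (TriangulationProperties.IsChart.rotation isChart) (λ _ _ _ _ _ _ → refl)
      {λ i j → (j <ᵇ i) · lowerCycle (squareArrows v w) i j} {λ i j → (i <ᵇ j) · upperCycle
          (squareArrows v w) i j}
      v w (lower-count v w) (upper-count v w))
    (cong (ℤ._+_ (+ 2 ℤ.* outerArrows v w)) (form-start n (squareArrows v w) (squareArrows-skew v w)))

  quiver-end : ∀ v w → + 2 ℤ.* quiver (quiverArrows χ′) v w ≡
    + 2 ℤ.* outerArrows v w ℤ.+ form n (λ i j → + endHeight n i j) (squareArrows v w)
  quiver-end v w = trans
    (quiver-split χ′ rotation′ (λ τ τ≢h τ≢k a b c → χ′≡ {τ , zero} (outside τ≢h τ≢k) a b c)
      {λ i j → (i + j <ᵇ n) · lowerCycle′ (squareArrows v w) i j} {λ i j → (n <ᵇ i + j) · upperCycle′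
          (squareArrows v w) i j}
      v w (lower-count′ v w) (upper-count′ v w))
    (cong (ℤ._+_ (+ 2 ℤ.* outerArrows v w)) (form-end n (squareArrows v w) (squareArrows-skew v w)))

-- The heights between the rounds of a flip

parity-suc : ∀ m → suc m % 2 ≢ m % 2
parity-suc zero          ()
parity-suc (suc zero)    ()
parity-suc (suc (suc m)) = parity-suc m

parity-cases : ∀ m r → m % 2 ≡ r % 2 ⊎ m % 2 ≡ suc r % 2
parity-cases zero          zero          = inj₁ refl
parity-cases zero          (suc zero)    = inj₂ refl
parity-cases (suc zero)    zero          = inj₂ refl
parity-cases (suc zero)    (suc zero)    = inj₁ refl
parity-cases zero          (suc (suc r)) = parity-cases zero r
parity-cases (suc zero)    (suc (suc r)) = parity-cases (suc zero) r
parity-cases (suc (suc m)) r             = parity-cases m r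

parity-+double : ∀ m e → (m + (e + e)) % 2 ≡ m % 2
parity-+double m zero    = cong (_% 2) (ℕ.+-identityʳ m)
parity-+double m (suc e) = trans (cong (_% 2) (shift m e)) (parity-+double m e)
  where
  shift : ∀ m e → m + (suc e + suc e) ≡ suc (suc (m + (e + e)))
  shift = ℕ-solver.solve-∀

∣-∣-step : ∀ m n → ∣ suc m - n ∣ ≡ suc ∣ m - n ∣ ⊎ ∣ m - n ∣ ≡ suc ∣ suc m - n ∣
∣-∣-step m n with ℕ.≤-<-connex n m
... | inj₁ n≤m = inj₁ (trans (ℕ.∣-∣-comm (suc m) n) (trans (∣-∣-up n≤m) (cong suc (ℕ.∣-∣-comm n m))))
... | inj₂ m<n = inj₂ (trans (ℕ.∣-∣-comm m n) (trans (∣-∣-down m<n) (cong suc (ℕ.∣-∣-comm n (suc m)))))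

adjacent : ∀ {a b} → a ≡ suc b ⊎ b ≡ suc a → a ≤ suc b × b ≤ suc a × a % 2 ≢ b % 2
adjacent {b = b} (inj₁ refl) = ℕ.≤-refl , ℕ.≤-trans (ℕ.n≤1+n b) (ℕ.n≤1+n _) , parity-suc b
adjacent {a = a} (inj₂ refl) = ℕ.≤-trans (ℕ.n≤1+n a) (ℕ.n≤1+n _) , ℕ.≤-refl , λ e → parity-suc a (sym e)

module Rounds (n : ℕ) where

  N : ℕ
  N = suc n

  lo hi dev : ℕ → ℕ → ℕ
  lo = startHeight n
  hi = endHeight n
  dev i j = ∣ i + j - N ∣

  -- `e` counts the moves of a unit of weight from 00 and 11 to 10 and 01 that lead from the lower
  -- to the upper face, each raising the height by 2. For `j ≤ i` the lower point has w₀₀ = N - i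
  -- and w₁₁ = j, so `e` is the smaller of these two numbers.
  hi-double′ : ∀ {i j} → j ≤ i → i ≤ N → ∃ λ e → hi i j ≡ lo i j + (e + e)
  hi-double′ {i} {j} j≤i i≤N with ℕ.≤-total (i + j) N
  ... | inj₁ ≤N = j , trans (trans (cong (N ∸_) (ℕ.m≤n⇒∣m-n∣≡n∸m ≤N)) (ℕ.m∸[m∸n]≡n ≤N))
        (trans (cong (_+ j) (sym (trans (cong (_+ j) (ℕ.m≤n⇒∣n-m∣≡n∸m j≤i)) (ℕ.m∸n+n≡m j≤i))))
            (ℕ.+-assoc (lo i j) j j))
  ... | inj₂ N≤ with d , refl ← ℕ.m≤n⇒∃[o]m+o≡n j≤i | e , eq ← ℕ.m≤n⇒∃[o]m+o≡n i≤N = e , (begin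
    N ∸ ∣ j + d + j - N ∣                ≡⟨ cong (N ∸_) (trans (cong (∣ j + d + j -_∣) (sym eq))
        (ℕ.∣m+n-m+o∣≡∣n-o∣ (j + d) j e)) ⟩
    N ∸ ∣ j - e ∣                        ≡⟨ cong₂ _∸_ (sym eq) (ℕ.m≤n⇒∣n-m∣≡n∸m e≤j) ⟩
    j + d + e ∸ (j ∸ e)                  ≡⟨ cong (λ x → x + d + e ∸ (j ∸ e)) (ℕ.m∸n+n≡m e≤j) ⟨
    (j ∸ e) + e + d + e ∸ (j ∸ e)        ≡⟨ cong (_∸ (j ∸ e)) (shuffle (j ∸ e) e d) ⟩
    (j ∸ e) + (d + (e + e)) ∸ (j ∸ e)    ≡⟨ ℕ.m+n∸m≡n (j ∸ e) _ ⟩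
    d + (e + e)                          ≡⟨ cong (_+ (e + e)) (trans (ℕ.∣-∣-comm (j + d) j)
        (ℕ.∣m-m+n∣≡n j d)) ⟨
    ∣ j + d - j ∣ + (e + e)              ∎)
    where
    shuffle : ∀ x e d → x + e + d + e ≡ x + (d + (e + e))
    shuffle = ℕ-solver.solve-∀
    e≤j : e ≤ j
    e≤j = ℕ.+-cancelˡ-≤ (j + d) e j (subst (_≤ j + d + j) (sym eq) N≤)

  hi-double : ∀ i j → i ≤ N → j ≤ N → ∃ λ e → hi i j ≡ lo i j + (e + e)
  hi-double i j i≤N j≤N with ℕ.≤-total j i
  ... | inj₁ j≤i = hi-double′ j≤i i≤N
  ... | inj₂ i≤j = let (e , eq) = hi-double′ i≤j j≤N in
    e , trans (cong (λ x → N ∸ ∣ x - N ∣) (ℕ.+-comm i j)) (trans eq (cong (_+ (e + e)) (ℕ.∣-∣-comm j i)))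

  lo≤hi : ∀ i j → i ≤ N → j ≤ N → lo i j ≤ hi i j
  lo≤hi i j i≤N j≤N = let (e , eq) = hi-double i j i≤N j≤N in subst (lo i j ≤_) (sym eq) (ℕ.m≤m+n (lo i j) (e + e))

  hi-parity : ∀ i j → i ≤ N → j ≤ N → hi i j % 2 ≡ lo i j % 2
  hi-parity i j i≤N j≤N = let (e , eq) = hi-double i j i≤N j≤N in trans (cong (_% 2) eq) (parity-+double (lo i j) e)

  -- Before round r the points of the parity of r lie at height r and the others at height
  -- r + 1, as far as the initial and the final height permit.
  opaque
    level : ℕ → ℕ → ℕ
    level r l with l % 2 ℕ.≟ r % 2
    ... | yes _ = r
    ... | no _  = suc r

    level-same : ∀ {r l} → l % 2 ≡ r % 2 → level r l ≡ r
    level-same {r} {l} e with l % 2 ℕ.≟ r % 2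
    ... | yes _ = refl
    ... | no ne = contradiction e ne

    level-other : ∀ {r l} → l % 2 ≢ r % 2 → level r l ≡ suc r
    level-other {r} {l} ne with l % 2 ℕ.≟ r % 2
    ... | yes e = contradiction e ne
    ... | no _  = refl

  height : ℕ → ℕ → ℕ → ℕ
  height r i j = lo i j ⊔ (hi i j ⊓ level r (lo i j))

  height-level : ∀ {r i j} → lo i j ≤ level r (lo i j) → level r (lo i j) ≤ hi i j → height r i j ≡
      level r (lo i j)
  height-level lo≤ ≤hi = trans (cong (_ ⊔_) (ℕ.m≥n⇒m⊓n≡n ≤hi)) (ℕ.m≤n⇒m⊔n≡n lo≤)

  height-low : ∀ {r i j} → level r (lo i j) ≤ lo i j → height r i j ≡ lo i j
  height-low {r} {i} {j} ≤lo = ℕ.m≥n⇒m⊔n≡m (ℕ.≤-trans (ℕ.m⊓n≤n (hi i j) _) ≤lo)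

  height-high : ∀ {r i j} → i ≤ N → j ≤ N → hi i j ≤ level r (lo i j) → height r i j ≡ hi i j
  height-high {r} {i} {j} i≤N j≤N hi≤ = trans (cong (lo i j ⊔_) (ℕ.m≤n⇒m⊓n≡m hi≤))
      (ℕ.m≤n⇒m⊔n≡n (lo≤hi i j i≤N j≤N))

  height-start : ∀ {i j} → height 0 i j ≡ lo i j
  height-start {i} {j} with lo i j % 2 ℕ.≟ 0 % 2
  ... | yes e = height-low {0} {i} {j} (subst (_≤ lo i j) (sym (level-same e)) z≤n)
  ... | no ne = height-low {0} {i} {j} (subst (_≤ lo i j) (sym (level-other ne)) (ℕ.n≢0⇒n>0 λ e → ne
      (cong (_% 2) e)))

  -- No clamping at `hi` is lost: points of the other parity have level `N`, which bounds `hi`, and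
  -- for the parity of `n` the value `N` is excluded, so that `hi` is at most the level `n`.
  height-end : ∀ {i j} → i ≤ N → j ≤ N → height n i j ≡ hi i j
  height-end {i} {j} i≤N j≤N with lo i j % 2 ℕ.≟ n % 2
  ... | yes e = height-high {n} i≤N j≤N (subst (hi i j ≤_) (sym (level-same e))
      (ℕ.≤-pred (ℕ.≤∧≢⇒< hi≤N λ hi≡N →
    parity-suc n (trans (cong (_% 2) (sym hi≡N)) (trans (hi-parity i j i≤N j≤N) e)))))
    where
    hi≤N : hi i j ≤ N
    hi≤N = ℕ.m∸n≤m N (dev i j)
  ... | no ne = height-high {n} i≤N j≤N (subst (hi i j ≤_) (sym (level-other ne)) (ℕ.m∸n≤m N (dev i j)))

  -- By `headroom` and `headroom⁻` the last condition means that `hi` is at least `2 + r`. So a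
  -- round consists of the points at height `r` that can be raised by 2 without leaving the
  -- tetrahedron.
  InRound : ℕ → ℕ × ℕ → Set
  InRound r (i , j) = lo i j % 2 ≡ r % 2 × lo i j ≤ r × dev i j ≤ n ∸ suc r

  inRound? : ∀ r → Decidable (InRound r)
  inRound? r (i , j) = lo i j % 2 ℕ.≟ r % 2 ×-dec lo i j ℕ.≤? r ×-dec dev i j ℕ.≤? n ∸ suc r

  points : List (ℕ × ℕ)
  points = cartesianProduct (upTo (2 + n)) (upTo (2 + n))

  module _ {t m : ℕ} where
    round : ℕ → List (ℕ × ℕ)
    round = Cluster.round {t} {m} n

    round-unique : ∀ r → Unique (round r)
    round-unique r = Unique.filter⁺ (inRound? r) (Unique.cartesianProduct⁺ (Unique.upTo⁺ (2 + n))
        (Unique.upTo⁺ (2 + n)))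

    round-sound : ∀ {r x} → x ∈ round r → (proj₁ x ≤ N × proj₂ x ≤ N) × InRound r x
    round-sound {r} {x} x∈ = let
        (x∈points , inRound) = ∈-filter⁻ (inRound? r) {xs = points} x∈
        (i∈ , j∈) = ∈-cartesianProduct⁻ (upTo (2 + n)) (upTo (2 + n)) x∈points
      in (ℕ.≤-pred (∈-upTo⁻ i∈) , ℕ.≤-pred (∈-upTo⁻ j∈)) , inRound

    round-complete : ∀ {r i j} → i ≤ N → j ≤ N → InRound r (i , j) → (i , j) ∈ round r
    round-complete {r} i≤N j≤N = ∈-filter⁺ (inRound? r)
      (∈-cartesianProduct⁺ (∈-upTo⁺ (s≤s i≤N)) (∈-upTo⁺ (s≤s j≤N)))

  module _ {r : ℕ} (r<n : r < n) where

    headroom : ∀ {i j} → dev i j ≤ n ∸ suc r → 2 + r ≤ hi i j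
    headroom {i} {j} dev≤ = subst (_≤ hi i j) (ℕ.m∸[m∸n]≡n (s≤s r<n)) (ℕ.∸-monoʳ-≤ N dev≤)

    headroom⁻ : ∀ {i j} → dev i j ≤ N → 2 + r ≤ hi i j → dev i j ≤ n ∸ suc r
    headroom⁻ {i} {j} dev≤N room = subst (_≤ n ∸ suc r) (ℕ.m∸[m∸n]≡n dev≤N) (ℕ.∸-monoʳ-≤ N room)

    dev≤N : ∀ {i j} → i ≤ N → j ≤ N → dev i j ≤ N
    dev≤N {i} {j} i≤N j≤N with ℕ.≤-total (i + j) N
    ... | inj₁ ≤N = subst (_≤ N) (sym (ℕ.m≤n⇒∣m-n∣≡n∸m ≤N)) (ℕ.m∸n≤m N (i + j))
    ... | inj₂ N≤ = subst (_≤ N) (sym (ℕ.m≤n⇒∣n-m∣≡n∸m N≤)) (subst (i + j ∸ N ≤_) (ℕ.m+n∸n≡m N N)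
        (ℕ.∸-monoˡ-≤ N (ℕ.+-mono-≤ i≤N j≤N)))

    height-before : ∀ {x} → InRound r x → height r (proj₁ x) (proj₂ x) ≡ r
    height-before {i , j} (parity , lo≤r , dev≤) = trans
      (height-level {r} {i} {j} (subst (lo i j ≤_) (sym l) lo≤r) (subst (_≤ hi i j) (sym l)
          (ℕ.≤-trans (ℕ.m≤n+m r 2) (headroom {i} {j} dev≤)))) l
      where l = level-same {r} {lo i j} parity

    -- The points of a round are local minima of the surface. A neighbour has the other parity and
    -- hence level `suc r`, and neither bound interferes, because `lo` and `dev` change by only 1
    -- from a point to its neighbour.
    height-neighbour : ∀ {x} → InRound r x → ∀ {i j} →
      lo i j ≡ suc (lo (proj₁ x) (proj₂ x)) ⊎ lo (proj₁ x) (proj₂ x) ≡ suc (lo i j) →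
      dev i j ≡ suc (dev (proj₁ x) (proj₂ x)) ⊎ dev (proj₁ x) (proj₂ x) ≡ suc (dev i j) →
      height r i j ≡ suc r × ¬ InRound r (i , j)
    height-neighbour {x} (parity , lo≤r , dev≤) {i} {j} lo-step dev-step =
      trans (height-level {r} {i} {j} (subst (lo i j ≤_) (sym l) (ℕ.≤-trans lo≤ (s≤s lo≤r)))
          (subst (_≤ hi i j) (sym l) room)) l ,
      λ (same , _) → other same
      where
      near = adjacent lo-step
      lo≤ = proj₁ near
      other : lo i j % 2 ≢ r % 2
      other e = proj₂ (proj₂ near) (trans e (sym parity))
      l = level-other {r} {lo i j} other
      room : suc r ≤ hi i j
      room = subst (_≤ hi i j) (ℕ.m∸[m∸n]≡n (ℕ.m≤n⇒m≤1+n r<n)) (ℕ.∸-monoʳ-≤ N (ℕ.≤-trans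
        (ℕ.≤-trans (proj₁ (adjacent dev-step)) (s≤s dev≤)) (ℕ.≤-reflexive (sym (ℕ.+-∸-assoc 1 r<n)))))

    height-raised : ∀ {x} → InRound r x → height (suc r) (proj₁ x) (proj₂ x) ≡ 2 + height r (proj₁ x)
        (proj₂ x)
    height-raised {i , j} inRound@(parity , lo≤r , dev≤) = trans (trans
      (height-level {suc r} {i} {j} (subst (lo i j ≤_) (sym l) (ℕ.≤-trans lo≤r (ℕ.m≤n+m r 2)))
          (subst (_≤ hi i j) (sym l) (headroom {i} {j} dev≤))) l)
      (cong (_+_ 2) (sym (height-before {i , j} inRound)))
      where
      l = level-other {suc r} {lo i j} λ e → parity-suc r (trans (sym e) parity)

    -- For the parity opposite to `r` both levels are `suc r`. A point of the parity of `r` outside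
    -- the round has `lo` above `r` or `hi` below `2 + r`; since parity excludes `suc r`, the levels
    -- `r` and `2 + r` are both at most `lo` or both at least `hi`, and clamping gives the same
    -- height.
    height-kept : ∀ {i j} → i ≤ N → j ≤ N → ¬ InRound r (i , j) → height (suc r) i j ≡ height r i j
    height-kept {i} {j} i≤N j≤N ¬inRound with parity-cases (lo i j) r
    ... | inj₂ e = cong (λ x → lo i j ⊔ (hi i j ⊓ x)) (trans (level-same e)
          (sym (level-other λ e′ → parity-suc r (trans (sym e) e′))))
    ... | inj₁ e with lo i j ℕ.≤? r | 2 + r ℕ.≤? hi i j
    ...   | yes lo≤r | yes room = contradiction (e , lo≤r , headroom⁻ {i} {j} (dev≤N i≤N j≤N) room) ¬inRound
    ...   | no lo≰r  | _ = trans (height-low {suc r} {i} {j} (subst (_≤ lo i j) (sym l₂) r+2≤lo))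
        (sym (height-low {r} {i} {j} (subst (_≤ lo i j) (sym l₁) (ℕ.<⇒≤ (ℕ.≰⇒> lo≰r)))))
      where
      l₁ = level-same {r} {lo i j} e
      l₂ = level-other {suc r} {lo i j} λ e′ → parity-suc r (trans (sym e′) e)
      r+2≤lo : 2 + r ≤ lo i j
      r+2≤lo = ℕ.≤∧≢⇒< (ℕ.≰⇒> lo≰r) λ eq → parity-suc r (trans (cong (_% 2) eq) e)
    ...   | yes _    | no ¬room = trans (height-high {suc r} i≤N j≤N (subst (hi i j ≤_) (sym l₂)
        (ℕ.≤-trans hi≤r (ℕ.m≤n+m r 2))))
              (sym (height-high {r} i≤N j≤N (subst (hi i j ≤_) (sym l₁) hi≤r)))
      where
      l₁ = level-same {r} {lo i j} e
      l₂ = level-other {suc r} {lo i j} λ e′ → parity-suc r (trans (sym e′) e)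
      hi≤r : hi i j ≤ r
      hi≤r = ℕ.≤-pred (ℕ.≤∧≢⇒< (ℕ.≤-pred (ℕ.≰⇒> ¬room)) λ eq → parity-suc r
          (trans (cong (_% 2) (sym eq)) (trans (hi-parity i j i≤N j≤N) e)))

    -- On the boundary of the square the initial and the final height agree.
    round-interior : ∀ {i j} → i ≤ N → j ≤ N → InRound r (i , j) → (1 ≤ i × i ≤ n) × (1 ≤ j × j ≤ n)
    round-interior {i} {j} i≤N j≤N (_ , lo≤r , dev≤) =
      (ℕ.n≢0⇒n>0 (λ { refl → boundary left }) , ℕ.≤-pred (ℕ.≤∧≢⇒< i≤N λ { refl → boundary right })) ,
      (ℕ.n≢0⇒n>0 (λ { refl → boundary bottom }) , ℕ.≤-pred (ℕ.≤∧≢⇒< j≤N λ { refl → boundary top }))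
      where
      boundary : ¬ hi i j ≤ lo i j
      boundary hi≤lo = ℕ.1+n≰n (ℕ.≤-trans (ℕ.n≤1+n (suc r)) (ℕ.≤-trans (headroom {i} {j} dev≤)
          (ℕ.≤-trans hi≤lo lo≤r)))
      left : N ∸ ∣ j - N ∣ ≤ j
      left = ℕ.≤-reflexive (trans (cong (N ∸_) (ℕ.m≤n⇒∣m-n∣≡n∸m j≤N)) (ℕ.m∸[m∸n]≡n j≤N))
      right : N ∸ ∣ N + j - N ∣ ≤ ∣ N - j ∣
      right = ℕ.≤-reflexive (trans (cong (N ∸_) (trans (ℕ.∣-∣-comm (N + j) N) (ℕ.∣m-m+n∣≡n N j)))
          (sym (ℕ.m≤n⇒∣n-m∣≡n∸m j≤N)))
      bottom : N ∸ ∣ i + 0 - N ∣ ≤ ∣ i - 0 ∣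
      bottom = ℕ.≤-reflexive (trans (cong (λ x → N ∸ ∣ x - N ∣) (ℕ.+-identityʳ i))
        (trans (trans (cong (N ∸_) (ℕ.m≤n⇒∣m-n∣≡n∸m i≤N)) (ℕ.m∸[m∸n]≡n i≤N)) (sym (ℕ.∣-∣-identityʳ i))))
      top : N ∸ ∣ i + N - N ∣ ≤ ∣ i - N ∣
      top = ℕ.≤-reflexive (trans (cong (N ∸_) (trans (cong (λ x → ∣ x - N ∣) (ℕ.+-comm i N))
        (trans (ℕ.∣-∣-comm (N + i) N) (ℕ.∣m-m+n∣≡n N i)))) (sym (ℕ.m≤n⇒∣m-n∣≡n∸m i≤N)))

-- The mutations of a flip

-- The variable at a point of a triangle with edge variables x for n = 1.
triangleVariable : ∀ {t} → (Side t → ℚ) → Side t → ℕ → ℕ → ℕ → ℚ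
triangleVariable x s a b c = x s ^ℚ (a ℕ.* b) ℚ.* (x (next s) ^ℚ (b ℕ.* c) ℚ.* x (prev s) ^ℚ (c ℕ.* a))

triangleVariable-rotation : ∀ {t} (x : Side t → ℚ) → RotationInvariant (triangleVariable x)
triangleVariable-rotation x s a b c rewrite next³ s =
  solve 3 (λ p q r → p :* (q :* r) := r :* (p :* q)) refl
    (x (next s) ^ℚ (a ℕ.* b)) (x (prev s) ^ℚ (b ℕ.* c)) (x s ^ℚ (c ℕ.* a))
  where open ℚ-solver.+-*-Solver

-- Recognises the lower faces: with `a` and `b` the weights of 10 and 01, the height `a + b` equals
-- the distance of the point coordinates only if one weight vanishes. The bound `1 ≤ b` keeps the
-- diagonal out of the upper triangle, as `square` requires.
∣-∣≡+ : ∀ a b → ∣ a - b ∣ ≡ a + b → (a ≡ 0 × 1 ≤ b) ⊎ b ≡ 0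
∣-∣≡+ a       zero    _  = inj₂ refl
∣-∣≡+ zero    (suc b) _  = inj₁ (refl , s≤s z≤n)
∣-∣≡+ (suc a) (suc b) eq = contradiction (ℕ.≤-trans (ℕ.∣m-n∣≤m⊔n a b) (ℕ.m⊔n≤m+n a b))
  (ℕ.<⇒≱ (subst (a + b <_) (sym eq) (s≤s (ℕ.+-monoʳ-≤ a (ℕ.n≤1+n b)))))

module FlipMutation {t m : ℕ} {T T′ : Triangulation t m} (fl : Flip T T′) (n : ℕ) (χ : Chart t m)
  (isChart : TriangulationProperties.IsChart T n χ) where

  open Flip fl
  open FlippedChart fl n χ isChart
  open SquareCounts T n χ isChart h k glued
  open FlippedCounts fl n χ isChart
  open TriangleCounts {t} {m} n
  open TriangulationProperties T
  open Cluster {t} {m} n using (Seed; arrows; cluster; mutate; mutateAll; quiver; quiverArrows)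
  open Evaluation {Vertex t m} _≟ᵛ_ (vertices n) using (_hasValue_)
  private module C = TriangulationProperties.IsChart isChart

  δ-point : ∀ a b → δ a b a b ≡ + 1
  δ-point a b rewrite ≡ᵇ-refl a | ≡ᵇ-refl b = refl

  δ-elsewhere : ∀ {a b i j} → (i , j) ≢ (a , b) → δ a b i j ≡ + 0
  δ-elsewhere {a} {b} {i} {j} ne with i ℕ.≟ a
  ... | no i≢a   rewrite ≡ᵇ-false i≢a = refl
  ... | yes refl rewrite ≡ᵇ-refl i | ≡ᵇ-false {j} {b} (λ { refl → ne refl }) = refl

  -- Translates equality of vertices into equality of points. Only `(a , b)` has to be interior, so
  -- `(i , j)` ranges over the whole square, as in the sums of `form`.
  indicator-δ : ∀ {a b i j} → Interior a b → i ≤ N → j ≤ N → indicator (□ a b) (□ i j) ≡ δ a b i j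
  indicator-δ {a} {b} {i} {j} int i≤N j≤N with Product.≡-dec ℕ._≟_ ℕ._≟_ (i , j) (a , b)
  ... | yes refl = trans (indicator-≡ refl) (sym (δ-point i j))
  ... | no ne    = trans (indicator-≢ (λ e → let (p , q) = □-injective int i≤N j≤N (sym e) in ne (cong₂ _,_ p q)))
                         (sym (δ-elsewhere {a} {b} {i} {j} ne))

  onSides-≢ : ∀ s s′ {a b a′ b′ v w} → a + b ≡ N → a′ + b′ ≡ N → 1 ≤ a × 1 ≤ b → 1 ≤ a′ × 1 ≤ b′ →
    v ≡ χ s a b 0 → w ≡ χ s′ a′ b′ 0 → s ≢ s′ → ¬ Triangulation.Glued T s s′ → v ≢ w
  onSides-≢ s s′ sum sum′ pos pos′ refl refl s≢s′ unglued eq with C.onSides s s′ sum sum′ pos pos′ eq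
  ... | inj₁ (s≡s′ , _)  = s≢s′ s≡s′
  ... | inj₂ (g , _)     = unglued g

  glued-k : Triangulation.Glued T k h
  glued-k = glued-sym {h} glued

  N∸n≡1 : N ∸ n ≡ 1
  N∸n≡1 = ℕ.m+n∸n≡m 1 n

  -- Neighbours of an interior point on different sides of it are different vertices: two
  -- neighbours on the boundary lie on adjacent sides of the square, which are not glued.
  module _ {a b : ℕ} (a<n : a < n) (b<n : b < n) where
    private
      i = suc a
      j = suc b
      1≤n : 1 ≤ n
      1≤n = ℕ.≤-trans (s≤s z≤n) a<n

    interior : Interior i j
    interior = (s≤s z≤n , a<n) , (s≤s z≤n , b<n)

    north≢east : □ i (suc j) ≢ □ (suc i) j
    north≢east with j ℕ.<? n | i ℕ.<? n
    ... | yes j<n | _ = λ e → ℕ.1+n≢n (proj₁ (□-injective ((s≤s z≤n , a<n) , (s≤s z≤n , j<n)) (s≤s a<n)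
        (ℕ.m≤n⇒m≤1+n b<n) (sym e)))
    ... | no _ | yes i<n = λ e → ℕ.1+n≢n (proj₂ (□-injective ((s≤s z≤n , i<n) , (s≤s z≤n , b<n))
        (ℕ.m≤n⇒m≤1+n a<n) (s≤s b<n) e))
    ... | no j≮n | no i≮n with refl ← ℕ.≤-antisym b<n (ℕ.≮⇒≥ j≮n) | refl ← ℕ.≤-antisym a<n (ℕ.≮⇒≥ i≮n) =
      onSides-≢ (prev k) (next h) refl (ℕ.+-comm n 1) (s≤s z≤n , 1≤n) (1≤n , s≤s z≤n)
        (trans (□-upper ℕ.≤-refl) (trans (cong₂ (χ k n) (ℕ.n∸n≡0 N) N∸n≡1) (sym (rotation² k 1 n 0))))
        (trans (□-lower (ℕ.n≤1+n n)) (trans (cong₂ (λ x → χ h x n) (ℕ.n∸n≡0 N) N∸n≡1)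
            (sym (C.rotation h n 1 0))))
        (λ e → h≢k (sym (cong proj₁ e))) (λ g → unglued-adjacent glued (glued-sym {prev k} g))

    north≢west : □ i (suc j) ≢ □ a j
    north≢west with j ℕ.<? n | a ℕ.≟ 0
    ... | yes j<n | _ = λ e → ℕ.1+n≢n (sym (proj₁ (□-injective ((s≤s z≤n , a<n) , (s≤s z≤n , j<n))
        (ℕ.<⇒≤ (ℕ.m≤n⇒m≤1+n a<n)) (ℕ.m≤n⇒m≤1+n b<n) (sym e))))
    ... | no _ | no a≢0 = λ e → ℕ.1+n≢n (proj₂ (□-injective ((ℕ.n≢0⇒n>0 a≢0 , ℕ.<⇒≤ a<n) ,
        (s≤s z≤n , b<n)) (ℕ.m≤n⇒m≤1+n a<n) (s≤s b<n) e))
    ... | no j≮n | yes refl with refl ← ℕ.≤-antisym b<n (ℕ.≮⇒≥ j≮n) =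
      onSides-≢ (prev k) (next k) (ℕ.+-comm n 1) refl (1≤n , s≤s z≤n) (s≤s z≤n , 1≤n)
        (trans (□-upper (s≤s (s≤s z≤n))) (trans (cong (λ x → χ k 1 x n) (ℕ.n∸n≡0 N))
            (sym (rotation² k n 1 0))))
        (trans (□-upper (s≤s z≤n)) (trans (cong (λ x → χ k 0 x n) N∸n≡1) (sym (C.rotation k 1 n 0))))
        (next≢ (next k)) (unglued-next {next k})

    south≢east : □ i b ≢ □ (suc i) j
    south≢east with b ℕ.≟ 0 | i ℕ.<? n
    ... | no b≢0 | _ = λ e → ℕ.1+n≢n (proj₁ (□-injective ((s≤s z≤n , a<n) , (ℕ.n≢0⇒n>0 b≢0 , ℕ.<⇒≤ b<n))
        (s≤s a<n) (ℕ.m≤n⇒m≤1+n b<n) (sym e)))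
    ... | yes _ | yes i<n = λ e → ℕ.1+n≢n (sym (proj₂ (□-injective ((s≤s z≤n , i<n) , (s≤s z≤n , b<n))
        (ℕ.m≤n⇒m≤1+n a<n) (ℕ.<⇒≤ (ℕ.m≤n⇒m≤1+n b<n)) e)))
    ... | yes refl | no i≮n with refl ← ℕ.≤-antisym a<n (ℕ.≮⇒≥ i≮n) =
      onSides-≢ (prev h) (next h) (ℕ.+-comm n 1) refl (1≤n , s≤s z≤n) (s≤s z≤n , 1≤n)
        (trans (□-lower z≤n) (trans (cong (λ x → χ h x 0 n) N∸n≡1) (sym (rotation² h n 1 0))))
        (trans (□-lower (s≤s z≤n)) (trans (cong (λ x → χ h x 1 n) (ℕ.n∸n≡0 N)) (sym (C.rotation h 1 n 0))))
        (next≢ (next h)) (unglued-next {next h})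

    south≢west : □ i b ≢ □ a j
    south≢west with b ℕ.≟ 0 | a ℕ.≟ 0
    ... | no b≢0 | _ = λ e → ℕ.1+n≢n
        (sym (proj₁ (□-injective ((s≤s z≤n , a<n) , (ℕ.n≢0⇒n>0 b≢0 , ℕ.<⇒≤ b<n))
        (ℕ.<⇒≤ (ℕ.m≤n⇒m≤1+n a<n)) (ℕ.m≤n⇒m≤1+n b<n) (sym e))))
    ... | yes _ | no a≢0 = λ e → ℕ.1+n≢n
        (sym (proj₂ (□-injective ((ℕ.n≢0⇒n>0 a≢0 , ℕ.<⇒≤ a<n) , (s≤s z≤n , b<n)) (ℕ.m≤n⇒m≤1+n a<n)
        (ℕ.<⇒≤ (ℕ.m≤n⇒m≤1+n b<n)) e)))
    ... | yes refl | yes refl =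
      onSides-≢ (prev h) (next k) refl (ℕ.+-comm n 1) (s≤s z≤n , 1≤n) (1≤n , s≤s z≤n)
        (trans (□-lower z≤n) (sym (rotation² h 1 n 0)))
        (trans (□-upper (s≤s z≤n)) (sym (C.rotation k n 1 0)))
        (λ e → h≢k (cong proj₁ e)) (λ g → unglued-adjacent glued-k (glued-sym {prev h} g))

    private
      i≤N = ℕ.m≤n⇒m≤1+n a<n
      j≤N = ℕ.m≤n⇒m≤1+n b<n

    north∈ : □ i (suc j) ∈ vertices n
    north∈ = □-member i≤N (s≤s b<n) (s≤s z≤n) (ℕ.+-mono-<-≤ (s≤s a<n) (s≤s b<n)) (inj₁ λ ()) (inj₂ λ ())

    south∈ : □ i b ∈ vertices n
    south∈ = □-member i≤N (ℕ.<⇒≤ j≤N) (s≤s z≤n) (ℕ.+-mono-<-≤ (s≤s a<n) (ℕ.<⇒≤ j≤N)) (inj₁ λ ())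
        (inj₁ (ℕ.<⇒≢ (s≤s a<n)))

    east∈ : □ (suc i) j ∈ vertices n
    east∈ = □-member (s≤s a<n) j≤N (s≤s z≤n) (ℕ.+-mono-≤-< (s≤s a<n) (s≤s b<n)) (inj₁ λ ()) (inj₂ λ ())

    west∈ : □ a j ∈ vertices n
    west∈ = □-member (ℕ.<⇒≤ i≤N) j≤N (ℕ.m≤n⇒m≤o+n a (s≤s z≤n)) (ℕ.+-mono-≤-< (ℕ.<⇒≤ i≤N) (s≤s b<n))
      (inj₂ (ℕ.<⇒≢ (s≤s b<n))) (inj₂ λ ())

  module _ (s₀ : Seed) (arrows₀ : ∀ v w → arrows s₀ v w ≡ quiver (quiverArrows χ) v w)
    (x : Side t → ℚ) (x-glued : x h ≡ x k)
    (values₀ : ∀ s a b c → a + b + c ≡ N → cluster s₀ (χ s a b c) hasValue triangleVariable x s a b c)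
    (ℓ : ℚ) (ptolemy : ℓ ℚ.* x h ≡ x (prev h) ℚ.* x (prev k) ℚ.+ x (next h) ℚ.* x (next k)) where

    open Quadrilateral ℓ (x h) (x (prev h)) (x (next h)) (x (next k)) (x (prev k))

    -- The state in the course of the flip in which the square has height τ.
    record State (s : Seed) (τ : ℕ → ℕ → ℕ) : Set where
      field
        arrows≡ : ∀ v w → + 2 ℤ.* arrows s v w ≡
          + 2 ℤ.* outerArrows v w ℤ.+ form n (λ i j → + τ i j) (squareArrows v w)
        -- The point and its height determine the weights through these equations, but solving them
        -- requires halving. Quantifying over all solutions avoids this and claims nothing where the
        -- parity is wrong or the height leaves the tetrahedron.
        values  : ∀ {i j} w₀₀ w₁₀ w₁₁ w₀₁ → w₀₀ + w₁₀ + w₁₁ + w₀₁ ≡ N → i ≡ w₁₀ + w₁₁ → j ≡ w₀₁ + w₁₁ →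
          τ i j ≡ w₁₀ + w₀₁ → cluster s (□ i j) hasValue weighted w₀₀ w₁₀ w₁₁ w₀₁
        others  : ∀ v → (∀ i j → Interior i j → v ≢ □ i j) → cluster s v ≡ cluster s₀ v

    start-values : ∀ {i j} w₀₀ w₁₀ w₁₁ w₀₁ → w₀₀ + w₁₀ + w₁₁ + w₀₁ ≡ N → i ≡ w₁₀ + w₁₁ → j ≡ w₀₁ + w₁₁ →
      startHeight n i j ≡ w₁₀ + w₀₁ → cluster s₀ (□ i j) hasValue weighted w₀₀ w₁₀ w₁₁ w₀₁
    start-values w₀₀ w₁₀ w₁₁ w₀₁ sum refl refl height with ∣-∣≡+ w₁₀ w₀₁
      (trans (sym (trans (cong₂ ∣_-_∣ (ℕ.+-comm w₁₀ w₁₁) (ℕ.+-comm w₀₁ w₁₁))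
          (ℕ.∣m+n-m+o∣≡∣n-o∣ w₁₁ w₁₀ w₀₁))) height)
    ... | inj₂ refl = subst₂ _hasValue_
        (cong (cluster s₀) (sym (trans (□-lower (ℕ.m≤n+m w₁₁ w₁₀)) (cong₂ (λ y → χ h y w₁₁) rest
            (ℕ.m+n∸n≡m w₁₀ w₁₁)))))
        value (values₀ h w₀₀ w₁₁ w₁₀ (trans (swap w₀₀ w₁₁ w₁₀) (trans (sym (ℕ.+-identityʳ _)) sum)))
      where
      swap : ∀ p q r → p + q + r ≡ p + r + q
      swap = ℕ-solver.solve-∀
      rest : N ∸ (w₁₀ + w₁₁) ≡ w₀₀
      rest = trans (cong (_∸ (w₁₀ + w₁₁)) (trans (sym sum) (trans (ℕ.+-identityʳ _)
          (ℕ.+-assoc w₀₀ w₁₀ w₁₁)))) (ℕ.m+n∸n≡m w₀₀ (w₁₀ + w₁₁))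
      value : triangleVariable x h w₀₀ w₁₁ w₁₀ ≡ weighted w₀₀ w₁₀ w₁₁ 0
      value rewrite ℕ.*-zeroʳ w₁₀ | ℕ.*-zeroʳ w₀₀ | ℕ.*-comm w₁₀ w₀₀ =
        solve 3 (λ p q r → p :* (q :* r) := con 1ℚ :* p :* (r :* q) :* (con 1ℚ :* con 1ℚ)) refl
          (x h ^ℚ (w₀₀ ℕ.* w₁₁)) (x (next h) ^ℚ (w₁₁ ℕ.* w₁₀)) (x (prev h) ^ℚ (w₀₀ ℕ.* w₁₀))
        where open ℚ-solver.+-*-Solver
    ... | inj₁ (refl , 1≤w₀₁) = subst₂ _hasValue_ (cong (cluster s₀) (sym upper))
        value (values₀ k w₁₁ w₀₀ w₀₁ (trans (swap w₁₁ w₀₀ w₀₁) sum))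
      where
      swap : ∀ p q r → p + q + r ≡ q + 0 + p + r
      swap = ℕ-solver.solve-∀
      swap′ : ∀ p q r → p + 0 + q + r ≡ p + (r + q)
      swap′ = ℕ-solver.solve-∀
      rest : N ∸ (w₀₁ + w₁₁) ≡ w₀₀
      rest = trans (cong (_∸ (w₀₁ + w₁₁)) (trans (sym sum) (swap′ w₀₀ w₁₁ w₀₁))) (ℕ.m+n∸n≡m w₀₀ (w₀₁ + w₁₁))
      upper : □ w₁₁ (w₀₁ + w₁₁) ≡ χ k w₁₁ w₀₀ w₀₁
      upper = trans (□-upper (ℕ.m<n+m w₁₁ 1≤w₀₁)) (cong₂ (χ k w₁₁) rest (ℕ.m+n∸n≡m w₀₁ w₁₁))
      value : triangleVariable x k w₁₁ w₀₀ w₀₁ ≡ weighted w₀₀ 0 w₁₁ w₀₁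
      value rewrite ℕ.*-zeroʳ w₀₀ | ℕ.*-zeroʳ w₁₁ | sym x-glued | ℕ.*-comm w₁₁ w₀₀ =
        solve 3 (λ p q r → p :* (q :* r) := con 1ℚ :* p :* (con 1ℚ :* con 1ℚ) :* (q :* r)) refl
          (x h ^ℚ (w₀₀ ℕ.* w₁₁)) (x (next k) ^ℚ (w₀₀ ℕ.* w₀₁)) (x (prev k) ^ℚ (w₀₁ ℕ.* w₁₁))
        where open ℚ-solver.+-*-Solver

    startState : State s₀ (startHeight n)
    startState = record
      { arrows≡ = λ v w → trans (cong (+ 2 ℤ.*_) (arrows₀ v w)) (quiver-start v w)
      ; values  = start-values
      ; others  = λ _ _ → refl
      }

    module _ {s : Seed} {τ : ℕ → ℕ → ℕ} (state : State s τ) {a b : ℕ} (a<n : a < n) (b<n : b < n)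
      (northHeight : τ (suc a) (suc (suc b)) ≡ suc (τ (suc a) (suc b)))
      (southHeight : τ (suc a) b ≡ suc (τ (suc a) (suc b)))
      (eastHeight  : τ (suc (suc a)) (suc b) ≡ suc (τ (suc a) (suc b)))
      (westHeight  : τ a (suc b) ≡ suc (τ (suc a) (suc b)))
      where
      open State state
      private
        i = suc a
        j = suc b
        int = interior a<n b<n
        i≤N = ℕ.m≤n⇒m≤1+n a<n
        j≤N = ℕ.m≤n⇒m≤1+n b<n

      row : V → ℤ
      row w = indicator w (□ i (suc j)) ℤ.+ indicator w (□ i b) ℤ.- indicator w
          (□ (suc i) j) ℤ.- indicator w (□ a j)

      heights : ∀ {u} → u ≡ suc (τ i j) → + u ≡ + τ i j ℤ.+ + 1
      heights refl = cong +_ (ℕ.+-comm 1 (τ i j))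

      out-row : ∀ w → arrows s (□ i j) w ≡ row w
      out-row w = ℤ.*-cancelˡ-≡ (+ 2) _ _ (begin
        + 2 ℤ.* arrows s (□ i j) w
          ≡⟨ arrows≡ (□ i j) w ⟩
        + 2 ℤ.* outerArrows (□ i j) w ℤ.+ form n (λ i j → + τ i j) (squareArrows (□ i j) w)
          ≡⟨ cong₂ (λ p q → + 2 ℤ.* p ℤ.+ q) (outerArrows-from int w)
               (form-cong n {t = λ i j → + τ i j} {A = squareArrows (□ i j) w}
                 {B = λ p q p′ q′ → δ i j p q ℤ.* ω p′ q′ ℤ.- δ i j p′ q′ ℤ.* ω p q}
                     (λ _ _ _ _ → refl) λ p q p′ q′ p≤ q≤ p′≤ q′≤ → trans (arrowCount≡ (□ i j) w (□ p q)
                     (□ p′ q′))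
                 (trans (cong₂ (λ y z → y ℤ.* indicator w (□ p′ q′) ℤ.- indicator w (□ p q) ℤ.* z)
                   (indicator-δ int p≤ q≤) (indicator-δ int p′≤ q′≤))
                   (cong (λ z → δ i j p q ℤ.* indicator w (□ p′ q′) ℤ.- z)
                       (ℤ.*-comm (indicator w (□ p q)) (δ i j p′ q′))))) ⟩
        + 0 ℤ.+ form n (λ i j → + τ i j) (λ p q p′ q′ → δ i j p q ℤ.* ω p′ q′ ℤ.- δ i j p′ q′ ℤ.* ω p q)
          ≡⟨ trans (ℤ.+-identityˡ _) (form-row n (λ i j → + τ i j) ω a b a<n b<n
               (heights eastHeight) (heights westHeight) (heights northHeight) (heights southHeight)) ⟩
        + 2 ℤ.* row w ∎)
        where
        ω : ℕ → ℕ → ℤ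
        ω p q = indicator w (□ p q)

      in-row : ∀ w → arrows s w (□ i j) ≡ ℤ.- row w
      in-row w = ℤ.*-cancelˡ-≡ (+ 2) _ _ (begin
        + 2 ℤ.* arrows s w (□ i j)
          ≡⟨ arrows≡ w (□ i j) ⟩
        + 2 ℤ.* outerArrows w (□ i j) ℤ.+ form n (λ i j → + τ i j) (squareArrows w (□ i j))
          ≡⟨ cong₂ (λ p q → + 2 ℤ.* p ℤ.+ q) (outerArrows-to int w)
               (form-cong n {t = λ i j → + τ i j} {A = squareArrows w (□ i j)}
                 {B = λ p q p′ q′ → δ i j p q ℤ.* ω p′ q′ ℤ.- δ i j p′ q′ ℤ.* ω p q}
                     (λ _ _ _ _ → refl) λ p q p′ q′ p≤ q≤ p′≤ q′≤ → trans (arrowCount≡ w (□ i j) (□ p q)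
                     (□ p′ q′))
                 (trans (cong₂ (λ y z → indicator w (□ p q) ℤ.* z ℤ.- y ℤ.* indicator w (□ p′ q′))
                   (indicator-δ int p≤ q≤) (indicator-δ int p′≤ q′≤))
                   (lemma (indicator w (□ p q)) (δ i j p′ q′) (δ i j p q) (indicator w (□ p′ q′))))) ⟩
        + 0 ℤ.+ form n (λ i j → + τ i j) (λ p q p′ q′ → δ i j p q ℤ.* ω p′ q′ ℤ.- δ i j p′ q′ ℤ.* ω p q)
          ≡⟨ trans (ℤ.+-identityˡ _) (form-row n (λ i j → + τ i j) ω a b a<n b<n
               (heights eastHeight) (heights westHeight) (heights northHeight) (heights southHeight)) ⟩
        + 2 ℤ.* (ω i (suc j) ℤ.+ ω i b ℤ.- ω (suc i) j ℤ.- ω a j)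
          ≡⟨ cong (+ 2 ℤ.*_) (negated (indicator w (□ i (suc j))) (indicator w (□ i b))
              (indicator w (□ (suc i) j)) (indicator w (□ a j))) ⟩
        + 2 ℤ.* ℤ.- row w ∎)
        where
        -- The sign accounts for the fixed point being the target: exchanging source and target
        -- negates the arrow count.
        ω : ℕ → ℕ → ℤ
        ω p q = ℤ.- indicator w (□ p q)
        lemma : ∀ p q r t → p ℤ.* q ℤ.- r ℤ.* t ≡ r ℤ.* ℤ.- t ℤ.- q ℤ.* ℤ.- p
        lemma = ℤ-solver.solve-∀
        negated : ∀ p q r t → ℤ.- p ℤ.+ ℤ.- q ℤ.- ℤ.- r ℤ.- ℤ.- t ≡ ℤ.- (p ℤ.+ q ℤ.- r ℤ.- t)
        negated = ℤ-solver.solve-∀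

      crossing : IsCrossing s (□ i j) (□ i (suc j)) (□ i b) (□ (suc i) j) (□ a j)
      crossing = record
        { out-arrows = out-row
        ; in-arrows  = in-row
        ; n≢e        = north≢east a<n b<n
        ; n≢w        = north≢west a<n b<n
        ; s≢e        = south≢east a<n b<n
        ; s≢w        = south≢west a<n b<n
        }

      away : ∀ {p q} → p ≤ N → q ≤ N → (p , q) ≢ (i , j) → □ i j ≢ □ p q
      away p≤ q≤ ne e = let (e₁ , e₂) = □-injective int p≤ q≤ (sym e) in ne (cong₂ _,_ e₁ e₂)

      module _ {τ′ : ℕ → ℕ → ℕ} (lo≤ : ∣ i - j ∣ ≤ τ i j) (raised : τ′ i j ≡ 2 + τ i j)
        (kept : ∀ p q → p ≤ N → q ≤ N → (p , q) ≢ (i , j) → τ′ p q ≡ τ p q) where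

        height-change : ∀ p q → p ≤ N → q ≤ N → + τ′ p q ≡ + τ p q ℤ.+ + 2 ℤ.* δ i j p q
        height-change p q p≤ q≤ with Product.≡-dec ℕ._≟_ ℕ._≟_ (p , q) (i , j)
        ... | yes refl = trans (cong +_ (trans raised (ℕ.+-comm 2 (τ i j))))
            (cong (λ z → + τ i j ℤ.+ + 2 ℤ.* z) (sym (δ-point i j)))
        ... | no ne    = trans (cong +_ (kept p q p≤ q≤ ne)) (sym (trans
              (cong (λ z → + τ p q ℤ.+ + 2 ℤ.* z) (δ-elsewhere {i} {j} {p} {q} ne)) (ℤ.+-identityʳ _)))

        next-arrows : ∀ v w → + 2 ℤ.* arrows (mutate (□ i j) s) v w ≡
          + 2 ℤ.* outerArrows v w ℤ.+ form n (λ i j → + τ′ i j) (squareArrows v w)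
        next-arrows v w = begin
          + 2 ℤ.* arrows (mutate (□ i j) s) v w
            ≡⟨ cong (+ 2 ℤ.*_) (IsCrossing.mutate-arrows crossing
                 (away i≤N (s≤s b<n) λ e → ℕ.1+n≢n (cong proj₂ e))
                 (away i≤N (ℕ.<⇒≤ j≤N) λ e → ℕ.1+n≢n (sym (cong proj₂ e)))
                 (away (s≤s a<n) j≤N λ e → ℕ.1+n≢n (cong proj₁ e))
                 (away (ℕ.<⇒≤ i≤N) j≤N λ e → ℕ.1+n≢n (sym (cong proj₁ e))) v w) ⟩
          + 2 ℤ.* (arrows s v w ℤ.+ change)
            ≡⟨ ℤ.*-distribˡ-+ (+ 2) (arrows s v w) change ⟩
          + 2 ℤ.* arrows s v w ℤ.+ + 2 ℤ.* change
            ≡⟨ cong₂ ℤ._+_ (arrows≡ v w) (cong (+ 2 ℤ.*_) (sym (form-δ n (squareArrows v w) a b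
                (squareArrows-skew v w) a<n b<n))) ⟩
          + 2 ℤ.* outerArrows v w ℤ.+ form n (λ i j → + τ i j) (squareArrows v w) ℤ.+ + 2 ℤ.* form n
              (δ i j) (squareArrows v w)
            ≡⟨ ℤ.+-assoc (+ 2 ℤ.* outerArrows v w) _ _ ⟩
          + 2 ℤ.* outerArrows v w ℤ.+ (form n (λ i j → + τ i j) (squareArrows v w) ℤ.+ + 2 ℤ.* form n
              (δ i j) (squareArrows v w))
            ≡⟨ cong (ℤ._+_ (+ 2 ℤ.* outerArrows v w)) (trans
                 (sym (form-+2* n (λ i j → + τ i j) (δ i j) (squareArrows v w)))
                 (form-cong n {A = squareArrows v w} (λ p q p≤ q≤ → sym (height-change p q p≤ q≤))
                     (λ _ _ _ _ _ _ _ _ → refl))) ⟩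
          + 2 ℤ.* outerArrows v w ℤ.+ form n (λ i j → + τ′ i j) (squareArrows v w) ∎
          where
          change = IsCrossing.change crossing v w

        -- A weight at the raised height has both middle coordinates positive.
        raised-value : ∀ w₀₀ w₁₀ w₁₁ w₀₁ → w₀₀ + w₁₀ + w₁₁ + w₀₁ ≡ N → i ≡ w₁₀ + w₁₁ → j ≡ w₀₁ + w₁₁ →
          2 + τ i j ≡ w₁₀ + w₀₁ → cluster (mutate (□ i j) s) (□ i j) hasValue weighted w₀₀ w₁₀ w₁₁ w₀₁
        raised-value α zero γ w₀₁ sum p q t = contradiction lo≤ (ℕ.<⇒≱ (subst (τ i j <_)
          (sym (trans (cong₂ ∣_-_∣ p (trans q (ℕ.+-comm w₀₁ γ))) (trans (ℕ.∣m-m+n∣≡n γ w₀₁) (sym t))))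
              (ℕ.n≤1+n _)))
        raised-value α (suc β) γ zero sum p q t = contradiction lo≤ (ℕ.<⇒≱ (subst (τ i j <_)
          (sym (trans (trans (cong₂ ∣_-_∣ (trans p (ℕ.+-comm (suc β) γ)) q)
              (trans (ℕ.∣-∣-comm (γ + suc β) γ) (ℕ.∣m-m+n∣≡n γ (suc β))))
            (trans (sym (ℕ.+-identityʳ (suc β))) (sym t)))) (ℕ.n≤1+n _)))
        -- The six points are the vertices of an octahedron: over the common weights α, β, γ, δ
        -- there is one unit more for two of the four corners. The old point has it for 00 and 11,
        -- the new one for 10 and 01, north for 11 and 01, south for 00 and 10, east for 10 and 11,
        -- west for 00 and 01.
        raised-value α (suc β) γ (suc δ) sum p q t = IsCrossing.mutate-hasValue crossing (vertices-unique n)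
          (north∈ a<n b<n) (south∈ a<n b<n) (east∈ a<n b<n) (west∈ a<n b<n) (weighted α (suc β) γ (suc δ))
          (values (suc α) β (suc γ) δ (trans (sum₁ α β γ δ) sum) (trans p (sym (ℕ.+-suc β γ)))
              (trans q (sym (ℕ.+-suc δ γ))) t₀)
          (values α β (suc γ) (suc δ) (trans (sum₂ α β γ δ) sum) (trans p (sym (ℕ.+-suc β γ)))
              (trans (cong suc q) (sym (ℕ.+-suc (suc δ) γ)))
            (trans northHeight (trans (cong suc t₀) (sym (ℕ.+-suc β δ)))))
          (values (suc α) (suc β) γ δ (trans (sum₃ α β γ δ) sum) p (ℕ.suc-injective q)
              (trans southHeight (cong suc t₀)))
          (values α (suc β) (suc γ) δ (trans (sum₄ α β γ δ) sum) (trans (cong suc p)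
              (sym (ℕ.+-suc (suc β) γ))) (trans q (sym (ℕ.+-suc δ γ)))
            (trans eastHeight (cong suc t₀)))
          (values (suc α) β γ (suc δ) (trans (sum₅ α β γ δ) sum) (ℕ.suc-injective p) q
            (trans westHeight (trans (cong suc t₀) (sym (ℕ.+-suc β δ)))))
          (weighted-octahedron ptolemy α β γ δ)
          where
          t₀ : τ i j ≡ β + δ
          t₀ = ℕ.suc-injective (ℕ.suc-injective (trans t (cong suc (ℕ.+-suc β δ))))
          sum₁ : ∀ α β γ δ → suc α + β + suc γ + δ ≡ α + suc β + γ + suc δ
          sum₁ = ℕ-solver.solve-∀
          sum₂ : ∀ α β γ δ → α + β + suc γ + suc δ ≡ α + suc β + γ + suc δ
          sum₂ = ℕ-solver.solve-∀
          sum₃ : ∀ α β γ δ → suc α + suc β + γ + δ ≡ α + suc β + γ + suc δ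
          sum₃ = ℕ-solver.solve-∀
          sum₄ : ∀ α β γ δ → α + suc β + suc γ + δ ≡ α + suc β + γ + suc δ
          sum₄ = ℕ-solver.solve-∀
          sum₅ : ∀ α β γ δ → suc α + β + γ + suc δ ≡ α + suc β + γ + suc δ
          sum₅ = ℕ-solver.solve-∀

        nextState : State (mutate (□ i j) s) τ′
        nextState = record
          { arrows≡ = next-arrows
          ; values  = next-values
          ; others  = λ v v≢ → trans (mutate-cluster s (v≢ i j int)) (others v v≢)
          }
          where
          next-values : ∀ {p q} w₀₀ w₁₀ w₁₁ w₀₁ → w₀₀ + w₁₀ + w₁₁ + w₀₁ ≡ N → p ≡ w₁₀ + w₁₁ → q ≡ w₀₁ + w₁₁ →
            τ′ p q ≡ w₁₀ + w₀₁ → cluster (mutate (□ i j) s) (□ p q) hasValue weighted w₀₀ w₁₀ w₁₁ w₀₁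
          next-values {p} {q} w₀₀ w₁₀ w₁₁ w₀₁ sum pe qe t with Product.≡-dec ℕ._≟_ ℕ._≟_ (p , q) (i , j)
          ... | yes refl = raised-value w₀₀ w₁₀ w₁₁ w₀₁ sum pe qe (trans (sym raised) t)
          ... | no ne = subst (_hasValue weighted w₀₀ w₁₀ w₁₁ w₀₁)
              (sym (mutate-cluster s (away p≤N q≤N ne ∘ sym)))
                (values w₀₀ w₁₀ w₁₁ w₀₁ sum pe qe (trans (sym (kept p q p≤N q≤N ne)) t))
            where
            p≤N : p ≤ N
            p≤N = subst₂ _≤_ (sym pe) (trans (shuffle w₀₀ w₁₀ w₁₁ w₀₁) sum) (ℕ.m≤m+n (w₁₀ + w₁₁) (w₀₀ + w₀₁))
              where
              shuffle : ∀ x y z w → y + z + (x + w) ≡ x + y + z + w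
              shuffle = ℕ-solver.solve-∀
            q≤N : q ≤ N
            q≤N = subst₂ _≤_ (sym qe) (trans (shuffle w₀₀ w₁₀ w₁₁ w₀₁) sum) (ℕ.m≤m+n (w₀₁ + w₁₁) (w₀₀ + w₁₀))
              where
              shuffle : ∀ x y z w → w + z + (x + y) ≡ x + y + z + w
              shuffle = ℕ-solver.solve-∀

    open Rounds n using (InRound; height; height-start; height-end; height-before; height-neighbour; height-raised;
                         height-kept; round; round-unique; round-sound; round-complete; round-interior)

    bump : ℕ × ℕ → (ℕ → ℕ → ℕ) → ℕ → ℕ → ℕ
    bump z τ p q with Product.≡-dec ℕ._≟_ ℕ._≟_ (p , q) z
    ... | yes _ = 2 + τ p q
    ... | no _  = τ p q

    bump-at : ∀ {z} τ → bump z τ (proj₁ z) (proj₂ z) ≡ 2 + τ (proj₁ z) (proj₂ z)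
    bump-at {z} τ with Product.≡-dec ℕ._≟_ ℕ._≟_ z z
    ... | yes _ = refl
    ... | no ne = contradiction refl ne

    bump-away : ∀ {z} τ {p q} → (p , q) ≢ z → bump z τ p q ≡ τ p q
    bump-away {z} τ {p} {q} ne with Product.≡-dec ℕ._≟_ ℕ._≟_ (p , q) z
    ... | yes e = contradiction e ne
    ... | no _  = refl

    □ₚ : ℕ × ℕ → Vertex t m
    □ₚ (i , j) = □ i j

    -- `xs` are the points of the round still to be mutated, `τ` is the current surface and `τ′` the
    -- one after the round. Neighbours of a point of the round are outside the round and keep their
    -- heights during it, so the remaining points stay local minima and any order of the mutations
    -- works.
    roundState : ∀ {r} → r < n → ∀ {τ τ′} xs {s} → Unique xs → State s τ →
      (∀ {x} → x ∈ xs → (proj₁ x ≤ N × proj₂ x ≤ N) × InRound r x) →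
      (∀ {x} → x ∈ xs → τ (proj₁ x) (proj₂ x) ≡ r) →
      (∀ p q → ¬ InRound r (p , q) → p ≤ N → q ≤ N → τ p q ≡ height r p q) →
      (∀ {x} → x ∈ xs → τ′ (proj₁ x) (proj₂ x) ≡ 2 + τ (proj₁ x) (proj₂ x)) →
      (∀ p q → p ≤ N → q ≤ N → (p , q) ∉ xs → τ′ p q ≡ τ p q) →
      State (mutateAll (map □ₚ xs) s) τ′
    roundState r<n [] unique state _ _ _ _ kept = record
      { arrows≡ = λ v w → trans (arrows≡ v w) (cong (ℤ._+_ (+ 2 ℤ.* outerArrows v w))
          (form-cong n {A = squareArrows v w} (λ p q p≤ q≤ → cong +_ (sym (kept p q p≤ q≤ λ ())))
              (λ _ _ _ _ _ _ _ _ → refl)))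
      ; values  = λ {p} {q} w₀₀ w₁₀ w₁₁ w₀₁ sum pe qe t → values w₀₀ w₁₀ w₁₁ w₀₁ sum pe qe
          (trans (sym (kept p q
          (subst₂ _≤_ (sym pe) (trans (shuffle w₀₀ w₁₀ w₁₁ w₀₁) sum) (ℕ.m≤m+n (w₁₀ + w₁₁) (w₀₀ + w₀₁)))
          (subst₂ _≤_ (sym qe) (trans (shuffle′ w₀₀ w₁₀ w₁₁ w₀₁) sum) (ℕ.m≤m+n (w₀₁ + w₁₁) (w₀₀ + w₁₀)))
              λ ())) t)
      ; others  = others
      }
      where
      open State state
      shuffle : ∀ x y z w → y + z + (x + w) ≡ x + y + z + w
      shuffle = ℕ-solver.solve-∀
      shuffle′ : ∀ x y z w → w + z + (x + y) ≡ x + y + z + w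
      shuffle′ = ℕ-solver.solve-∀
    roundState {r} r<n {τ} {τ′} (z ∷ xs) {s} (z∉ ∷ unique) state sound before off raised kept =
      roundState r<n {bump z τ} xs unique (step z (sound (here refl)) (before (here refl)))
        (sound ∘ there)
        (λ x∈ → trans (bump-away τ (fresh x∈)) (before (there x∈)))
        (λ p q ¬in p≤ q≤ → trans (bump-away τ λ { refl → ¬in (proj₂ (sound (here refl))) })
            (off p q ¬in p≤ q≤))
        (λ x∈ → trans (raised (there x∈)) (cong (λ y → suc (suc y)) (sym (bump-away τ (fresh x∈)))))
        kept′
      where
      fresh : ∀ {x} → x ∈ xs → x ≢ z
      fresh x∈ refl = All.lookup z∉ x∈ refl
      kept′ : ∀ p q → p ≤ N → q ≤ N → (p , q) ∉ xs → τ′ p q ≡ bump z τ p q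
      kept′ p q p≤ q≤ ∉xs with Product.≡-dec ℕ._≟_ ℕ._≟_ (p , q) z
      ... | yes refl = raised (here refl)
      ... | no ne    = kept p q p≤ q≤ λ { (here e) → ne e ; (there x∈) → ∉xs x∈ }
      step : ∀ z → (proj₁ z ≤ N × proj₂ z ≤ N) × InRound r z → τ (proj₁ z) (proj₂ z) ≡ r →
        State (mutate (□ₚ z) s) (bump z τ)
      step (i , j) ((i≤N , j≤N) , inRound) at with round-interior r<n i≤N j≤N inRound
      step (suc a , suc b) ((i≤N , j≤N) , inRound) at | (_ , a<n) , (_ , b<n) =
        nextState state a<n b<n
          (neighbour (suc a) (suc (suc b)) i≤N (s≤s b<n) (swap (∣-∣-stepʳ (suc a) (suc b)))
              (dev-up (ℕ.+-suc (suc a) (suc b))))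
          (neighbour (suc a) b i≤N (ℕ.<⇒≤ j≤N) (∣-∣-stepʳ (suc a) b) (dev-down (ℕ.+-suc (suc a) b)))
          (neighbour (suc (suc a)) (suc b) (s≤s a<n) j≤N (∣-∣-step (suc a) (suc b)) (dev-up refl))
          (neighbour a (suc b) (ℕ.<⇒≤ i≤N) j≤N (swap (∣-∣-step a (suc b))) (dev-down refl))
          (subst (∣ suc a - suc b ∣ ≤_) (sym at) (proj₁ (proj₂ inRound)))
          (bump-at {suc a , suc b} τ)
          (λ p q _ _ ne → bump-away τ ne)
        where
        Adjacent : ℕ → ℕ → Set
        Adjacent x y = x ≡ suc y ⊎ y ≡ suc x
        swap : ∀ {x y} → Adjacent x y → Adjacent y x
        swap (inj₁ e) = inj₂ e
        swap (inj₂ e) = inj₁ e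
        ∣-∣-stepʳ : ∀ p q → Adjacent (∣ p - q ∣) (∣ p - suc q ∣)
        ∣-∣-stepʳ p q = swap (subst₂ Adjacent (ℕ.∣-∣-comm (suc q) p) (ℕ.∣-∣-comm q p) (∣-∣-step q p))
        dev-up : ∀ {x} → x ≡ suc (suc a + suc b) → Adjacent (∣ x - N ∣) (∣ suc a + suc b - N ∣)
        dev-up refl = ∣-∣-step (suc a + suc b) N
        dev-down : ∀ {x} → suc a + suc b ≡ suc x → Adjacent (∣ x - N ∣) (∣ suc a + suc b - N ∣)
        dev-down {x} e = swap (subst (λ y → Adjacent (∣ y - N ∣) (∣ x - N ∣)) (sym e) (∣-∣-step x N))
        neighbour : ∀ p q → p ≤ N → q ≤ N → Adjacent (∣ p - q ∣) (∣ suc a - suc b ∣) →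
          Adjacent (∣ p + q - N ∣) (∣ suc a + suc b - N ∣) → τ p q ≡ suc (τ (suc a) (suc b))
        neighbour p q p≤ q≤ lo-step dev-step = let (e , ¬in) = height-neighbour r<n {suc a , suc b} inRound {p} {q} lo-step dev-step in
          trans (off p q ¬in p≤ q≤) (trans e (cong suc (sym at)))

    -- `applyUpTo` recurs by shifting its function, so the induction generalises over `f`: the
    -- condition `f y ≡ r + y` says that the `l` rounds still to come start with `r`.
    allRounds : ∀ l r f {s} → (∀ y → f y ≡ r + y) → r + l ≡ n → State s (height r) →
      State (mutateAll (concatMap (λ r → map □ₚ (round {t} {m} r)) (applyUpTo f l)) s) (height n)
    allRounds zero    r f {s} _ r≡n state = subst (λ r → State s (height r))
        (trans (sym (ℕ.+-identityʳ r)) r≡n) state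
    allRounds (suc l) r f {s} f≡ r+l≡n state =
      subst (λ q → State q (height n))
        (sym (List.foldl-++ (λ s k → mutate k s) s (map □ₚ (round {t} {m} (f 0)))
            (concatMap (λ r → map □ₚ (round {t} {m} r)) (applyUpTo (f ∘ suc) l))))
        (allRounds l (suc r) (f ∘ suc) (λ y → trans (f≡ (suc y)) (ℕ.+-suc r y))
            (trans (sym (ℕ.+-suc r l)) r+l≡n)
          (subst (λ q → State (mutateAll (map □ₚ (round {t} {m} q)) s) (height (suc r)))
              (sym (trans (f≡ 0) (ℕ.+-identityʳ r)))
            (roundState r<n (round {t} {m} r) (round-unique {t} {m} r) state
              (λ x∈ → round-sound {t} {m} x∈)
              (λ {x} x∈ → height-before r<n {x} (proj₂ (round-sound {t} {m} x∈)))
              (λ _ _ _ _ _ → refl)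
              (λ {x} x∈ → height-raised r<n {x} (proj₂ (round-sound {t} {m} x∈)))
              (λ p q p≤ q≤ ∉round → height-kept r<n p≤ q≤ (∉round ∘ round-complete {t} {m} p≤ q≤)))))
      where
      r<n : r < n
      r<n = subst (r <_) r+l≡n (ℕ.m<m+n r (s≤s z≤n))

    flippedSeed : Seed
    flippedSeed = mutateAll (concatMap (λ r → map (λ (i , j) → Cluster.square n h k χ i j)
        (round {t} {m} r)) (upTo n)) s₀

    endState : State flippedSeed (height n)
    endState = subst (λ sq → State (mutateAll (concatMap (λ r → map (λ (i , j) → sq i j)
        (round {t} {m} r)) (upTo n)) s₀) (height n))
      □≡square (allRounds n 0 id (λ _ → refl) refl (record
        { arrows≡ = λ v w → trans (arrows≡ v w) (cong (ℤ._+_ (+ 2 ℤ.* outerArrows v w))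
            (form-cong n {A = squareArrows v w} (λ p q _ _ → cong +_ (sym (height-start {p} {q})))
                (λ _ _ _ _ _ _ _ _ → refl)))
        ; values  = λ {p} {q} w₀₀ w₁₀ w₁₁ w₀₁ sum pe qe e → values w₀₀ w₁₀ w₁₁ w₀₁ sum pe qe
            (trans (sym (height-start {p} {q})) e)
        ; others  = others
        }))
      where open State startState

    flipped-arrows : ∀ v w → arrows flippedSeed v w ≡ quiver (quiverArrows χ′) v w
    flipped-arrows v w = ℤ.*-cancelˡ-≡ (+ 2) _ _ (trans (State.arrows≡ endState v w) (trans
      (cong (ℤ._+_ (+ 2 ℤ.* outerArrows v w))
        (form-cong n {A = squareArrows v w} (λ p q p≤ q≤ → cong +_ (height-end p≤ q≤))
            (λ _ _ _ _ _ _ _ _ → refl)))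
      (sym (quiver-end v w))))

    x′ : Side t → ℚ
    x′ = replace h k ℓ (x (prev h)) (x (next k)) ℓ (x (prev k)) (x (next h)) x

    x′≡ : ∀ {s} (v : SideView h k s) → x′ s ≡ replaced h k ℓ (x (prev h)) (x (next k)) ℓ (x (prev k))
        (x (next h)) x v
    x′≡ v = replace≡replaced h k h≢k v

    triangleVariable-cong : ∀ (s : Side t) {y : Side t → ℚ} a b c {p q r} → y s ≡ p → y (next s) ≡ q → y
        (prev s) ≡ r →
      triangleVariable y s a b c ≡ p ^ℚ (a ℕ.* b) ℚ.* (q ^ℚ (b ℕ.* c) ℚ.* r ^ℚ (c ℕ.* a))
    triangleVariable-cong s a b c refl refl refl = refl

    flipped-values : ∀ s a b c → a + b + c ≡ N → cluster flippedSeed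
        (χ′ s a b c) hasValue triangleVariable x′ s a b c
    flipped-values s a b c sum with cover s a b c
    -- The triangle at `h` is the upper face on which the weight of 11 vanishes; `A`, `B`, `C` are
    -- the weights of 01, 10 and 00.
    ... | inH A B C e f = subst₂ _hasValue_ (cong (cluster flippedSeed) (sym f)) value
        (State.values endState C B 0 A (trans (shuffle A B C) sumA) (sym (ℕ.+-identityʳ B))
            (sym (ℕ.+-identityʳ A))
          (trans (height-end (proj₁ bounds) (proj₂ bounds)) (trans (cong (N ∸_) (ℕ.m≤n⇒∣m-n∣≡n∸m B+A≤N))
              (ℕ.m∸[m∸n]≡n B+A≤N))))
      where
      sumA = covered-sum s h sum e
      bounds = below-bounds A B C sumA
      shuffle : ∀ p q r → r + q + 0 + p ≡ p + q + r
      shuffle = ℕ-solver.solve-∀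
      B+A≤N : B + A ≤ N
      B+A≤N = ℕ.m+n≤o⇒m≤o (B + A) {C} (ℕ.≤-reflexive (trans (cong (_+ C) (ℕ.+-comm B A)) sumA))
      value : weighted C B 0 A ≡ triangleVariable x′ s a b c
      value = trans reorder (sym (trans (position-cong (triangleVariable-rotation x′) {s} {s′ = h} e)
        (triangleVariable-cong h {x′} A B C (x′≡ h₀) (x′≡ h₁) (x′≡ h₂))))
        where
        reorder : weighted C B 0 A ≡ ℓ ^ℚ (A ℕ.* B) ℚ.* (x (prev h) ^ℚ (B ℕ.* C) ℚ.* x (next k) ^ℚ (C ℕ.* A))
        reorder rewrite ℕ.*-zeroʳ C | ℕ.*-zeroʳ A | ℕ.*-comm B A | ℕ.*-comm C B =
          solve 3 (λ p q r → p :* con 1ℚ :* (q :* con 1ℚ) :* (r :* con 1ℚ) := p :* (q :* r)) refl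
            (ℓ ^ℚ (A ℕ.* B)) (x (prev h) ^ℚ (B ℕ.* C)) (x (next k) ^ℚ (C ℕ.* A))
          where open ℚ-solver.+-*-Solver
    -- Here the weight of 00 vanishes, and `A`, `B`, `C` are the weights of 10, 01 and 11.
    ... | inK A B C e f = subst₂ _hasValue_ (cong (cluster flippedSeed) (sym f)) value
        (State.values endState 0 A C B (trans (shuffle A B C) sumA) refl refl
          (trans (height-end (proj₁ bounds) (proj₂ bounds)) (trans (cong (N ∸_) dev≡C) N∸C)))
      where
      sumA = covered-sum s k sum e
      bounds = above-bounds A B C sumA
      shuffle : ∀ p q r → 0 + p + r + q ≡ p + q + r
      shuffle = ℕ-solver.solve-∀
      total : ∀ p q r → p + r + (q + r) ≡ p + q + r + r
      total = ℕ-solver.solve-∀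
      dev≡C : ∣ A + C + (B + C) - N ∣ ≡ C
      dev≡C = trans (cong (λ y → ∣ y - N ∣) (trans (total A B C) (cong (_+ C) sumA)))
        (trans (ℕ.∣-∣-comm (N + C) N) (ℕ.∣m-m+n∣≡n N C))
      N∸C : N ∸ C ≡ A + B
      N∸C = trans (cong (_∸ C) (sym sumA)) (ℕ.m+n∸n≡m (A + B) C)
      value : weighted 0 A C B ≡ triangleVariable x′ s a b c
      value = trans reorder (sym (trans (position-cong (triangleVariable-rotation x′) {s} {s′ = k} e)
        (triangleVariable-cong k {x′} A B C (x′≡ k₀) (x′≡ k₁) (x′≡ k₂))))
        where
        reorder : weighted 0 A C B ≡ ℓ ^ℚ (A ℕ.* B) ℚ.* (x (prev k) ^ℚ (B ℕ.* C) ℚ.* x (next h) ^ℚ (C ℕ.* A))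
        reorder =
          solve 3 (λ p q r → p :* con 1ℚ :* (con 1ℚ :* r) :* (con 1ℚ :* q) := p :* (q :* r)) refl
            (ℓ ^ℚ (A ℕ.* B)) (x (prev k) ^ℚ (B ℕ.* C)) (x (next h) ^ℚ (C ℕ.* A))
          where open ℚ-solver.+-*-Solver
    ... | out s≢h s≢k f = subst₂ _hasValue_
        (trans (sym (State.others endState (χ s a b c) λ i j int → □-outside int s sum s≢h s≢k))
            (cong (cluster flippedSeed) (sym f)))
        (sym (triangleVariable-cong s {x′} a b c (x′≡ {s} (outside s≢h s≢k))
            (x′≡ {next s} (outside s≢h s≢k)) (x′≡ {prev s} (outside s≢h s≢k))))
        (values₀ s a b c sum)

-- Evaluation after a sequence of flips

-- Ptolemy's relation divides by the value of the arc that is flipped, so the values carry their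
-- positivity along.
ℚ⁺ : Set
ℚ⁺ = ∃ ℚ.Positive

infixl 6 _+⁺_
infixl 7 _*⁺_ _/⁺_
_+⁺_ _*⁺_ _/⁺_ : ℚ⁺ → ℚ⁺ → ℚ⁺
(p , p>0) +⁺ (q , q>0) = p ℚ.+ q , ℚ.pos+pos⇒pos p ⦃ p>0 ⦄ q ⦃ q>0 ⦄
(p , p>0) *⁺ (q , q>0) = p ℚ.* q , ℚ.pos*pos⇒pos p ⦃ p>0 ⦄ q ⦃ q>0 ⦄
(p , p>0) /⁺ (q , q>0) = p ℚ.* 1/q , ℚ.pos*pos⇒pos p ⦃ p>0 ⦄ 1/q ⦃ ℚ.1/pos⇒pos q ⦃ q>0 ⦄ ⦄
  where
  1/q : ℚ
  1/q = ℚ.1/_ q ⦃ ℚ.pos⇒nonZero q ⦃ q>0 ⦄ ⦄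

/⁺-cancel : ∀ p q → proj₁ (p /⁺ q) ℚ.* proj₁ q ≡ proj₁ p
/⁺-cancel (p , _) (q , q>0) = trans (ℚ.*-assoc p _ q)
  (trans (cong (p ℚ.*_) (ℚ.*-inverseˡ q ⦃ ℚ.pos⇒nonZero q ⦃ q>0 ⦄ ⦄)) (ℚ.*-identityʳ p))

replace-natural : ∀ {t} {X Y : Set} (g : X → Y) (h k : Side t) {x₁ x₂ x₃ y₁ y₂ y₃ : X} {f : Side t → X} s →
  g (replace h k x₁ x₂ x₃ y₁ y₂ y₃ f s) ≡ replace h k (g x₁) (g x₂) (g x₃) (g y₁) (g y₂) (g y₃)
      (λ s → g (f s)) s
replace-natural g h k s
  with s ≟ˢ h | s ≟ˢ next h | s ≟ˢ prev h | s ≟ˢ k | s ≟ˢ next k | s ≟ˢ prev k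
... | yes _ | _     | _     | _     | _     | _     = refl
... | no _  | yes _ | _     | _     | _     | _     = refl
... | no _  | no _  | yes _ | _     | _     | _     = refl
... | no _  | no _  | no _  | yes _ | _     | _     = refl
... | no _  | no _  | no _  | no _  | yes _ | _     = refl
... | no _  | no _  | no _  | no _  | no _  | yes _ = refl
... | no _  | no _  | no _  | no _  | no _  | no _  = refl

1^ℚ : ∀ e → 1ℚ ^ℚ e ≡ 1ℚ
1^ℚ zero    = refl
1^ℚ (suc e) = trans (ℚ.*-identityˡ (1ℚ ^ℚ e)) (1^ℚ e)

ι-homo-^ : ∀ m e → ι (m ^ e) ≡ ι m ^ℚ e
ι-homo-^ m zero    = refl
ι-homo-^ m (suc e) = trans (ι-homo-* m (m ^ e)) (cong (ι m ℚ.*_) (ι-homo-^ m e))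

-- The values at the point where all initial variables are 1 of the cluster variables for
-- n = 1, computed by Ptolemy's relation.
edgeVariable⁺ : ∀ {t m} {T T′ : Triangulation t m} → Flips T T′ → Side t → ℚ⁺
edgeVariable⁺ start    _ = 1ℚ , _
edgeVariable⁺ (φ ▷ fl) =
  replace h k ℓ (x (prev h)) (x (next k)) ℓ (x (prev k)) (x (next h)) x
  where
  open Flip fl
  x = edgeVariable⁺ φ
  ℓ = (x (prev h) *⁺ x (prev k) +⁺ x (next h) *⁺ x (next k)) /⁺ x h

edgeVariable : ∀ {t m} {T T′ : Triangulation t m} → Flips T T′ → Side t → ℚ
edgeVariable φ s = proj₁ (edgeVariable⁺ φ s)

triangleVariable-edge : ∀ {t} (x : Side t → ℚ) s a b → triangleVariable x s a b 0 ≡ x s ^ℚ (a * b)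
triangleVariable-edge x s a b rewrite ℕ.*-zeroʳ b =
  trans (cong (x s ^ℚ (a * b) ℚ.*_) (ℚ.*-identityˡ 1ℚ)) (ℚ.*-identityʳ _)

module _ {t m : ℕ} {T : Triangulation t m} where

  record IsEvaluated (n : ℕ) {T′ : Triangulation t m} (φ : Flips T T′) : Set where
    open Cluster {t} {m} n using (arrows; cluster; chartAfter; seedAfter; quiver; quiverArrows)
    open Evaluation {Vertex t m} _≟ᵛ_ (vertices n) using (_hasValue_)
    field
      isChart : TriangulationProperties.IsChart T′ n (chartAfter φ)
      arrows≡ : ∀ v w → arrows (seedAfter φ) v w ≡ quiver (quiverArrows (chartAfter φ)) v w
      values  : ∀ s a b c → a + b + c ≡ suc n →
        cluster (seedAfter φ) (chartAfter φ s a b c) hasValue triangleVariable (edgeVariable φ) s a b c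

    edge-value : ∀ s a b → a + b ≡ suc n →
      cluster (seedAfter φ) (chartAfter φ s a b 0) hasValue (edgeVariable φ s ^ℚ (a * b))
    edge-value s a b sum = subst (λ r → cluster (seedAfter φ) (chartAfter φ s a b 0) hasValue r)
        (triangleVariable-edge (edgeVariable φ) s a b)
      (values s a b 0 (trans (ℕ.+-identityʳ (a + b)) sum))

  -- For n = 1 the two sides of an arc carry the same variable.
  edgeVariable-glued : ∀ {T′} {φ : Flips T T′} → IsEvaluated 1 φ → ∀ {s s′} → Triangulation.Glued T′ s s′ →
    edgeVariable φ s ≡ edgeVariable φ s′
  edgeVariable-glued {T′} {φ} evaluated {s} {s′} g = trans (sym (ℚ.*-identityʳ _)) (trans
    (hasValue-unique (edge-value s 1 1 refl)
      (subst (λ v → cluster (seedAfter φ) v hasValue (edgeVariable φ s′ ^ℚ 1))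
        (sym (TriangulationProperties.IsChart.glue isChart g (s≤s z≤n) (s≤s z≤n) refl))
            (edge-value s′ 1 1 refl)))
    (ℚ.*-identityʳ _))
    where
    open IsEvaluated evaluated
    open Cluster {t} {m} 1 using (cluster; seedAfter)
    open Evaluation {Vertex t m} _≟ᵛ_ (vertices 1) using (_hasValue_; hasValue-unique)

  isEvaluated : ∀ n {T′} (φ : Flips T T′) → IsEvaluated n φ
  isEvaluated n start = record
    { isChart = TriangulationProperties.Initial.initial-isChart T n
    ; arrows≡ = λ _ _ → refl
    ; values  = λ s a b c _ → subst (λ r → generator (initialChart T s a b c) hasValue r) (sym (ones a b c))
        (generator-hasValue (initialChart T s a b c))
    }
    where
    open Cluster {t} {m} n using (generator)
    open Evaluation {Vertex t m} _≟ᵛ_ (vertices n) using (_hasValue_; generator-hasValue)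
    ones : ∀ a b c → 1ℚ ^ℚ (a * b) ℚ.* (1ℚ ^ℚ (b * c) ℚ.* 1ℚ ^ℚ (c * a)) ≡ 1ℚ
    ones a b c rewrite 1^ℚ (a * b) | 1^ℚ (b * c) | 1^ℚ (c * a) = refl
  isEvaluated n {T′} (_▷_ {T₁} φ fl) = record
    { isChart = subst (TriangulationProperties.IsChart T′ n) χ′≡replace isChart′
    ; arrows≡ = λ v w → trans (F.flipped-arrows v w) (cong (λ ψ → quiver (quiverArrows ψ) v w) χ′≡replace)
    ; values  = λ s a b c sum → subst₂ _hasValue_ (cong (λ ψ → cluster F.flippedSeed (ψ s a b c)) χ′≡replace)
        (F.triangleVariable-cong s {F.x′} a b c (natural s) (natural (next s)) (natural (prev s)))
        (F.flipped-values s a b c sum)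
    }
    where
    open Flip fl
    open IsEvaluated (isEvaluated n φ)
    open Cluster {t} {m} n using (cluster; chartAfter; seedAfter; quiver; quiverArrows)
    open Evaluation {Vertex t m} _≟ᵛ_ (vertices n) using (_hasValue_)
    open FlippedChart fl n (chartAfter φ) isChart using (χ′≡replace; isChart′)
    x⁺ = edgeVariable⁺ φ
    numerator⁺ = x⁺ (prev h) *⁺ x⁺ (prev k) +⁺ x⁺ (next h) *⁺ x⁺ (next k)
    module M = FlipMutation fl n (chartAfter φ) isChart
    -- `edgeVariable` is defined on sides, so its agreement on `h` and `k` needs an argument: both
    -- numbers are the value of one cluster variable for n = 1. Hence every n calls on the instance
    -- n = 1 for the shorter sequence of flips.
    x-glued = edgeVariable-glued (isEvaluated 1 φ) glued
    ℓ = proj₁ (numerator⁺ /⁺ x⁺ h)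
    ptolemy = /⁺-cancel numerator⁺ (x⁺ h)
    module F where
      flipped-arrows = M.flipped-arrows (seedAfter φ) arrows≡ (edgeVariable φ) x-glued values ℓ ptolemy
      flippedSeed = M.flippedSeed (seedAfter φ) arrows≡ (edgeVariable φ) x-glued values ℓ ptolemy
      flipped-values = M.flipped-values (seedAfter φ) arrows≡ (edgeVariable φ) x-glued values ℓ ptolemy
      x′ = M.x′ (seedAfter φ) arrows≡ (edgeVariable φ) x-glued values ℓ ptolemy
      triangleVariable-cong = λ s {y} → M.triangleVariable-cong (seedAfter φ) arrows≡
          (edgeVariable φ) x-glued values ℓ ptolemy s {y}
    natural : ∀ s → F.x′ s ≡ edgeVariable (φ ▷ fl) s
    natural s = sym (replace-natural proj₁ h k s)

-- The numbers of monomials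

theorem1p3 : ∀ {t m : ℕ} (T T′ : Triangulation t m) (φ : Flips T T′)
    (γ : Homotopy.NonTDiagonal T) (h : Side t) → Homotopy.IsSide T φ h γ →
    ∀ (K : ℕ) (L₁ : Cluster.Laurent {t} {m} 1) →
    Cluster.IsLaurentExpansion 1 L₁ (Cluster.variableOn 1 φ h 1) →
    Cluster.coefficientSum {t} {m} 1 L₁ ≡ + K →
    ∀ (n : ℕ) → 1 ≤ n → ∀ (s : ℕ) → 1 ≤ s → s ≤ n →
    ∀ (L : Cluster.Laurent {t} {m} n) →
    Cluster.IsLaurentExpansion n L (Cluster.variableOn n φ h s) →
    Cluster.coefficientSum {t} {m} n L ≡ + (K ^ (s * (suc n ∸ s)))
theorem1p3 {t} {m} T T′ φ γ h _ K L₁ expansion₁ sum₁ n _ s _ s≤n L expansion =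
  proj₂ (Eₙ.coefficientSum-value {L} expansion (edge-valueₙ h (suc n ∸ s) s
      (ℕ.m∸n+n≡m (ℕ.m≤n⇒m≤1+n s≤n))) (K ^ (s * (suc n ∸ s))))
    (begin
      edgeVariable φ h ^ℚ ((suc n ∸ s) * s)   ≡⟨ cong₂ _^ℚ_ x≡K (ℕ.*-comm (suc n ∸ s) s) ⟩
      ι K ^ℚ (s * (suc n ∸ s))                ≡⟨ ι-homo-^ K (s * (suc n ∸ s)) ⟨
      ι (K ^ (s * (suc n ∸ s)))               ∎)
  where
  module E₁ = Evaluation {Vertex t m} _≟ᵛ_ (vertices 1)
  module Eₙ = Evaluation {Vertex t m} _≟ᵛ_ (vertices n)
  open IsEvaluated (isEvaluated 1 φ) using () renaming (edge-value to edge-value₁)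
  open IsEvaluated (isEvaluated n φ) using () renaming (edge-value to edge-valueₙ)
  -- For n = 1 the variable sits at the middle of the edge, where the exponent is 1 * 1, so that `K`
  -- is the value of the edge itself.
  x≡K : edgeVariable φ h ≡ ι K
  x≡K = trans (sym (ℚ.*-identityʳ _)) (proj₁ (E₁.coefficientSum-value {L₁} expansion₁
      (edge-value₁ h 1 1 refl) K) sum₁)
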